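{- The linear map $\phi:\mathbf{PBT}\to\mathbf{PBT}^*$ defined by $\phi(\mathbf{P}_T)=\mathbf{Q}'_T$ for every binary tree $T$ is a Hopf algebra isomorphism; that is, $\phi$ is bijective, $\phi(\mathbf{P}_{T'}\mathbf{P}_{T''})=\mathbf{Q}'_{T'}\mathbf{Q}'_{T''}$ and $(\phi\otimes\phi)(\Delta\mathbf{P}_T)=\Delta\mathbf{Q}'_T$ for all trees $T,T',T''$.
   Context: For a word $w$, $\mathrm{std}(w)$ is obtained by scanning $w$ left to right and labelling $1,2,\dots$ the occurrences of its smallest letter, then the next smallest, etc. For $\sigma\in S_n$, $\mathbf{F}_\sigma=\sum_{\mathrm{std}(w)=\sigma^{ -1}}w$ in $\mathbb{K}\langle A\rangle$ ($A=\{1<2<\cdots\}$, $\mathbb{K}$ of characteristic $0$); $\mathbf{FQSym}$ is the Hopf algebra they span, with product given by the shifted shuffle and coproduct $\Delta\mathbf{F}_\sigma=\sum_{u\cdot v=\sigma}\mathbf{F}_{\mathrm{std}(u)}\otimes\mathbf{F}_{\mathrm{std}(v)}$. A binary tree is empty or a node with left and right subtrees. $\mathrm{bst}(w)$ is obtained by reading $w$ right to left and inserting each letter $x$: into an empty tree create a node labeled $x$; otherwise insert recursively into the left subtree if $x\le$ root label, into the right subtree if $x>$ root label. $\mathbf{P}_T=\sum_{\mathrm{shape}(\mathrm{bst}(\sigma))=T}\mathbf{F}_\sigma$ for an unlabeled tree $T$; $\mathbf{PBT}$ is the Hopf subalgebra of $\mathbf{FQSym}$ with basis $(\mathbf{P}_T)$,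 $\mathbf{PBT}^*$ its graded dual Hopf algebra and $(\mathbf{Q}_T)$ the basis of $\mathbf{PBT}^*$ dual to $(\mathbf{P}_T)$. For a tree $T$, $\mathbf{Q}'_T=\sum_{\sigma:\ \mathrm{shape}(\mathrm{bst}(\sigma))=T}\mathbf{Q}_{\mathrm{shape}(\mathrm{bst}(\sigma^{ -1}))}$. -}

module Defs where

open import Level using (_⊔_) renaming (suc to lsuc)
open import Data.Nat as ℕ using (ℕ; zero; suc; _≤ᵇ_; _<ᵇ_)
open import Data.Nat.Properties using () renaming (_≟_ to _≟ℕ_)
open import Data.Bool using (Bool; true; false; if_then_else_)
open import Data.List using (List; []; _∷_; _++_; map; concatMap; foldr; length; take; drop; upTo; reverse)
open import Data.Product using (_×_; _,_; Σ; ∃)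
open import Relation.Nullary using (¬_; Dec; yes; no)
open import Relation.Nullary.Decidable using (⌊_⌋)
open import Relation.Binary.PropositionalEquality using (_≡_; refl)
open import Algebra.Bundles using (CommutativeRing)

record Field c ℓ : Set (lsuc (c ⊔ ℓ)) where
  field
    commutativeRing : CommutativeRing c ℓ
  open CommutativeRing commutativeRing public
  field
    0≉1     : ¬ (0# ≈ 1#)
    inverse : ∀ x → ¬ (x ≈ 0#) → Σ Carrier (λ y → (x * y) ≈ 1#)

module _ {c ℓ} (K : Field c ℓ) where
  open Field K using (Carrier; _+_; 0#; 1#)

  fromℕ : ℕ → Carrier
  fromℕ zero    = 0#
  fromℕ (suc n) = 1# + fromℕ n

CharacteristicZero : ∀ {c ℓ} → Field c ℓ → Set ℓ
CharacteristicZero K = ∀ n → ¬ (fromℕ K (suc n) ≈ Field.0# K)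
  where open Field K using (_≈_)

data BT : Set where
  leaf : BT
  node : BT → BT → BT

size : BT → ℕ
size leaf       = 0
size (node l r) = suc (size l ℕ.+ size r)

_≟ᵀ_ : (s t : BT) → Dec (s ≡ t)
leaf ≟ᵀ leaf = yes refl
leaf ≟ᵀ node _ _ = no (λ ())
node _ _ ≟ᵀ leaf = no (λ ())
node l r ≟ᵀ node l' r' with l ≟ᵀ l' | r ≟ᵀ r'
... | yes refl | yes refl = yes refl
... | no ne | _ = no (λ { refl → ne refl })
... | yes _ | no ne = no (λ { refl → ne refl })

treesOfSize : ℕ → List BT
treesOfSize n = go n n
  where
  go : ℕ → ℕ → List BT
  go _       zero    = leaf ∷ []
  go zero    (suc _) = []
  go (suc f) (suc m) =
    concatMap (λ k → concatMap (λ l → map (node l) (go f (m ℕ.∸ k))) (go f k))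
              (upTo (suc m))

-- Words and permutations (a permutation of size n is the word σ(1)…σ(n))

Word : Set
Word = List ℕ

_≟ᵂ_ : (u v : Word) → Dec (u ≡ v)
[] ≟ᵂ [] = yes refl
[] ≟ᵂ (_ ∷ _) = no (λ ())
(_ ∷ _) ≟ᵂ [] = no (λ ())
(x ∷ u) ≟ᵂ (y ∷ v) with x ≟ℕ y | u ≟ᵂ v
... | yes refl | yes refl = yes refl
... | no ne | _ = no (λ { refl → ne refl })
... | yes _ | no ne = no (λ { refl → ne refl })

countLt : ℕ → Word → ℕ
countLt x [] = 0
countLt x (y ∷ w) = (if y <ᵇ x then 1 else 0) ℕ.+ countLt x w

countEq : ℕ → Word → ℕ
countEq x [] = 0
countEq x (y ∷ w) = (if ⌊ y ≟ℕ x ⌋ then 1 else 0) ℕ.+ countEq x w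

std : Word → Word
std w = go [] w
  where
  go : Word → Word → Word
  go pre [] = []
  go pre (x ∷ rest) = suc (countLt x w ℕ.+ countEq x pre) ∷ go (pre ++ (x ∷ [])) rest

insertEverywhere : ℕ → Word → List Word
insertEverywhere x [] = (x ∷ []) ∷ []
insertEverywhere x (y ∷ w) = (x ∷ y ∷ w) ∷ map (y ∷_) (insertEverywhere x w)

perms : ℕ → List Word
perms zero = [] ∷ []
perms (suc n) = concatMap (insertEverywhere (suc n)) (perms n)

-- 1-based position of x in w (0 if absent)
position : ℕ → Word → ℕ
position x [] = 0
position x (y ∷ w) = if ⌊ x ≟ℕ y ⌋ then 1 else (if position x w ≤ᵇ 0 then 0 else suc (position x w))

inverse : Word → Word
inverse σ = map (λ k → position (suc k) σ) (upTo (length σ))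

data LT : Set where
  lleaf : LT
  lnode : LT → ℕ → LT → LT

insertBST : ℕ → LT → LT
insertBST x lleaf = lnode lleaf x lleaf
insertBST x (lnode l y r) = if x ≤ᵇ y then lnode (insertBST x l) y r
                                       else lnode l y (insertBST x r)

bst : Word → LT
bst w = foldr insertBST lleaf w

shape : LT → BT
shape lleaf = leaf
shape (lnode l _ r) = node (shape l) (shape r)

-- a canonical permutation σ with shape (bst σ) ≡ T
canon : BT → Word
canon leaf = []
canon (node l r) = canon l ++ map (λ x → suc (size l) ℕ.+ x) (canon r) ++ (suc (size l) ∷ [])

module FreeModule {c ℓ} (K : Field c ℓ) where
  open Field K using (Carrier; _≈_; _+_; _*_; 0#; 1#)

  FS : Set → Set c
  FS B = List (Carrier × B)

  coeff : {B : Set} → ((a b : B) → Dec (a ≡ b)) → FS B → B → Carrier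
  coeff eq [] b = 0#
  coeff eq ((k , a) ∷ x) b with eq a b
  ... | yes _ = k + coeff eq x b
  ... | no _  = coeff eq x b

  basis : {B : Set} → B → FS B
  basis b = (1# , b) ∷ []

  scale : {B : Set} → Carrier → FS B → FS B
  scale k = map (λ { (k' , b) → (k * k' , b) })

  lin : {B C : Set} → (B → FS C) → FS B → FS C
  lin f = concatMap (λ { (k , b) → scale k (f b) })

  bilin : {B C D : Set} → (B → C → FS D) → FS B → FS C → FS D
  bilin f x y = lin (λ b → lin (λ c' → f b c') y) x

  _⊗_ : {B C : Set} → FS B → FS C → FS (B × C)
  x ⊗ y = bilin (λ b c' → basis (b , c')) x y

  pairEq : {B C : Set} → ((a b : B) → Dec (a ≡ b)) → ((a b : C) → Dec (a ≡ b))
         → (p q : B × C) → Dec (p ≡ q)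
  pairEq e₁ e₂ (a , b) (a' , b') with e₁ a a' | e₂ b b'
  ... | yes refl | yes refl = yes refl
  ... | no ne | _ = no (λ { refl → ne refl })
  ... | yes _ | no ne = no (λ { refl → ne refl })

  -- FQSym : basis (F_σ), σ a permutation (as a word)

  FQSym : Set c
  FQSym = FS Word

  shuffle : Word → Word → List Word
  shuffle [] v = v ∷ []
  shuffle (x ∷ u) [] = (x ∷ u) ∷ []
  shuffle (x ∷ u) (y ∷ v) = map (x ∷_) (shuffle u (y ∷ v)) ++ map (y ∷_) (shuffle (x ∷ u) v)

  mulF : Word → Word → FQSym
  mulF σ τ = map (λ γ → (1# , γ)) (shuffle σ (map (λ x → length σ ℕ.+ x) τ))

  ΔF : Word → FS (Word × Word)
  ΔF σ = map (λ k → (1# , (std (take k σ) , std (drop k σ)))) (upTo (suc (length σ)))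

  -- PBT ⊆ FQSym : elements written in the basis (P_T)

  PBT : Set c
  PBT = FS BT

  P : BT → FQSym
  P T = concatMap (λ σ → if ⌊ shape (bst σ) ≟ᵀ T ⌋ then (1# , σ) ∷ [] else [])
                  (perms (size T))

  -- coefficient of P_T in an element of PBT (given in FQSym):
  -- the coefficient of F_(canon T)
  coeffP : FQSym → BT → Carrier
  coeffP x T = coeff _≟ᵂ_ x (canon T)

  coeffPP : FS (Word × Word) → BT × BT → Carrier
  coeffPP z (A , B) = coeff (pairEq _≟ᵂ_ _≟ᵂ_) z (canon A , canon B)

  -- expansion in the basis (P_T) of an element of FQSym lying in PBT,
  -- homogeneous of degree n
  toP : ℕ → FQSym → PBT
  toP n x = map (λ T → (coeffP x T , T)) (treesOfSize n)

  mulP : BT → BT → PBT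
  mulP T' T'' = toP (size T' ℕ.+ size T'') (bilin mulF (P T') (P T''))

  ΔP : BT → FS (BT × BT)
  ΔP T = concatMap (λ k → concatMap (λ A → map (λ B → (coeffPP (lin ΔF (P T)) (A , B) , (A , B)))
                                                 (treesOfSize (size T ℕ.∸ k)))
                                    (treesOfSize k))
                   (upTo (suc (size T)))

  _≈ᴾ_ : PBT → PBT → Set ℓ
  x ≈ᴾ y = ∀ T → coeff _≟ᵀ_ x T ≈ coeff _≟ᵀ_ y T

  -- PBT* : graded dual, elements written in the dual basis (Q_T)

  PBT* : Set c
  PBT* = FS BT

  mulQ : BT → BT → PBT*
  mulQ A B = map (λ V → (coeff (pairEq _≟ᵀ_ _≟ᵀ_) (ΔP V) (A , B) , V))
                 (treesOfSize (size A ℕ.+ size B))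

  ΔQ : BT → FS (BT × BT)
  ΔQ V = concatMap (λ k → concatMap (λ A → map (λ B → (coeff _≟ᵀ_ (mulP A B) V , (A , B)))
                                                 (treesOfSize (size V ℕ.∸ k)))
                                    (treesOfSize k))
                   (upTo (suc (size V)))

  _·Q_ : PBT* → PBT* → PBT*
  x ·Q y = bilin mulQ x y

  ΔQlin : PBT* → FS (BT × BT)
  ΔQlin = lin ΔQ

  _≈²_ : FS (BT × BT) → FS (BT × BT) → Set ℓ
  x ≈² y = ∀ p → coeff (pairEq _≟ᵀ_ _≟ᵀ_) x p ≈ coeff (pairEq _≟ᵀ_ _≟ᵀ_) y p

  Q′ : BT → PBT*
  Q′ T = concatMap (λ σ → if ⌊ shape (bst σ) ≟ᵀ T ⌋
                             then (1# , shape (bst (inverse σ))) ∷ [] else [])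
                   (perms (size T))

  φ : PBT → PBT*
  φ = lin Q′

  φ⊗φ : FS (BT × BT) → FS (BT × BT)
  φ⊗φ = lin (λ { (A , B) → Q′ A ⊗ Q′ B })

{-# OPTIONS --safe #-}

-- Write b(σ) for the shape of bst(σ) and d(σ) for the shape of the decreasing tree of σ. Both the
-- insertion of σ⁻¹ and the decreasing tree of σ build the treap whose keys are the positions and
-- whose priorities are the values of σ, so d(σ) = b(σ⁻¹), and φ has the symmetric matrix
-- M(T,V) = #{σ : b(σ) = T, d(σ) = V}.
--
-- Product.  b(σ) determines the shapes of bst for the restrictions of σ to the values ≤ k and > k,
-- which gives the structure constants of (P_T).  Dually, the decreasing trees of the shuffles of α
-- with a shift of β depend only on d(α) and d(β), which gives those of (Q_T).  Both sides of
-- φ(P_X P_Y) = Q'_X Q'_Y then count, at Q_V, the permutations δ with d(δ) = V whose restrictions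
-- to the small and the large values have binary search trees of shapes X and Y.
--
-- Coproduct.  As M is symmetric, this is the transpose of the product formula.
--
-- Bijectivity.  Order trees of equal size lexicographically by (size of left subtree, left subtree,
-- right subtree).  Among the σ with d(σ) = V, the shape b(σ) has a least element G(V), where
-- G(node l r) is G(r) with node (G l) leaf grafted at its rightmost leaf.  G is injective, so M is
-- triangular with positive integers on the "diagonal" (G(V), V), invertible in characteristic 0.

module Submission where

open import Defs
open import Data.Nat as ℕ using (ℕ; zero; suc; _≤_; _<_; z≤n; s≤s; z<s; _≤ᵇ_; _<ᵇ_; _∸_; _≤?_; _<?_)
open import Data.Nat.Properties
  using (≤-refl; ≤-trans; ≤-reflexive; <-irrefl; <-trans; <⇒≤; <⇒≢; <⇒≱; ≤⇒≯; ≰⇒>; ≮⇒≥; <-≤-trans; ≤-<-trans;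
    n<1+n; m≤m+n; m≤n+m; +-identityʳ; +-suc; +-comm; +-assoc; +-cancelˡ-≡; +-cancelˡ-<; +-cancelˡ-≤;
    +-monoʳ-≤; +-monoʳ-<; m+n∸m≡n; m+[n∸m]≡n; m<n⇒0<n∸m; m≤n+o⇒m∸n≤o; ≤∧≢⇒<; m≤n⇒m<n∨m≡n; ≤⇒≤ᵇ; ≤ᵇ⇒≤; <⇒<ᵇ;
    <ᵇ⇒<; m<m+n; suc-injective; <-cmp; m∸n≤m; m≤n⇒m⊓n≡m) renaming (_≟_ to _≟ℕ_)
open import Data.Nat.Induction using (<-wellFounded)
open import Induction.WellFounded using (Acc; acc)
open import Data.Bool using (true; false; T; if_then_else_)
open import Data.List
  using (List; []; _∷_; [_]; _++_; _∷ʳ_; map; concatMap; foldr; length; take; drop; filter; upTo; applyUpTo;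
    initLast; InitLast)
open import Data.List.Properties
  using (filter-++; filter-accept; filter-reject; filter-all; filter-none; length-filter; length-++;
    length-map; map-upTo; map-applyUpTo; applyUpTo-∷ʳ; map-++; map-∘; ++-identityʳ; ++-assoc; map-cong-local;
    ∷-injectiveˡ; ∷-injectiveʳ; take++drop≡id; length-take)
open import Data.List.Membership.Propositional using (_∈_; _∉_; find; lose)
open import Data.List.Membership.Propositional.Properties
  using (∈-map⁺; ∈-map⁻; ∈-++⁺ˡ; ∈-++⁺ʳ; ∈-++⁻; ∈-∃++; ∈-filter⁺; ∈-filter⁻; ∈-concatMap⁻; ∈-applyUpTo⁺;
    ∈-applyUpTo⁻; ∈-concatMap⁺)
open import Data.List.Membership.DecPropositional _≟ℕ_ using (_∈?_)
open import Data.List.Relation.Unary.Any using (here; there)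
open import Data.List.Relation.Unary.All as All using (All; []; _∷_)
open import Data.List.Relation.Unary.All.Properties using (++⁺; ++⁻; ¬Any⇒All¬; All¬⇒¬Any)
open import Data.List.Relation.Unary.AllPairs using (AllPairs; []; _∷_)
import Data.List.Relation.Unary.AllPairs.Properties as AllPairs
open import Data.List.Relation.Unary.Unique.Propositional using (Unique)
import Data.List.Relation.Unary.Unique.Propositional.Properties as Unique
open import Data.Product using (_×_; _,_; Σ; ∃; ∃₂; proj₁; proj₂)
open import Data.Sum using (_⊎_; inj₁; inj₂)
open import Data.Unit using (⊤; tt)
open import Function using (_∘_; id; case_of_; _∋_)
open import Relation.Nullary using (¬_; Dec; yes; no; contradiction)
open import Relation.Nullary.Decidable using (⌊_⌋; _×-dec_)
open import Relation.Binary.Definitions using (tri<; tri≈; tri>)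
open import Relation.Binary.PropositionalEquality
  using (_≡_; _≢_; refl; sym; trans; cong; cong₂; subst; subst₂; module ≡-Reasoning; setoid)
open import Data.List.Relation.Binary.Permutation.Propositional
  using (_↭_; ↭-refl; ↭-sym; ↭-trans; prep; ↭-reflexive; ↭⇒↭ₛ)
open import Data.List.Relation.Binary.Permutation.Propositional.Properties using (∈-resp-↭; shift; ++-comm)
import Data.List.Relation.Binary.Permutation.Setoid.Properties as ↭ₛ
import Relation.Binary.Reasoning.Setoid
import Algebra.Properties.CommutativeSemigroup

-- `mulP` and `ΔP` read each coefficient off an element of `FQSym` at a single word, `canon T`.
-- Nothing in these definitions says that another permutation of the same shape would give the same
-- value. This invariance is the real content of the two structure-constant results: `cP-splitsTo`
-- lets any permutation replace the canonical one, and `cΔ-shuffleT` expresses the coefficient by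
-- shapes alone. The rest of both compatibility claims is double counting. Coefficients are written
-- as sums of indicators over `perms`, `shuffle` and `treesOfSize`, each list is shown to contain
-- its members exactly once, and the sums are interchanged. For bijectivity only surjectivity is
-- solved by recursion along the triangular order; injectivity then follows because the symmetric
-- matrix makes `φ` self-adjoint.

≤ᵇ-true : ∀ {x y} → x ≤ y → (x ≤ᵇ y) ≡ true
≤ᵇ-true {x} {y} p with x ≤ᵇ y | ≤⇒≤ᵇ p
... | true | _ = refl

≤ᵇ-false : ∀ {x y} → y < x → (x ≤ᵇ y) ≡ false
≤ᵇ-false {x} {y} p with x ≤ᵇ y in eq
... | false = refl
... | true  = contradiction (≤ᵇ⇒≤ x y (subst T (sym eq) tt)) (<⇒≱ p)

<ᵇ-true : ∀ {x y} → x < y → (x <ᵇ y) ≡ true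
<ᵇ-true {x} {y} p with x <ᵇ y | <⇒<ᵇ p
... | true | _ = refl

<ᵇ-false : ∀ {x y} → y ≤ x → (x <ᵇ y) ≡ false
<ᵇ-false {x} {y} p with x <ᵇ y in eq
... | false = refl
... | true  = contradiction (<ᵇ⇒< x y (subst T (sym eq) tt)) (≤⇒≯ p)

-- Splitting words by value

lo hi : ℕ → Word → Word
lo k = filter (_≤? k)
hi k = filter (k <?_)

lo-∷ : ∀ {k x} w → x ≤ k → lo k (x ∷ w) ≡ x ∷ lo k w
lo-∷ {k} w = filter-accept (_≤? k)

lo-∷-skip : ∀ {k x} w → k < x → lo k (x ∷ w) ≡ lo k w
lo-∷-skip {k} w p = filter-reject (_≤? k) (<⇒≱ p)

hi-∷ : ∀ {k x} w → k < x → hi k (x ∷ w) ≡ x ∷ hi k w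
hi-∷ {k} w = filter-accept (k <?_)

hi-∷-skip : ∀ {k x} w → x ≤ k → hi k (x ∷ w) ≡ hi k w
hi-∷-skip {k} w p = filter-reject (k <?_) (≤⇒≯ p)

lo-all : ∀ {k w} → All (_≤ k) w → lo k w ≡ w
lo-all {k} = filter-all (_≤? k)

lo-none : ∀ {k w} → All (k <_) w → lo k w ≡ []
lo-none {k} = filter-none (_≤? k) ∘ All.map <⇒≱

hi-all : ∀ {k w} → All (k <_) w → hi k w ≡ w
hi-all {k} = filter-all (k <?_)

hi-none : ∀ {k w} → All (_≤ k) w → hi k w ≡ []
hi-none {k} = filter-none (k <?_) ∘ All.map ≤⇒≯

-- Arrangements of an interval of integers

-- General intervals are allowed because the letters of a permutation below or above a cut value
-- again fill an interval. For `s = 0` this agrees with membership in `perms e` (`perms-fills`,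
-- `fills-perms`).
record Fills (s e : ℕ) (w : Word) : Set where
  field
    unique : Unique w
    sound  : ∀ {x} → x ∈ w → s < x × x ≤ e
    full   : ∀ {x} → s < x → x ≤ e → x ∈ w

open Fills

unique-mid : ∀ (u : Word) {x v} → Unique (u ++ x ∷ v) → Unique (u ++ v) × x ∉ u ++ v
unique-mid []      (p ∷ q) = q , All¬⇒¬Any p
unique-mid (y ∷ u) {x} {v} (p ∷ q) with ++⁻ u p | unique-mid u q
... | pu , (y≢x ∷ pv) | q′ , x∉ = (++⁺ pu pv ∷ q′) , λ { (here refl) → y≢x refl ; (there i) → x∉ i }

∈-mid⁺ : ∀ (u : Word) {x y v} → y ∈ u ++ v → y ∈ u ++ x ∷ v
∈-mid⁺ u i with ∈-++⁻ u i
... | inj₁ j = ∈-++⁺ˡ j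
... | inj₂ j = ∈-++⁺ʳ u (there j)

∈-mid⁻ : ∀ (u : Word) {x y v} → y ≢ x → y ∈ u ++ x ∷ v → y ∈ u ++ v
∈-mid⁻ u ne i with ∈-++⁻ u i
... | inj₁ j         = ∈-++⁺ˡ j
... | inj₂ (here p)  = contradiction p ne
... | inj₂ (there j) = ∈-++⁺ʳ u j

∈-insertEverywhere : ∀ {m} δ {w} → w ∈ insertEverywhere m δ → ∃₂ λ u v → w ≡ u ++ m ∷ v × δ ≡ u ++ v
∈-insertEverywhere []      (here refl) = [] , [] , refl , refl
∈-insertEverywhere (y ∷ δ) (here refl) = [] , y ∷ δ , refl , refl
∈-insertEverywhere {m} (y ∷ δ) (there i) with ∈-map⁻ (y ∷_) i
... | w′ , j , refl with ∈-insertEverywhere δ j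
... | u , v , refl , refl = y ∷ u , v , refl , refl

unique-mid⁺ : ∀ (u : Word) {x v} → Unique (u ++ v) → x ∉ u ++ v → Unique (u ++ x ∷ v)
unique-mid⁺ []      q x∉ = ¬Any⇒All¬ _ x∉ ∷ q
unique-mid⁺ (y ∷ u) (p ∷ q) x∉ with ++⁻ u p
... | pu , pv = ++⁺ pu ((λ { refl → x∉ (here refl) }) ∷ pv) ∷ unique-mid⁺ u q (x∉ ∘ there)

-- With `fills-mid⁻` this is the induction step on permutations: `perms` builds its words by
-- inserting the largest letter.
fills-mid⁺ : ∀ u {v n} → Fills 0 n (u ++ v) → Fills 0 (suc n) (u ++ suc n ∷ v)
fills-mid⁺ u {v} {n} F .unique = unique-mid⁺ u (unique F) (λ i → <-irrefl refl (proj₂ (sound F i)))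
fills-mid⁺ u {v} {n} F .sound {x} i with x ≟ℕ suc n
... | yes refl = z<s , ≤-refl
... | no ne with sound F (∈-mid⁻ u ne i)
... | p , q = p , ≤-trans q (<⇒≤ (n<1+n n))
fills-mid⁺ u {v} {n} F .full {x} p q with x ≟ℕ suc n
... | yes refl = ∈-++⁺ʳ u (here refl)
... | no ne    = ∈-mid⁺ u (full F p (ℕ.s≤s⁻¹ (≤∧≢⇒< q ne)))

fills-mid⁻ : ∀ u {v n} → Fills 0 (suc n) (u ++ suc n ∷ v) → Fills 0 n (u ++ v)
fills-mid⁻ u F .unique = proj₁ (unique-mid u (unique F))
fills-mid⁻ u F .sound {x} i with sound F (∈-mid⁺ u i)
... | p , q = p , ℕ.s≤s⁻¹ (≤∧≢⇒< q (λ { refl → proj₂ (unique-mid u (unique F)) i }))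
fills-mid⁻ u {n = n} F .full p q = ∈-mid⁻ u (<⇒≢ (s≤s q)) (full F p (≤-trans q (<⇒≤ (n<1+n n))))

fills-[] : ∀ {s} → Fills s s []
fills-[] .unique = []
fills-[] .sound ()
fills-[] .full p q = contradiction q (<⇒≱ p)

fills-empty : ∀ {s w} → Fills s s w → w ≡ []
fills-empty {w = []}    F = refl
fills-empty {w = x ∷ w} F with sound F (here refl)
... | p , q = contradiction q (<⇒≱ p)

perms-fills : ∀ n {w} → w ∈ perms n → Fills 0 n w
perms-fills zero    (here refl) = fills-[]
perms-fills (suc n) i with find (∈-concatMap⁻ (insertEverywhere (suc n)) {xs = perms n} i)
... | δ , j , k with ∈-insertEverywhere δ k
... | u , v , refl , refl = fills-mid⁺ u (perms-fills n j)

length-mid : ∀ (u : Word) {x v} → length (u ++ x ∷ v) ≡ suc (length (u ++ v))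
length-mid []      = refl
length-mid (y ∷ u) = cong suc (length-mid u)

fills-length : ∀ n {w} → Fills 0 n w → length w ≡ n
fills-length zero    F rewrite fills-empty F = refl
fills-length (suc n) F with ∈-∃++ (full F {suc n} z<s ≤-refl)
... | u , v , refl = trans (length-mid u) (cong suc (fills-length n (fills-mid⁻ u F)))

lo-fills : ∀ {s k e w} → k ≤ e → Fills s e w → Fills s k (lo k w)
lo-fills {k = k} k≤e F .unique = Unique.filter⁺ (_≤? k) (unique F)
lo-fills {k = k} k≤e F .sound i with ∈-filter⁻ (_≤? k) i
... | j , p = proj₁ (sound F j) , p
lo-fills {k = k} k≤e F .full p q = ∈-filter⁺ (_≤? k) (full F p (≤-trans q k≤e)) q

hi-fills : ∀ {s k e w} → s ≤ k → Fills s e w → Fills k e (hi k w)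
hi-fills {k = k} s≤k F .unique = Unique.filter⁺ (k <?_) (unique F)
hi-fills {k = k} s≤k F .sound i with ∈-filter⁻ (k <?_) i
... | j , p = p , proj₂ (sound F j)
hi-fills {k = k} s≤k F .full p q = ∈-filter⁺ (k <?_) (full F (≤-<-trans s≤k p) q) p

fills-shift : ∀ k {s e w} → Fills s e w → Fills (k ℕ.+ s) (k ℕ.+ e) (map (k ℕ.+_) w)
fills-shift k F .unique = Unique.map⁺ (+-cancelˡ-≡ k _ _) (unique F)
fills-shift k F .sound i with ∈-map⁻ (k ℕ.+_) i
... | x , j , refl = +-monoʳ-< k (proj₁ (sound F j)) , +-monoʳ-≤ k (proj₂ (sound F j))
fills-shift k {s} {e} {w} F .full {x} p q = subst (_∈ map (k ℕ.+_) w) eq (∈-map⁺ (k ℕ.+_) (full F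
    (+-cancelˡ-< k _ _ (subst (k ℕ.+ s <_) (sym eq) p)) (+-cancelˡ-≤ k _ _ (subst (_≤ k ℕ.+ e) (sym eq) q))))
  where
  eq : k ℕ.+ (x ∸ k) ≡ x
  eq = m+[n∸m]≡n (≤-trans (m≤m+n k s) (<⇒≤ p))

unshift : ℕ → Word → Word
unshift k = map (_∸ k)

unshift-shift : ∀ k w → unshift k (map (k ℕ.+_) w) ≡ w
unshift-shift k []      = refl
unshift-shift k (x ∷ w) = cong₂ _∷_ (m+n∸m≡n k x) (unshift-shift k w)

shift-unshift : ∀ k {w} → All (k ≤_) w → map (k ℕ.+_) (unshift k w) ≡ w
shift-unshift k []      = refl
shift-unshift k (p ∷ q) = cong₂ _∷_ (m+[n∸m]≡n p) (shift-unshift k q)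

fills-All : ∀ {s e w} → Fills s e w → All (λ x → s < x × x ≤ e) w
fills-All F = All.tabulate (sound F)

-- Injectivity is asked on the letters of `w` alone: neither `_∸ k` nor `rank w` is injective on all
-- of `ℕ`.
unique-map : ∀ {f : ℕ → ℕ} {w} → (∀ {x y} → x ∈ w → y ∈ w → f x ≡ f y → x ≡ y) → Unique w → Unique (map f w)
unique-map inj [] = []
unique-map {f} {x ∷ w} inj (p ∷ q) =
  All.tabulate (λ i e → case ∈-map⁻ f i of λ { (y , j , refl) → All.lookup p j (inj (here refl) (there j) e) })
  ∷ unique-map (λ i j → inj (there i) (there j)) q

fills-unshift : ∀ k {n w} → Fills k (k ℕ.+ n) w → Fills 0 n (unshift k w)
fills-unshift k {n} {w} F .unique = unique-map
  (λ {x} {y} i j e → trans (sym (m+[n∸m]≡n (k≤ i))) (trans (cong (k ℕ.+_) e) (m+[n∸m]≡n (k≤ j)))) (unique F)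
  where
  k≤ : ∀ {x} → x ∈ w → k ≤ x
  k≤ i = <⇒≤ (proj₁ (sound F i))
fills-unshift k F .sound i with ∈-map⁻ (_∸ k) i
... | x , j , refl = m<n⇒0<n∸m (proj₁ (sound F j)) , m≤n+o⇒m∸n≤o x k (proj₂ (sound F j))
fills-unshift k {w = w} F .full {x} p q = subst (_∈ unshift k w) (m+n∸m≡n k x)
  (∈-map⁺ (_∸ k) (full F (m<m+n k p) (+-monoʳ-≤ k q)))

-- Binary search trees

insert-≤ : ∀ {x y l r} → x ≤ y → insertBST x (lnode l y r) ≡ lnode (insertBST x l) y r
insert-≤ p rewrite ≤ᵇ-true p = refl

insert-> : ∀ {x y l r} → y < x → insertBST x (lnode l y r) ≡ lnode l y (insertBST x r)
insert-> p rewrite ≤ᵇ-false p = refl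

-- Insertion runs from the right, so the last letter becomes the root and stays there; it sends
-- every other letter left or right, ties to the left.
bst-snoc : ∀ w y → bst (w ∷ʳ y) ≡ lnode (bst (lo y w)) y (bst (hi y w))
bst-snoc []      y = refl
bst-snoc (x ∷ w) y rewrite bst-snoc w y with x ≤? y
... | yes p rewrite lo-∷ w p | hi-∷-skip w p = insert-≤ p
... | no ¬p rewrite lo-∷-skip w (≰⇒> ¬p) | hi-∷ w (≰⇒> ¬p) = insert-> (≰⇒> ¬p)

-- Recursion along `bst-snoc`. The words `lo y w` and `hi y w` are not structurally smaller, so the
-- view is built by induction on length and carries the views of both.
data BstView : Word → Set where
  empty : BstView []
  root  : ∀ w y → BstView (lo y w) → BstView (hi y w) → BstView (w ∷ʳ y)

bstView : ∀ w → BstView w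
bstView w = go w (<-wellFounded (length w))
  where
  go : ∀ w → Acc _<_ (length w) → BstView w
  go w a with initLast w
  go .[] a | InitLast.[] = empty
  go .(w ∷ʳ y) (acc rs) | w InitLast.∷ʳ′ y =
    root w y (go _ (rs (shorter (length-filter (_≤? y) w)))) (go _ (rs (shorter (length-filter (y <?_) w))))
    where
    shorter : ∀ {m} → m ≤ length w → m < length (w ∷ʳ y)
    shorter p = ≤-<-trans p (≤-reflexive (sym (trans (length-++ w) (+-comm _ 1))))

size-insert : ∀ x t → size (shape (insertBST x t)) ≡ suc (size (shape t))
size-insert x lleaf = refl
size-insert x (lnode l y r) with x ≤ᵇ y
... | true  = cong (λ k → suc (k ℕ.+ size (shape r))) (size-insert x l)
... | false = cong suc (trans (cong (size (shape l) ℕ.+_) (size-insert x r)) (+-suc _ _))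

size-bst : ∀ w → size (shape (bst w)) ≡ length w
size-bst []      = refl
size-bst (x ∷ w) = trans (size-insert x (bst w)) (cong suc (size-bst w))

-- Restriction by value performed on the tree. In a search tree a root above `k` has its whole right
-- subtree above `k`, so `cutLo` drops both; `cutHi` is the mirror case.
cutLo cutHi : ℕ → LT → LT
cutLo k lleaf = lleaf
cutLo k (lnode l y r) = if y ≤ᵇ k then lnode l y (cutLo k r) else cutLo k l
cutHi k lleaf = lleaf
cutHi k (lnode l y r) = if y ≤ᵇ k then cutHi k r else lnode (cutHi k l) y r

cutLo-insert-≤ : ∀ {k x} t → x ≤ k → cutLo k (insertBST x t) ≡ insertBST x (cutLo k t)
cutLo-insert-≤ lleaf p rewrite ≤ᵇ-true p = refl
cutLo-insert-≤ {k} {x} (lnode l y r) p with x ≤? y | y ≤? k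
... | yes a | yes b rewrite insert-≤ {l = l} {r} a | ≤ᵇ-true b = sym (insert-≤ a)
... | yes a | no ¬b rewrite insert-≤ {l = l} {r} a | ≤ᵇ-false (≰⇒> ¬b) = cutLo-insert-≤ l p
... | no ¬a | yes b rewrite insert-> {l = l} {r} (≰⇒> ¬a) | ≤ᵇ-true b | cutLo-insert-≤ r p = sym (insert-> (≰⇒> ¬a))
... | no ¬a | no ¬b = contradiction (≤-trans p (<⇒≤ (≰⇒> ¬b))) ¬a

cutLo-insert-> : ∀ {k x} t → k < x → cutLo k (insertBST x t) ≡ cutLo k t
cutLo-insert-> lleaf p rewrite ≤ᵇ-false p = refl
cutLo-insert-> {k} {x} (lnode l y r) p with x ≤? y | y ≤? k
... | yes a | yes b = contradiction (≤-trans a b) (<⇒≱ p)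
... | yes a | no ¬b rewrite insert-≤ {l = l} {r} a | ≤ᵇ-false (≰⇒> ¬b) = cutLo-insert-> l p
... | no ¬a | yes b rewrite insert-> {l = l} {r} (≰⇒> ¬a) | ≤ᵇ-true b | cutLo-insert-> r p = refl
... | no ¬a | no ¬b rewrite insert-> {l = l} {r} (≰⇒> ¬a) | ≤ᵇ-false (≰⇒> ¬b) = refl

cutHi-insert-≤ : ∀ {k x} t → x ≤ k → cutHi k (insertBST x t) ≡ cutHi k t
cutHi-insert-≤ lleaf p rewrite ≤ᵇ-true p = refl
cutHi-insert-≤ {k} {x} (lnode l y r) p with x ≤? y | y ≤? k
... | yes a | yes b rewrite insert-≤ {l = l} {r} a | ≤ᵇ-true b = refl
... | yes a | no ¬b rewrite insert-≤ {l = l} {r} a | ≤ᵇ-false (≰⇒> ¬b) | cutHi-insert-≤ l p = refl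
... | no ¬a | yes b rewrite insert-> {l = l} {r} (≰⇒> ¬a) | ≤ᵇ-true b = cutHi-insert-≤ r p
... | no ¬a | no ¬b = contradiction (≤-trans p (<⇒≤ (≰⇒> ¬b))) ¬a

cutHi-insert-> : ∀ {k x} t → k < x → cutHi k (insertBST x t) ≡ insertBST x (cutHi k t)
cutHi-insert-> lleaf p rewrite ≤ᵇ-false p = refl
cutHi-insert-> {k} {x} (lnode l y r) p with x ≤? y | y ≤? k
... | yes a | yes b = contradiction (≤-trans a b) (<⇒≱ p)
... | yes a | no ¬b rewrite insert-≤ {l = l} {r} a | ≤ᵇ-false (≰⇒> ¬b) | cutHi-insert-> l p = sym (insert-≤ a)
... | no ¬a | yes b rewrite insert-> {l = l} {r} (≰⇒> ¬a) | ≤ᵇ-true b = cutHi-insert-> r p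
... | no ¬a | no ¬b rewrite insert-> {l = l} {r} (≰⇒> ¬a) | ≤ᵇ-false (≰⇒> ¬b) = sym (insert-> (≰⇒> ¬a))

-- The tree of the small letters is thus a function of the tree of the whole word, which later makes
-- a product coefficient constant on the permutations with one search tree.
bst-lo : ∀ k w → bst (lo k w) ≡ cutLo k (bst w)
bst-lo k []      = refl
bst-lo k (x ∷ w) with x ≤? k
... | yes p rewrite lo-∷ w p = trans (cong (insertBST x) (bst-lo k w)) (sym (cutLo-insert-≤ (bst w) p))
... | no ¬p rewrite lo-∷-skip w (≰⇒> ¬p) = trans (bst-lo k w) (sym (cutLo-insert-> (bst w) (≰⇒> ¬p)))

bst-hi : ∀ k w → bst (hi k w) ≡ cutHi k (bst w)
bst-hi k []      = refl
bst-hi k (x ∷ w) with x ≤? k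
... | yes p rewrite hi-∷-skip w p = trans (bst-hi k w) (sym (cutHi-insert-≤ (bst w) p))
... | no ¬p rewrite hi-∷ w (≰⇒> ¬p) = trans (cong (insertBST x) (bst-hi k w)) (sym (cutHi-insert-> (bst w) (≰⇒> ¬p)))

-- The inorder labelling by consecutive integers from `s + 1` on, the only search-tree labelling of
-- that shape with these labels.
label : ℕ → BT → LT
label s leaf       = lleaf
label s (node l r) = lnode (label s l) (suc (s ℕ.+ size l)) (label (suc (s ℕ.+ size l)) r)

-- The size of the left subtree tells how many letters lie below the root, so when the letters fill
-- an interval the shape fixes every label. The second component supplies this count for the left
-- subtree in the recursion.
bst-label : ∀ {s e w} → s ≤ e → Fills s e w → bst w ≡ label s (shape (bst w)) × s ℕ.+ size (shape (bst w)) ≡ e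
bst-label s≤e F = go (bstView _) s≤e F
  where
  fills-left : ∀ {s y e} w → Fills s e (w ∷ʳ suc y) → Fills s y (lo (suc y) w)
  fills-left {y = y} w F .unique = Unique.filter⁺ (_≤? suc y) (subst Unique (++-identityʳ w) (proj₁ (unique-mid w
      (unique F))))
  fills-left {y = y} w F .sound i with ∈-filter⁻ (_≤? suc y) {xs = w} i
  ... | j , p = proj₁ (sound F (∈-++⁺ˡ j)) , ℕ.s≤s⁻¹ (≤∧≢⇒< p (λ { refl → proj₂ (unique-mid w (unique F)) (∈-++⁺ˡ j) }))
  fills-left {y = y} w F .full {x} p q = ∈-filter⁺ (_≤? suc y)
    (subst (x ∈_) (++-identityʳ w) (∈-mid⁻ w (<⇒≢ (s≤s q)) (full F p (≤-trans (≤-trans q (<⇒≤ (n<1+n y)))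
        (proj₂ (sound F (∈-++⁺ʳ w (here refl))))))))
    (≤-trans q (<⇒≤ (n<1+n y)))

  fills-right : ∀ {s y e} w → Fills s e (w ∷ʳ y) → Fills y e (hi y w)
  fills-right {y = y} w F .unique = Unique.filter⁺ (y <?_) (subst Unique (++-identityʳ w) (proj₁ (unique-mid w
      (unique F))))
  fills-right {y = y} w F .sound i with ∈-filter⁻ (y <?_) {xs = w} i
  ... | j , p = p , proj₂ (sound F (∈-++⁺ˡ j))
  fills-right {y = y} w F .full {x} p q = ∈-filter⁺ (y <?_)
    (subst (x ∈_) (++-identityʳ w) (∈-mid⁻ w (λ { refl → <-irrefl refl p }) (full F (<-trans
        (proj₁ (sound F (∈-++⁺ʳ w (here refl)))) p) q))) p

  label-node : ∀ {s y l r} → l ≡ label s (shape l) → s ℕ.+ size (shape l) ≡ y → r ≡ label (suc y) (shape r) →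
               lnode l (suc y) r ≡ label s (shape (lnode l (suc y) r))
  label-node {s} {l = l} l≡ refl r≡ = cong₂ (λ t r → lnode t (suc (s ℕ.+ size (shape l))) r) l≡ r≡

  go : ∀ {s e w} → BstView w → s ≤ e → Fills s e w → bst w ≡ label s (shape (bst w)) × s ℕ.+ size (shape (bst w)) ≡ e
  go {s} {e} empty s≤e F with m≤n⇒m<n∨m≡n s≤e
  ... | inj₁ s<e = contradiction (full F s<e ≤-refl) (λ ())
  ... | inj₂ refl = refl , +-identityʳ s
  go {s} (root w y v₁ v₂) s≤e F with sound F (∈-++⁺ʳ w (here refl))
  -- The root exceeds `s`, hence is a successor `suc y`; its left subtree fills the values from
  -- `s + 1` to `y`, its right one those from `y + 2` to `e`.
  go {s} {e} (root w (suc y) v₁ v₂) s≤e F | s≤s s≤y , y≤e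
    rewrite bst-snoc w (suc y) with go v₁ s≤y (fills-left w F) | go v₂ y≤e (fills-right w F)
  ... | l≡ , p | r≡ , q =
    label-node {s} l≡ p r≡ ,
    trans (+-suc s _) (trans (cong suc (trans (sym (+-assoc s (size (shape (bst (lo (suc y) w)))) _))
        (cong (ℕ._+ size (shape (bst (hi (suc y) w)))) p))) q)

bst-shape-injective : ∀ {n v w} → Fills 0 n v → Fills 0 n w → shape (bst v) ≡ shape (bst w) → bst v ≡ bst w
bst-shape-injective F G e = trans (proj₁ (bst-label z≤n F)) (trans (cong (label 0) e) (sym (proj₁ (bst-label z≤n G))))

mapLT : (ℕ → ℕ) → LT → LT
mapLT f lleaf         = lleaf
mapLT f (lnode l x r) = lnode (mapLT f l) (f x) (mapLT f r)

shape-mapLT : ∀ f t → shape (mapLT f t) ≡ shape t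
shape-mapLT f lleaf         = refl
shape-mapLT f (lnode l x r) = cong₂ node (shape-mapLT f l) (shape-mapLT f r)

insert-shift : ∀ k x t → insertBST (k ℕ.+ x) (mapLT (k ℕ.+_) t) ≡ mapLT (k ℕ.+_) (insertBST x t)
insert-shift k x lleaf = refl
insert-shift k x (lnode l y r) with x ≤? y
... | yes p rewrite insert-≤ {l = l} {r} p = trans (insert-≤ (+-monoʳ-≤ k p))
    (cong (λ t → lnode t _ _) (insert-shift k x l))
... | no ¬p rewrite insert-> {l = l} {r} (≰⇒> ¬p) = trans (insert-> (+-monoʳ-< k (≰⇒> ¬p)))
    (cong (λ t → lnode _ _ t) (insert-shift k x r))

bst-shift : ∀ k w → bst (map (k ℕ.+_) w) ≡ mapLT (k ℕ.+_) (bst w)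
bst-shift k []      = refl
bst-shift k (x ∷ w) = trans (cong (insertBST (k ℕ.+ x)) (bst-shift k w)) (insert-shift k x (bst w))

shape-bst-shift : ∀ k w → shape (bst (map (k ℕ.+_) w)) ≡ shape (bst w)
shape-bst-shift k w = trans (cong shape (bst-shift k w)) (shape-mapLT _ (bst w))

canon-fills : ∀ T → Fills 0 (size T) (canon T)
canon-fills leaf = fills-[]
canon-fills (node l r) = F
  where
  s : ℕ
  s = suc (size l)
  L : Fills 0 (size l) (canon l)
  L = canon-fills l
  R : Fills s (s ℕ.+ size r) (map (s ℕ.+_) (canon r))
  R = subst (λ k → Fills k (s ℕ.+ size r) (map (s ℕ.+_) (canon r))) (+-identityʳ s) (fills-shift s (canon-fills r))
  F : Fills 0 (size (node l r)) (canon (node l r))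
  F .unique = Unique.++⁺ (unique L) (Unique.++⁺ (unique R) ([] ∷ []) (λ { (i , here refl) → <-irrefl refl
      (proj₁ (sound R i)) }))
    (λ { {x} (i , j) → <⇒≱ (s≤s (proj₂ (sound L i))) (s≤ j) })
    where
    s≤ : ∀ {x} → x ∈ map (s ℕ.+_) (canon r) ++ (s ∷ []) → s ≤ x
    s≤ j with ∈-++⁻ (map (s ℕ.+_) (canon r)) j
    ... | inj₁ i = <⇒≤ (proj₁ (sound R i))
    ... | inj₂ (here refl) = ≤-refl
  F .sound i with ∈-++⁻ (canon l) i
  ... | inj₁ j = proj₁ (sound L j) , ≤-trans (proj₂ (sound L j)) (≤-trans (m≤m+n (size l) (size r)) (<⇒≤ (n<1+n _)))
  ... | inj₂ j with ∈-++⁻ (map (s ℕ.+_) (canon r)) j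
  ...   | inj₁ k = ≤-<-trans z≤n (proj₁ (sound R k)) , proj₂ (sound R k)
  ...   | inj₂ (here refl) = z<s , m≤m+n s (size r)
  F .full {x} p q with <-cmp x s
  ... | tri< x<s _ _ = ∈-++⁺ˡ (full L p (ℕ.s≤s⁻¹ x<s))
  ... | tri≈ _ refl _ = ∈-++⁺ʳ (canon l) (∈-++⁺ʳ (map (s ℕ.+_) (canon r)) (here refl))
  ... | tri> _ _ x>s = ∈-++⁺ʳ (canon l) (∈-++⁺ˡ (full R x>s q))

shape-bst-canon : ∀ T → shape (bst (canon T)) ≡ T
shape-bst-canon leaf = refl
shape-bst-canon (node l r) = begin
  shape (bst (canon l ++ R ++ s ∷ []))
    ≡⟨ cong (shape ∘ bst) (sym (++-assoc (canon l) R (s ∷ []))) ⟩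
  shape (bst ((canon l ++ R) ∷ʳ s))
    ≡⟨ cong shape (bst-snoc (canon l ++ R) s) ⟩
  node (shape (bst (lo s (canon l ++ R)))) (shape (bst (hi s (canon l ++ R))))
    ≡⟨ cong₂ (λ u v → node (shape (bst u)) (shape (bst v))) lo≡ hi≡ ⟩
  node (shape (bst (canon l))) (shape (bst R))
    ≡⟨ cong₂ node (shape-bst-canon l) (trans (shape-bst-shift s (canon r)) (shape-bst-canon r)) ⟩
  node l r ∎
  where
  open ≡-Reasoning
  s : ℕ
  s = suc (size l)
  R : Word
  R = map (s ℕ.+_) (canon r)
  L≤ : All (_≤ s) (canon l)
  L≤ = All.map (λ p → ≤-trans (proj₂ p) (<⇒≤ (n<1+n _))) (fills-All (canon-fills l))
  R> : All (s <_) R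
  R> = All.map (λ {x} p → subst (_< x) (+-identityʳ s) (proj₁ p)) (fills-All (fills-shift s (canon-fills r)))
  lo≡ : lo s (canon l ++ R) ≡ canon l
  lo≡ = trans (filter-++ (_≤? s) (canon l) R) (trans (cong₂ _++_ (lo-all L≤) (lo-none R>)) (++-identityʳ _))
  hi≡ : hi s (canon l ++ R) ≡ R
  hi≡ = trans (filter-++ (s <?_) (canon l) R) (cong₂ _++_ (hi-none L≤) (hi-all R>))

-- Inverses

position-here : ∀ x w → position x (x ∷ w) ≡ 1
position-here x w with x ≟ℕ x
... | yes _ = refl
... | no ne = contradiction refl ne

mutual
  -- `position` returns 0 for an absent letter, so its successor clause fires only once the position
  -- in the tail is known to be positive; hence the mutual induction.
  position-there : ∀ {x y} w → x ≢ y → x ∈ w → position x (y ∷ w) ≡ suc (position x w)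
  position-there {x} {y} w x≢y i with x ≟ℕ y
  ... | yes p = contradiction p x≢y
  ... | no _ rewrite ≤ᵇ-false (position>0 w i) = refl

  position>0 : ∀ {x} w → x ∈ w → 0 < position x w
  position>0 {x} (y ∷ w) i with x ≟ℕ y
  position>0 {x} (y ∷ w) i           | yes refl = z<s
  position>0 {x} (y ∷ w) (here p)    | no ne = contradiction p ne
  position>0 {x} (y ∷ w) (there i)   | no ne rewrite ≤ᵇ-false (position>0 w i) = z<s

position≤length : ∀ {x} w → x ∈ w → position x w ≤ length w
position≤length {x} (y ∷ w) i with x ≟ℕ y
position≤length {x} (y ∷ w) i         | yes refl = s≤s z≤n
position≤length {x} (y ∷ w) (here p)  | no ne = contradiction p ne
position≤length {x} (y ∷ w) (there i) | no ne rewrite ≤ᵇ-false (position>0 w i) = s≤s (position≤length w i)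

position-injective : ∀ {x y} w → x ∈ w → y ∈ w → position x w ≡ position y w → x ≡ y
position-injective {x} {y} (z ∷ w) i j e with x ≟ℕ z | y ≟ℕ z
position-injective (z ∷ w) i j e                 | yes refl | yes refl = refl
position-injective (z ∷ w) i (here q) e          | yes refl | no ne = contradiction q ne
position-injective (z ∷ w) i (there j) e         | yes refl | no ne rewrite ≤ᵇ-false (position>0 w j)
  = contradiction (suc-injective e) (<⇒≢ (position>0 w j))
position-injective (z ∷ w) (here p) j e          | no ne | yes refl = contradiction p ne
position-injective (z ∷ w) (there i) j e         | no ne | yes refl rewrite ≤ᵇ-false (position>0 w i)
  = contradiction (suc-injective (sym e)) (<⇒≢ (position>0 w i))
position-injective (z ∷ w) (here p) j e          | no ne | no ne′ = contradiction p ne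
position-injective (z ∷ w) (there i) (here q) e  | no ne | no ne′ = contradiction q ne′
position-injective (z ∷ w) (there i) (there j) e | no ne | no ne′
  rewrite ≤ᵇ-false (position>0 w i) | ≤ᵇ-false (position>0 w j) = position-injective w i j (suc-injective e)

position-surjective : ∀ {i} w → Unique w → i < length w → ∃ λ x → x ∈ w × position x w ≡ suc i
position-surjective {zero}  (y ∷ w) _ _ = y , here refl , position-here y w
position-surjective {suc i} (y ∷ w) (p ∷ q) (s≤s i<) with position-surjective w q i<
... | x , j , e = x , there j , trans (position-there w (λ { refl → All.lookup p j refl }) j) (cong suc e)

position-++ˡ : ∀ {x} u {v} → x ∈ u → position x (u ++ v) ≡ position x u
position-++ˡ {x} (y ∷ u) {v} i with x ≟ℕ y
position-++ˡ (y ∷ u) i         | yes refl = refl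
position-++ˡ (y ∷ u) (here p)  | no ne = contradiction p ne
position-++ˡ (y ∷ u) {v} (there i) | no ne rewrite position-++ˡ u {v} i = refl

position-++ʳ : ∀ {x} u {v} → x ∉ u → x ∈ v → position x (u ++ v) ≡ length u ℕ.+ position x v
position-++ʳ []      x∉ i = refl
position-++ʳ (y ∷ u) x∉ i = trans (position-there _ (x∉ ∘ here) (∈-++⁺ʳ u i)) (cong suc (position-++ʳ u (x∉ ∘ there) i))

position-map : ∀ {f : ℕ → ℕ} {x} w → (∀ {y} → y ∈ w → f x ≡ f y → x ≡ y) → position (f x) (map f w) ≡ position x w
position-map [] _ = refl
position-map {f} {x} (y ∷ w) inj rewrite position-map {f} {x} w (inj ∘ there) with f x ≟ℕ f y | x ≟ℕ y
... | yes _  | yes _    = refl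
... | yes e  | no ne    = contradiction (inj (here refl) e) ne
... | no ne  | yes refl = contradiction refl ne
... | no _   | no _     = refl

position-applyUpTo : ∀ (f : ℕ → ℕ) n {i} → (∀ {i j} → i < n → j < n → f i ≡ f j → i ≡ j) → i < n →
                     position (f i) (applyUpTo f n) ≡ suc i
position-applyUpTo f (suc n) {zero}  inj i<n = position-here (f 0) (applyUpTo (f ∘ suc) n)
position-applyUpTo f (suc n) {suc i} inj (s≤s i<n) = trans
  (position-there _ (λ e → case inj (s≤s i<n) z<s e of λ ()) (∈-applyUpTo⁺ (f ∘ suc) i<n))
  (cong suc (position-applyUpTo (f ∘ suc) n (λ p q e → suc-injective (inj (s≤s p) (s≤s q) e)) i<n))

applyUpTo-position : ∀ (g : ℕ → ℕ) w → Unique w → (∀ {x i} → x ∈ w → position x w ≡ suc i → g i ≡ x) →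
                     applyUpTo g (length w) ≡ w
applyUpTo-position g []      _ h = refl
applyUpTo-position g (x ∷ w) (p ∷ q) h = cong₂ _∷_ (h (here refl) (position-here x w))
  (applyUpTo-position (g ∘ suc) w q
    (λ i e → h (there i) (trans (position-there w (λ { refl → All.lookup p i refl }) i) (cong suc e))))

inverse-applyUpTo : ∀ {n σ} → Fills 0 n σ → inverse σ ≡ applyUpTo (λ i → position (suc i) σ) n
inverse-applyUpTo {n} {σ} F = trans (map-upTo _ (length σ)) (cong (applyUpTo _) (fills-length n F))

inverse-fills : ∀ {n σ} → Fills 0 n σ → Fills 0 n (inverse σ)
inverse-fills {n} {σ} F rewrite inverse-applyUpTo F = G
  where
  f : ℕ → ℕ
  f i = position (suc i) σ
  mem : ∀ {i} → i < n → suc i ∈ σ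
  mem p = full F z<s p
  G : Fills 0 n (applyUpTo f n)
  G .unique = Unique.applyUpTo⁺₁ f n
    (λ i<j j<n e → <⇒≢ i<j (suc-injective (position-injective σ (mem (<-trans i<j j<n)) (mem j<n) e)))
  G .sound i with ∈-applyUpTo⁻ f i
  ... | j , j<n , refl = position>0 σ (mem j<n) , ≤-trans (position≤length σ (mem j<n)) (≤-reflexive (fills-length n F))
  G .full {suc i} p q with position-surjective σ (unique F) (≤-trans q (≤-reflexive (sym (fills-length n F))))
  ... | x , x∈ , e with sound F x∈
  G .full {suc i} p q | suc x , x∈ , e | _ , x≤n = subst (_∈ applyUpTo f n) e (∈-applyUpTo⁺ f x≤n)

inverse-involutive : ∀ {n σ} → Fills 0 n σ → inverse (inverse σ) ≡ σ
inverse-involutive {n} {σ} F = begin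
  inverse (inverse σ)  ≡⟨ inverse-applyUpTo (inverse-fills F) ⟩
  applyUpTo g n        ≡⟨ cong (applyUpTo g) (sym (fills-length n F)) ⟩
  applyUpTo g (length σ) ≡⟨ applyUpTo-position g σ (unique F) h ⟩
  σ ∎
  where
  open ≡-Reasoning
  g : ℕ → ℕ
  g i = position (suc i) (inverse σ)
  h : ∀ {x i} → x ∈ σ → position x σ ≡ suc i → g i ≡ x
  h {x} {i} x∈ e with sound F x∈
  h {suc x} {i} x∈ e | _ , x≤n = begin
    position (suc i) (inverse σ) ≡⟨ cong₂ position (sym e) (inverse-applyUpTo F) ⟩
    position (position (suc x) σ) (applyUpTo (λ i → position (suc i) σ) n)
      ≡⟨ position-applyUpTo (λ i → position (suc i) σ) n
           (λ p q e′ → suc-injective (position-injective σ (full F z<s p) (full F z<s q) e′)) x≤n ⟩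
    suc x ∎

inverse-injective : ∀ {n σ τ} → Fills 0 n σ → Fills 0 n τ → inverse σ ≡ inverse τ → σ ≡ τ
inverse-injective F G e = trans (sym (inverse-involutive F)) (trans (cong inverse e) (inverse-involutive G))

-- Decreasing trees

-- Letters arrive from the right, so a new one is leftmost: it descends the left spine to the first
-- smaller label and takes the subtree there as its right child. The rightmost maximum of the word
-- ends at the root.
insertDecr : ℕ → LT → LT
insertDecr x lleaf = lnode lleaf x lleaf
insertDecr x (lnode l y r) = if y <ᵇ x then lnode lleaf x (lnode l y r) else lnode (insertDecr x l) y r

decr : Word → LT
decr = foldr insertDecr lleaf

insertDecr-> : ∀ {x l y r} → y < x → insertDecr x (lnode l y r) ≡ lnode lleaf x (lnode l y r)
insertDecr-> p rewrite <ᵇ-true p = refl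

insertDecr-≤ : ∀ {x l y r} → x ≤ y → insertDecr x (lnode l y r) ≡ lnode (insertDecr x l) y r
insertDecr-≤ p rewrite <ᵇ-false p = refl

decr-root : ∀ {m v} → All (_< m) v → insertDecr m (decr v) ≡ lnode lleaf m (decr v)
decr-root {m} {v} below = go (decr v) (root-below v below)
  where
  RootBelow : LT → Set
  RootBelow lleaf         = ⊤
  RootBelow (lnode _ y _) = y < m
  root-insert : ∀ {x} t → x < m → RootBelow t → RootBelow (insertDecr x t)
  root-insert lleaf p _ = p
  root-insert {x} (lnode l y r) p q with y <ᵇ x
  ... | true  = p
  ... | false = q
  root-below : ∀ v → All (_< m) v → RootBelow (decr v)
  root-below []      []      = tt
  root-below (x ∷ v) (p ∷ q) = root-insert (decr v) p (root-below v q)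
  go : ∀ t → RootBelow t → insertDecr m t ≡ lnode lleaf m t
  go lleaf _ = refl
  go (lnode l y r) p = insertDecr-> p

decr-mid : ∀ u {m v} → All (_≤ m) u → All (_< m) v → decr (u ++ m ∷ v) ≡ lnode (decr u) m (decr v)
decr-mid []      []      below = decr-root below
decr-mid (x ∷ u) (p ∷ q) below = trans (cong (insertDecr x) (decr-mid u q below)) (insertDecr-≤ p)

-- Factorisation at the rightmost maximum, which is the root by `decr-mid`; the strict bound on `v`
-- singles out that occurrence.
data DecrView : Word → Set where
  empty : DecrView []
  root  : ∀ u m v → All (_≤ m) u → All (_< m) v → DecrView u → DecrView v → DecrView (u ++ m ∷ v)

decrView-∷ : ∀ x {w} → DecrView w → DecrView (x ∷ w)
decrView-∷ x empty = root [] x [] [] [] empty empty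
decrView-∷ x t@(root u m v p q a b) with x ≤? m
... | yes x≤m = root (x ∷ u) m v (x≤m ∷ p) q (decrView-∷ x a) b
... | no  x≰m = root [] x (u ++ m ∷ v) [] (++⁺ (All.map (λ r → ≤-<-trans r (≰⇒> x≰m)) p)
                  (≰⇒> x≰m ∷ All.map (λ r → <-trans r (≰⇒> x≰m)) q)) empty t

decrView : ∀ w → DecrView w
decrView []      = empty
decrView (x ∷ w) = decrView-∷ x (decrView w)

-- A search tree ordered by the keys `κ x` that keeps the letters `x` as labels, so that it can be
-- compared with a decreasing tree on the same letters.
insertBy : (ℕ → ℕ) → ℕ → LT → LT
insertBy κ x lleaf = lnode lleaf x lleaf
insertBy κ x (lnode l y r) = if κ x ≤ᵇ κ y then lnode (insertBy κ x l) y r else lnode l y (insertBy κ x r)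

treeBy : (ℕ → ℕ) → Word → LT
treeBy κ = foldr (insertBy κ) lleaf

bst-map : ∀ κ w → bst (map κ w) ≡ mapLT κ (treeBy κ w)
bst-map κ []      = refl
bst-map κ (x ∷ w) = trans (cong (insertBST (κ x)) (bst-map κ w)) (insert-map (treeBy κ w))
  where
  insert-map : ∀ t → insertBST (κ x) (mapLT κ t) ≡ mapLT κ (insertBy κ x t)
  insert-map lleaf = refl
  insert-map (lnode l y r) with κ x ≤ᵇ κ y
  ... | true  = cong (λ t → lnode t _ _) (insert-map l)
  ... | false = cong (lnode _ _) (insert-map r)

AllT : (ℕ → Set) → LT → Set
AllT P lleaf         = ⊤
AllT P (lnode l y r) = AllT P l × P y × AllT P r

allT-insertBy : ∀ {P κ x} t → P x → AllT P t → AllT P (insertBy κ x t)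
allT-insertBy lleaf p _ = tt , p , tt
allT-insertBy {κ = κ} {x} (lnode l y r) p (a , b , c) with κ x ≤ᵇ κ y
... | true  = allT-insertBy l p a , b , c
... | false = a , b , allT-insertBy r p c

allT-treeBy : ∀ {P κ w} → All P w → AllT P (treeBy κ w)
allT-treeBy [] = tt
allT-treeBy {κ = κ} {x ∷ w} (p ∷ q) = allT-insertBy (treeBy κ w) p (allT-treeBy q)

insertBy-cong : ∀ {κ κ′ x} t → AllT (λ y → (κ x ≤ᵇ κ y) ≡ (κ′ x ≤ᵇ κ′ y)) t → insertBy κ x t ≡ insertBy κ′ x t
insertBy-cong lleaf _ = refl
insertBy-cong {κ} {κ′} {x} (lnode l y r) (a , b , c) rewrite b with κ′ x ≤ᵇ κ′ y
... | true  = cong (λ t → lnode t y r) (insertBy-cong l a)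
... | false = cong (lnode l y) (insertBy-cong r c)

treeBy-cong : ∀ {κ κ′} w → (∀ {x y} → x ∈ w → y ∈ w → (κ x ≤ᵇ κ y) ≡ (κ′ x ≤ᵇ κ′ y)) → treeBy κ w ≡ treeBy κ′ w
treeBy-cong [] h = refl
treeBy-cong {κ} {κ′} (x ∷ w) h = trans
  (insertBy-cong {κ} {κ′} (treeBy κ w) (allT-treeBy (All.tabulate (λ i → h (here refl) (there i)))))
  (cong (insertBy κ′ x) (treeBy-cong w (λ i j → h (there i) (there j))))

-- A letter least both in key and in value goes to the bottom of the left spine under either
-- insertion.
insertBy-min : ∀ {κ x} t → AllT (λ y → κ x < κ y × x < y) t → insertBy κ x t ≡ insertDecr x t
insertBy-min lleaf _ = refl
insertBy-min (lnode l y r) (a , (p , q) , _)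
  rewrite ≤ᵇ-true (<⇒≤ p) | insertDecr-≤ {l = l} {r = r} (<⇒≤ q) = cong (λ t → lnode t y r) (insertBy-min l a)

-- If `x` becomes a new root, its smaller key sends `z` into the old tree, now the right child.
-- Otherwise `x` goes left, and `z` either goes left as well or enters the other subtree. At an
-- empty tree `z < x` puts `z` below `x` in both orders.
insertBy-insertDecr : ∀ {κ x z} t → z < x → κ x < κ z → insertBy κ z (insertDecr x t) ≡ insertDecr x (insertBy κ z t)
insertBy-insertDecr {κ} {x} {z} lleaf p q rewrite ≤ᵇ-false q | <ᵇ-true p = refl
insertBy-insertDecr {κ} {x} {z} (lnode l y r) p q with y <ᵇ x in e | κ z ≤ᵇ κ y in e′
... | true  | true  rewrite e | e′ | ≤ᵇ-false q = refl
... | true  | false rewrite e | e′ | ≤ᵇ-false q = refl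
... | false | true  rewrite e | e′ = cong (λ t → lnode t y r) (insertBy-insertDecr l p q)
... | false | false rewrite e | e′ = refl

-- Moves the letter of least key to the end of the insertion order. Once the letters of `v` are in,
-- `insertBy-min` turns its insertion into `insertDecr`, which then commutes with the insertion of
-- each letter of `u`.
treeBy-mid : ∀ {κ x} u {v} → All (λ z → z < x × κ x < κ z) u → All (λ y → κ x < κ y × x < y) v →
             treeBy κ (u ++ x ∷ v) ≡ insertDecr x (treeBy κ (u ++ v))
treeBy-mid {κ} [] {v} [] q = insertBy-min (treeBy κ v) (allT-treeBy q)
treeBy-mid {κ} {x} (z ∷ u) {v} ((z<x , κ<) ∷ p) q = trans (cong (insertBy κ z) (treeBy-mid u p q))
  (insertBy-insertDecr (treeBy κ (u ++ v)) z<x κ<)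

increasing-mid : ∀ u {x v} → AllPairs _<_ (u ++ x ∷ v) → AllPairs _<_ (u ++ v) × All (_< x) u × All (x <_) v
increasing-mid []      (p ∷ q) = q , [] , p
increasing-mid (y ∷ u) (p ∷ q) with ++⁻ u p | increasing-mid u q
... | pu , (y<x ∷ pv) | q′ , a , b = (++⁺ pu pv ∷ q′) , (y<x ∷ a) , b

suc-≤ᵇ : ∀ a b → (suc a ≤ᵇ suc b) ≡ (a ≤ᵇ b)
suc-≤ᵇ zero    b = refl
suc-≤ᵇ (suc a) b = refl

-- The treap with keys the positions and priorities the values is unique: inserting the keys by
-- decreasing priority or the priorities by decreasing key builds the same tree.
treeBy-position : ∀ w {vs} → Unique w → AllPairs _<_ vs → (∀ {x} → x ∈ vs → x ∈ w) → (∀ {x} → x ∈ w → x ∈ vs) →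
                  treeBy (λ x → position x w) vs ≡ decr w
treeBy-position [] {[]}     _ _ _ _ = refl
treeBy-position [] {v ∷ vs} _ _ h _ = case h (here refl) of λ ()
treeBy-position (x ∷ w) {vs} (p ∷ q) inc vs⊆ vs⊇ with ∈-∃++ (vs⊇ (here refl))
... | u , v , refl with increasing-mid u inc
... | inc′ , u< , >v = trans (treeBy-mid u (All.tabulate left) (All.tabulate right))
    (cong (insertDecr x) (trans (treeBy-cong (u ++ v) agree)
      (treeBy-position w q inc′ in-w (λ i → ∈-mid⁻ u (λ { refl → x∉w i }) (vs⊇ (there i))))))
  where
  x∉w : x ∉ w
  x∉w = All¬⇒¬Any p
  in-w : ∀ {y} → y ∈ u ++ v → y ∈ w
  in-w {y} i with vs⊆ (∈-mid⁺ u i)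
  ... | there j = j
  ... | here refl with ∈-++⁻ u i
  ...   | inj₁ k = contradiction (All.lookup u< k) (<-irrefl refl)
  ...   | inj₂ k = contradiction (All.lookup >v k) (<-irrefl refl)
  shifted : ∀ {y} → y ∈ u ++ v → position y (x ∷ w) ≡ suc (position y w)
  shifted i = position-there w (λ { refl → x∉w (in-w i) }) (in-w i)
  first : ∀ {y} → y ∈ u ++ v → position x (x ∷ w) < position y (x ∷ w)
  first i rewrite position-here x w | shifted i = s≤s (position>0 w (in-w i))
  left : ∀ {z} → z ∈ u → z < x × position x (x ∷ w) < position z (x ∷ w)
  left i = All.lookup u< i , first (∈-++⁺ˡ i)
  right : ∀ {y} → y ∈ v → position x (x ∷ w) < position y (x ∷ w) × x < y
  right i = first (∈-++⁺ʳ u i) , All.lookup >v i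
  agree : ∀ {y z} → y ∈ u ++ v → z ∈ u ++ v →
          (position y (x ∷ w) ≤ᵇ position z (x ∷ w)) ≡ (position y w ≤ᵇ position z w)
  agree {y} {z} i j rewrite shifted i | shifted j = suc-≤ᵇ (position y w) (position z w)

inverse-map : ∀ {n σ} → Fills 0 n σ → inverse σ ≡ map (λ x → position x σ) (applyUpTo suc n)
inverse-map {n} {σ} F = trans (inverse-applyUpTo F) (sym (map-applyUpTo suc (λ x → position x σ) n))

-- `inverse σ` lists the positions of 1, 2, ..., n. Inserting it from the right adds the letters of
-- `σ` by decreasing value with their positions as keys, to which `treeBy-position` applies.
bst-inverse : ∀ {n σ} → Fills 0 n σ → shape (bst (inverse σ)) ≡ shape (decr σ)
bst-inverse {n} {σ} F = begin
  shape (bst (inverse σ)) ≡⟨ cong (shape ∘ bst) (inverse-map F) ⟩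
  shape (bst (map κ (applyUpTo suc n))) ≡⟨ cong shape (bst-map κ (applyUpTo suc n)) ⟩
  shape (mapLT κ (treeBy κ (applyUpTo suc n))) ≡⟨ shape-mapLT κ _ ⟩
  shape (treeBy κ (applyUpTo suc n)) ≡⟨ cong shape (treeBy-position σ (unique F)
      (AllPairs.applyUpTo⁺₁ suc n (λ i<j _ → s≤s i<j)) sub sup) ⟩
  shape (decr σ) ∎
  where
  open ≡-Reasoning
  κ : ℕ → ℕ
  κ x = position x σ
  sub : ∀ {x} → x ∈ applyUpTo suc n → x ∈ σ
  sub i with ∈-applyUpTo⁻ suc i
  ... | j , j<n , refl = full F z<s j<n
  sup : ∀ {x} → x ∈ σ → x ∈ applyUpTo suc n
  sup i with sound F i
  sup {suc x} i | _ , p = ∈-applyUpTo⁺ suc p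

decr-inverse : ∀ {n σ} → Fills 0 n σ → shape (decr (inverse σ)) ≡ shape (bst σ)
decr-inverse F = trans (sym (bst-inverse (inverse-fills F))) (cong (shape ∘ bst) (inverse-involutive F))

-- Standardization

countEq-∉ : ∀ {x} w → x ∉ w → countEq x w ≡ 0
countEq-∉ [] _ = refl
countEq-∉ {x} (y ∷ w) x∉ with y ≟ℕ x
... | yes refl = contradiction (here refl) x∉
... | no _     = countEq-∉ w (x∉ ∘ there)

rank : Word → ℕ → ℕ
rank w x = suc (countLt x w)

-- Names the local recursion of std: the with-abstraction separates its three arguments,
-- after which the metavariable is solved by unification.
mutual
  stdFrom : Word → Word → Word → Word
  stdFrom = _

  std-∷ : ∀ x w → std (x ∷ w) ≡ suc (countLt x (x ∷ w) ℕ.+ 0) ∷ stdFrom (x ∷ w) (x ∷ []) w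
  std-∷ x w with Word ∋ x ∷ w | [ x ]
  ... | _ | _ = refl

-- For distinct letters the tie-breaking count of earlier equal letters is 0.
std-rank : ∀ {w} → Unique w → std w ≡ map (rank w) w
std-rank {w} U = go [] w U (λ _ ())
  where
  go : ∀ pre rest → Unique rest → (∀ {x} → x ∈ rest → x ∉ pre) → stdFrom w pre rest ≡ map (rank w) rest
  go pre []      _ _ = refl
  go pre (x ∷ rest) (p ∷ q) h = cong₂ _∷_
    (cong suc (trans (cong (countLt x w ℕ.+_) (countEq-∉ pre (h (here refl)))) (+-identityʳ _)))
    (go (pre ++ x ∷ []) rest q λ i j → case ∈-++⁻ pre j of λ
      { (inj₁ k) → h (there i) k ; (inj₂ (here refl)) → All.lookup p i refl })

countLt-mono : ∀ {x y} w → x ≤ y → countLt x w ≤ countLt y w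
countLt-mono [] _ = z≤n
countLt-mono {x} {y} (z ∷ w) p with z <? x
... | yes q rewrite <ᵇ-true q | <ᵇ-true (<-≤-trans q p) = s≤s (countLt-mono w p)
... | no ¬q rewrite <ᵇ-false (≮⇒≥ ¬q) = ≤-trans (countLt-mono w p) (m≤n+m _ _)

countLt-strict : ∀ {x y w} → x ∈ w → x < y → countLt x w < countLt y w
countLt-strict {x} {y} {z ∷ w} (here refl) p rewrite <ᵇ-false (≤-refl {x}) | <ᵇ-true p = s≤s (countLt-mono w (<⇒≤ p))
countLt-strict {x} {y} {z ∷ w} (there i) p with z <? x
... | yes q rewrite <ᵇ-true q | <ᵇ-true (<-trans q p) = s≤s (countLt-strict i p)
... | no ¬q rewrite <ᵇ-false (≮⇒≥ ¬q) = ≤-trans (countLt-strict i p) (m≤n+m _ _)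

rank-injective : ∀ {x y w} → x ∈ w → y ∈ w → rank w x ≡ rank w y → x ≡ y
rank-injective {x} {y} i j e with <-cmp x y
... | tri< p _ _ = contradiction (suc-injective e) (<⇒≢ (countLt-strict i p))
... | tri≈ _ p _ = p
... | tri> _ _ p = contradiction (suc-injective (sym e)) (<⇒≢ (countLt-strict j p))

countLt-suc-∉ : ∀ {x} w → x ∉ w → countLt (suc x) w ≡ countLt x w
countLt-suc-∉ [] _ = refl
countLt-suc-∉ {x} (y ∷ w) x∉ with y <? x
... | yes p rewrite <ᵇ-true p | <ᵇ-true (<-trans p (n<1+n x)) = cong suc (countLt-suc-∉ w (x∉ ∘ there))
... | no ¬p rewrite <ᵇ-false (≮⇒≥ ¬p) | <ᵇ-false (≤∧≢⇒< (≮⇒≥ ¬p) (x∉ ∘ here)) = countLt-suc-∉ w (x∉ ∘ there)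

countLt-suc-∈ : ∀ {x w} → Unique w → x ∈ w → countLt (suc x) w ≡ suc (countLt x w)
countLt-suc-∈ {x} {y ∷ w} (p ∷ q) (here refl)
  rewrite <ᵇ-false (≤-refl {x}) | <ᵇ-true (n<1+n x) = cong suc (countLt-suc-∉ w (All¬⇒¬Any p))
countLt-suc-∈ {x} {y ∷ w} (p ∷ q) (there i) with y <? x
... | yes r rewrite <ᵇ-true r | <ᵇ-true (<-trans r (n<1+n x)) = cong suc (countLt-suc-∈ q i)
... | no ¬r rewrite <ᵇ-false (≮⇒≥ ¬r) | <ᵇ-false (≤∧≢⇒< (≮⇒≥ ¬r) (λ { refl → All.lookup p i refl })) = countLt-suc-∈ q i

countLt-all : ∀ {n w} → All (_< n) w → countLt n w ≡ length w
countLt-all []      = refl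
countLt-all (p ∷ q) rewrite <ᵇ-true p = cong suc (countLt-all q)

countLt-none : ∀ {n w} → All (n ≤_) w → countLt n w ≡ 0
countLt-none []      = refl
countLt-none (p ∷ q) rewrite <ᵇ-false p = countLt-none q

sorted : Word → ℕ → Word
sorted w n = filter (_∈? w) (applyUpTo suc n)

-- Induction on the bound: the next integer lengthens both lists by one if it occurs in `w` and
-- changes neither if it does not.
rank-sorted : ∀ {w} n → Unique w → All (0 <_) w → map (rank w) (sorted w n) ≡ applyUpTo suc (countLt (suc n) w)
rank-sorted {w} zero    U pos rewrite countLt-none pos = refl
rank-sorted {w} (suc n) U pos = begin
  map (rank w) (sorted w (suc n))
    ≡⟨ cong (map (rank w) ∘ filter (_∈? w)) (sym (applyUpTo-∷ʳ suc n)) ⟩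
  map (rank w) (filter (_∈? w) (applyUpTo suc n ∷ʳ suc n))
    ≡⟨ cong (map (rank w)) (filter-++ (_∈? w) (applyUpTo suc n) (suc n ∷ [])) ⟩
  map (rank w) (sorted w n ++ filter (_∈? w) (suc n ∷ []))
    ≡⟨ map-++ (rank w) (sorted w n) _ ⟩
  map (rank w) (sorted w n) ++ map (rank w) (filter (_∈? w) (suc n ∷ []))
    ≡⟨ cong (_++ map (rank w) (filter (_∈? w) (suc n ∷ []))) (rank-sorted n U pos) ⟩
  applyUpTo suc (countLt (suc n) w) ++ map (rank w) (filter (_∈? w) (suc n ∷ []))
    ≡⟨ last ⟩
  applyUpTo suc (countLt (suc (suc n)) w) ∎
  where
  open ≡-Reasoning
  last : applyUpTo suc (countLt (suc n) w) ++ map (rank w) (filter (_∈? w) (suc n ∷ [])) ≡ applyUpTo suc (countLt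
      (suc (suc n)) w)
  last with suc n ∈? w
  ... | yes i rewrite countLt-suc-∈ U i = applyUpTo-∷ʳ suc (countLt (suc n) w)
  ... | no ¬i rewrite countLt-suc-∉ w ¬i = ++-identityʳ _

Bounded : ℕ → Word → Set
Bounded n = All (λ x → 0 < x × x ≤ n)

rank-sorted-length : ∀ {n w} → Unique w → Bounded n w → map (rank w) (sorted w n) ≡ applyUpTo suc (length w)
rank-sorted-length {n} U B = trans (rank-sorted n U (All.map proj₁ B))
    (cong (applyUpTo suc) (countLt-all (All.map (s≤s ∘ proj₂) B)))

-- The value `i` stands in `std w` where the `i`-th smallest letter stands in `w`, so both sides
-- list positions by increasing letter.
inverse-std : ∀ {n w} → Unique w → Bounded n w → inverse (std w) ≡ map (λ x → position x w) (sorted w n)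
inverse-std {n} {w} U B = begin
  inverse (std w) ≡⟨ cong inverse (std-rank U) ⟩
  inverse (map (rank w) w) ≡⟨ map-upTo _ _ ⟩
  applyUpTo (λ i → position (suc i) (map (rank w) w)) (length (map (rank w) w))
    ≡⟨ cong (applyUpTo _) (length-map (rank w) w) ⟩
  applyUpTo (λ i → position (suc i) (map (rank w) w)) (length w)
    ≡⟨ sym (map-applyUpTo suc (λ x → position x (map (rank w) w)) (length w)) ⟩
  map (λ x → position x (map (rank w) w)) (applyUpTo suc (length w))
    ≡⟨ cong (map _) (sym (rank-sorted-length U B)) ⟩
  map (λ x → position x (map (rank w) w)) (map (rank w) (sorted w n))
    ≡⟨ sym (map-∘ (sorted w n)) ⟩
  map (λ x → position (rank w x) (map (rank w) w)) (sorted w n)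
    ≡⟨ map-cong-local (All.tabulate λ i → position-map w
        (rank-injective (proj₂ (∈-filter⁻ (_∈? w) {xs = applyUpTo suc n} i)))) ⟩
  map (λ x → position x w) (sorted w n) ∎
  where open ≡-Reasoning

std-fills : ∀ {n w} → Unique w → Bounded n w → Fills 0 (length w) (std w)
std-fills {n} {w} U B rewrite std-rank U = F
  where
  F : Fills 0 (length w) (map (rank w) w)
  F .unique = unique-map rank-injective U
  F .sound i with ∈-map⁻ (rank w) i
  ... | x , j , refl = z<s , <-≤-trans (countLt-strict j (s≤s (proj₂ (All.lookup B j))))
      (≤-reflexive (countLt-all (All.map (s≤s ∘ proj₂) B)))
  F .full {suc x} p q with ∈-map⁻ (rank w) (subst (suc x ∈_) (sym (rank-sorted-length U B)) (∈-applyUpTo⁺ suc q))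
  ... | y , j , e = subst (_∈ map (rank w) w) (sym e)
      (∈-map⁺ (rank w) (proj₂ (∈-filter⁻ (_∈? w) {xs = applyUpTo suc n} j)))

unique-++⁻ : ∀ (u : Word) {v} → Unique (u ++ v) → Unique u × Unique v × (∀ {x} → x ∈ u → x ∉ v)
unique-++⁻ []      U = [] , U , λ ()
unique-++⁻ (y ∷ u) (p ∷ q) with unique-++⁻ u q | ++⁻ u p
... | a , b , h | pu , pv = (pu ∷ a) , b , λ { (here refl) → All¬⇒¬Any pv ; (there i) → h i }

-- The small values of the inverse are the positions inside the prefix `u`. Cutting a permutation in
-- two is thus restricting its inverse by value, which turns deconcatenation into shuffles.
lo-inverse : ∀ {n} u {v} → Fills 0 n (u ++ v) → lo (length u) (inverse (u ++ v)) ≡ inverse (std u)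
lo-inverse {n} u {v} F = begin
  lo (length u) (inverse (u ++ v)) ≡⟨ cong (lo (length u)) (inverse-map F) ⟩
  lo (length u) (map (λ x → position x (u ++ v)) (applyUpTo suc n)) ≡⟨ go (applyUpTo suc n) mem ⟩
  map (λ x → position x u) (sorted u n) ≡⟨ sym (inverse-std (proj₁ (unique-++⁻ u (unique F)))
      (proj₁ (++⁻ u (fills-All F)))) ⟩
  inverse (std u) ∎
  where
  open ≡-Reasoning
  mem : ∀ {x} → x ∈ applyUpTo suc n → x ∈ u ++ v
  mem i with ∈-applyUpTo⁻ suc i
  ... | j , j<n , refl = full F z<s j<n
  go : ∀ xs → (∀ {x} → x ∈ xs → x ∈ u ++ v) →
      lo (length u) (map (λ x → position x (u ++ v)) xs) ≡ map (λ x → position x u) (filter (_∈? u) xs)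
  go []       h = refl
  go (x ∷ xs) h with x ∈? u
  ... | yes i rewrite position-++ˡ u {v} i = trans (lo-∷ _ (position≤length u i)) (cong (_ ∷_) (go xs (h ∘ there)))
  ... | no x∉ with ∈-++⁻ u (h (here refl))
  ...   | inj₁ i = contradiction i x∉
  ...   | inj₂ i rewrite position-++ʳ u {v} x∉ i = trans (lo-∷-skip _ (m<m+n (length u) (position>0 v i)))
      (go xs (h ∘ there))

hi-inverse : ∀ {n} u {v} → Fills 0 n (u ++ v) → unshift (length u) (hi (length u) (inverse (u ++ v))) ≡ inverse (std v)
hi-inverse {n} u {v} F = begin
  unshift (length u) (hi (length u) (inverse (u ++ v))) ≡⟨ cong (unshift (length u) ∘ hi (length u)) (inverse-map F) ⟩
  unshift (length u) (hi (length u) (map (λ x → position x (u ++ v)) (applyUpTo suc n))) ≡⟨ go (applyUpTo suc n) mem ⟩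
  map (λ x → position x v) (sorted v n) ≡⟨ sym (inverse-std (proj₁ (proj₂ (unique-++⁻ u (unique F))))
      (proj₂ (++⁻ u (fills-All F)))) ⟩
  inverse (std v) ∎
  where
  open ≡-Reasoning
  mem : ∀ {x} → x ∈ applyUpTo suc n → x ∈ u ++ v
  mem i with ∈-applyUpTo⁻ suc i
  ... | j , j<n , refl = full F z<s j<n
  go : ∀ xs → (∀ {x} → x ∈ xs → x ∈ u ++ v) →
       unshift (length u) (hi (length u) (map (λ x → position x (u ++ v)) xs)) ≡ map (λ x → position x v) (filter
           (_∈? v) xs)
  go []       h = refl
  go (x ∷ xs) h with x ∈? v
  ... | no x∉ with ∈-++⁻ u (h (here refl))
  ...   | inj₂ i = contradiction i x∉
  ...   | inj₁ i rewrite position-++ˡ u {v} i = trans (cong (unshift (length u)) (hi-∷-skip _ (position≤length u i)))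
      (go xs (h ∘ there))
  go (x ∷ xs) h | yes i rewrite position-++ʳ u {v} (λ j → proj₂ (proj₂ (unique-++⁻ u (unique F))) j i) i =
    trans (cong (unshift (length u)) (hi-∷ _ (m<m+n (length u) (position>0 v i))))
      (cong₂ _∷_ (m+n∸m≡n (length u) _) (go xs (h ∘ there)))

-- Triangularity

-- The size equations make only trees of equal size comparable. Without that for `by-size`, a tree
-- could have arbitrarily large trees below it.
data _≺_ : BT → BT → Set where
  by-size  : ∀ {l r l′ r′} → size l < size l′ → size l ℕ.+ size r ≡ size l′ ℕ.+ size r′ → node l r ≺ node l′ r′
  by-left  : ∀ {l r l′ r′} → l ≺ l′ → size r ≡ size r′ → node l r ≺ node l′ r′
  by-right : ∀ {l r r′} → r ≺ r′ → node l r ≺ node l r′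

_≼_ : BT → BT → Set
s ≼ t = s ≡ t ⊎ s ≺ t

≺-size : ∀ {s t} → s ≺ t → size s ≡ size t
≺-size (by-size _ e)      = cong suc e
≺-size (by-left p e)      = cong suc (cong₂ ℕ._+_ (≺-size p) e)
≺-size (by-right {l} p)   = cong (λ k → suc (size l ℕ.+ k)) (≺-size p)

≺-trans : ∀ {s t u} → s ≺ t → t ≺ u → s ≺ u
≺-trans (by-size p e) (by-size q e′)  = by-size (<-trans p q) (trans e e′)
≺-trans (by-size p e) (by-left q e′)  = by-size (<-≤-trans p (≤-reflexive (≺-size q)))
    (trans e (cong₂ ℕ._+_ (≺-size q) e′))
≺-trans (by-size p e) (by-right q)    = by-size p (trans e (cong (_ ℕ.+_) (≺-size q)))
≺-trans (by-left p e) (by-size q e′)  = by-size (≤-<-trans (≤-reflexive (≺-size p)) q)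
    (trans (cong₂ ℕ._+_ (≺-size p) e) e′)
≺-trans (by-left p e) (by-left q e′)  = by-left (≺-trans p q) (trans e e′)
≺-trans (by-left p e) (by-right q)    = by-left p (trans e (≺-size q))
≺-trans (by-right {l} p) (by-size q e) = by-size q (trans (cong (size l ℕ.+_) (≺-size p)) e)
≺-trans (by-right p) (by-left q e)    = by-left q (trans (≺-size p) e)
≺-trans (by-right p) (by-right q)     = by-right (≺-trans p q)

≼-trans : ∀ {s t u} → s ≼ t → t ≼ u → s ≼ u
≼-trans (inj₁ refl) q           = q
≼-trans (inj₂ p)    (inj₁ refl) = inj₂ p
≼-trans (inj₂ p)    (inj₂ q)    = inj₂ (≺-trans p q)

-- Nested induction on the size, the size of the left subtree, the left subtree and the right
-- subtree. When an earlier component drops, the accessibility of the later ones is supplied afresh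
-- by the induction on total size.
≺-wellFounded : ∀ t → Acc _≺_ t
≺-wellFounded t = bySize t (<-wellFounded (size t))
  where
  bySize : ∀ t → Acc _<_ (size t) → Acc _≺_ t
  -- The sizes are held in separate variables so that the accessibility of `k` is kept when `l` is
  -- replaced by a smaller tree of the same size.
  accNode : ∀ {k n l r} → size l ≡ k → size (node l r) ≡ n → (∀ {t} → size t < n → Acc _≺_ t) →
            Acc _<_ k → Acc _≺_ l → Acc _≺_ r → Acc _≺_ (node l r)
  accBelow : ∀ {k n l r} → size l ≡ k → size (node l r) ≡ n → (∀ {t} → size t < n → Acc _≺_ t) →
             Acc _<_ k → Acc _≺_ l → Acc _≺_ r → ∀ {t} → t ≺ node l r → Acc _≺_ t

  bySize leaf       _        = acc λ ()
  bySize (node l r) (acc rs) = accNode refl refl (λ {t} p → bySize t (rs p)) (<-wellFounded (size l))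
    (bySize l (rs (s≤s (m≤m+n (size l) (size r))))) (bySize r (rs (s≤s (m≤n+m (size r) (size l)))))

  accNode eₗ e small a b c = acc (accBelow eₗ e small a b c)

  accBelow refl refl small (acc a) b c q@(by-size {l} {r} p _) = accNode refl (≺-size q) small (a p)
    (small (subst (size l <_) (≺-size q) (s≤s (m≤m+n (size l) (size r)))))
    (small (subst (size r <_) (≺-size q) (s≤s (m≤n+m (size r) (size l)))))
  accBelow eₗ refl small a (acc b) c q@(by-left {l} {r} p _) = accNode (trans (≺-size p) eₗ) (≺-size q) small a (b p)
    (small (subst (size r <_) (≺-size q) (s≤s (m≤n+m (size r) (size l)))))
  accBelow eₗ refl small a b (acc c) q@(by-right p) = accNode eₗ (≺-size q) small a b (c p)

graft : BT → BT → BT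
graft leaf       t = node t leaf
graft (node l r) t = node l (graft r t)

size-graft : ∀ s t → size (graft s t) ≡ suc (size s ℕ.+ size t)
size-graft leaf       t = cong suc (+-identityʳ _)
size-graft (node l r) t = cong suc (trans (cong (size l ℕ.+_) (size-graft r t)) (trans (+-suc _ _)
    (cong suc (sym (+-assoc (size l) _ _)))))

graft-monoˡ : ∀ {s s′} t → s ≺ s′ → graft s t ≺ graft s′ t
graft-monoˡ t (by-size {l} {r} {l′} {r′} p e) = by-size p (begin
    size l ℕ.+ size (graft r t)        ≡⟨ cong (size l ℕ.+_) (size-graft r t) ⟩
    size l ℕ.+ suc (size r ℕ.+ size t) ≡⟨ +-suc _ _ ⟩
    suc (size l ℕ.+ (size r ℕ.+ size t)) ≡⟨ cong suc (sym (+-assoc (size l) _ _)) ⟩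
    suc (size l ℕ.+ size r ℕ.+ size t) ≡⟨ cong (λ k → suc (k ℕ.+ size t)) e ⟩
    suc (size l′ ℕ.+ size r′ ℕ.+ size t) ≡⟨ cong suc (+-assoc (size l′) _ _) ⟩
    suc (size l′ ℕ.+ (size r′ ℕ.+ size t)) ≡⟨ sym (+-suc _ _) ⟩
    size l′ ℕ.+ suc (size r′ ℕ.+ size t) ≡⟨ cong (size l′ ℕ.+_) (sym (size-graft r′ t)) ⟩
    size l′ ℕ.+ size (graft r′ t) ∎)
  where open ≡-Reasoning
graft-monoˡ t (by-left {r = r} {r′ = r′} p e) = by-left p
    (trans (size-graft r t) (trans (cong (λ k → suc (k ℕ.+ size t)) e) (sym (size-graft r′ t))))
graft-monoˡ t (by-right p) = by-right (graft-monoˡ t p)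

graft-monoʳ : ∀ s {t t′} → t ≺ t′ → graft s t ≺ graft s t′
graft-monoʳ leaf       p = by-left p refl
graft-monoʳ (node l r) p = by-right (graft-monoʳ r p)

graft-mono : ∀ {s s′ t t′} → s ≼ s′ → t ≼ t′ → graft s t ≼ graft s′ t′
graft-mono (inj₁ refl) (inj₁ refl) = inj₁ refl
graft-mono {s} (inj₁ refl) (inj₂ q) = inj₂ (graft-monoʳ s q)
graft-mono {t = t} (inj₂ p) (inj₁ refl) = inj₂ (graft-monoˡ t p)
graft-mono {s′ = s′} {t} (inj₂ p) (inj₂ q) = inj₂ (≺-trans (graft-monoˡ t p) (graft-monoʳ s′ q))

graft≢leaf : ∀ s {t} → leaf ≢ graft s t
graft≢leaf leaf       ()
graft≢leaf (node _ _) ()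

node-injective : ∀ {l r l′ r′} → node l r ≡ node l′ r′ → l ≡ l′ × r ≡ r′
node-injective refl = refl , refl

-- The last node on the right spine of `graft s t` has left subtree `t`, and deleting it leaves `s`.
graft-injective : ∀ s s′ {t t′} → graft s t ≡ graft s′ t′ → s ≡ s′ × t ≡ t′
graft-injective leaf       leaf         e = refl , proj₁ (node-injective e)
graft-injective leaf       (node l′ r′) e = contradiction (proj₂ (node-injective e)) (graft≢leaf r′)
graft-injective (node l r) leaf         e = contradiction (sym (proj₂ (node-injective e))) (graft≢leaf r)
graft-injective (node l r) (node l′ r′) e with node-injective e
... | refl , e′ with graft-injective r r′ e′
... | refl , p = refl , p

-- Induction on the last letter `k` of `v`, which is the root on both sides. If some letter of `u`
-- is at most `k`, the left subtree on the right-hand side is larger and `by-size` decides. If none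
-- is, the left subtrees agree and the right ones are compared by induction. For empty `v` both
-- sides are `node (shape (bst u)) leaf`.
bst-graft-≼ : ∀ u {m} v → All (_≤ m) u → All (_< m) v → graft (shape (bst v)) (shape (bst u)) ≼ shape (bst (u ++ m ∷ v))
bst-graft-≼ u {m} v u≤ v< = go (bstView v) u≤ v<
  where
  size-total : ∀ u v → size (graft (shape (bst v)) (shape (bst u))) ≡ size (shape (bst (u ++ m ∷ v)))
  size-total u v = begin
    size (graft (shape (bst v)) (shape (bst u))) ≡⟨ size-graft (shape (bst v)) _ ⟩
    suc (size (shape (bst v)) ℕ.+ size (shape (bst u))) ≡⟨ cong suc (cong₂ ℕ._+_ (size-bst v) (size-bst u)) ⟩
    suc (length v ℕ.+ length u) ≡⟨ cong suc (+-comm (length v) _) ⟩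
    suc (length u ℕ.+ length v) ≡⟨ cong suc (sym (length-++ u)) ⟩
    suc (length (u ++ v)) ≡⟨ sym (length-mid u) ⟩
    length (u ++ m ∷ v) ≡⟨ sym (size-bst (u ++ m ∷ v)) ⟩
    size (shape (bst (u ++ m ∷ v))) ∎
    where open ≡-Reasoning

  go : ∀ {u v} → BstView v → All (_≤ m) u → All (_< m) v → graft (shape (bst v)) (shape (bst u)) ≼ shape (bst
      (u ++ m ∷ v))
  go {u} empty u≤ _ = inj₁ (sym (trans (cong shape (bst-snoc u m)) (cong₂ (λ a b → node (shape (bst a)) (shape (bst b)))
      (lo-all u≤) (hi-none u≤))))
  go {u} (root v k a b) u≤ v< with ++⁻ v v<
  ... | v<′ , (k<m ∷ []) = compare
    where
    open ≡-Reasoning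
    expand : bst (u ++ m ∷ (v ∷ʳ k)) ≡ lnode (bst (lo k u ++ lo k v)) k (bst (hi k u ++ m ∷ hi k v))
    expand = begin
      bst (u ++ m ∷ (v ∷ʳ k)) ≡⟨ cong bst (sym (++-assoc u (m ∷ v) (k ∷ []))) ⟩
      bst ((u ++ m ∷ v) ∷ʳ k) ≡⟨ bst-snoc (u ++ m ∷ v) k ⟩
      lnode (bst (lo k (u ++ m ∷ v))) k (bst (hi k (u ++ m ∷ v)))
        ≡⟨ cong₂ (λ a b → lnode (bst a) k (bst b))
             (trans (filter-++ (_≤? k) u (m ∷ v)) (cong (lo k u ++_) (lo-∷-skip v k<m)))
             (trans (filter-++ (k <?_) u (m ∷ v)) (cong (hi k u ++_) (hi-∷ v k<m))) ⟩
      lnode (bst (lo k u ++ lo k v)) k (bst (hi k u ++ m ∷ hi k v)) ∎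
    v>< : All (_< m) (hi k v)
    v>< = All.tabulate (λ i → All.lookup v<′ (proj₁ (∈-filter⁻ (k <?_) {xs = v} i)))
    Goal : Set
    Goal = graft (shape (bst (v ∷ʳ k))) (shape (bst u)) ≼ shape (bst (u ++ m ∷ (v ∷ʳ k)))
    graft-expand : graft (shape (bst (v ∷ʳ k))) (shape (bst u)) ≡ node (shape (bst (lo k v))) (graft
        (shape (bst (hi k v))) (shape (bst u)))
    graft-expand = cong (λ t → graft (shape t) (shape (bst u))) (bst-snoc v k)
    compare : Goal
    compare with lo k u in eq
    ... | [] = subst₂ _≼_ (sym graft-expand)
                 (sym (trans (cong shape expand) (cong₂ (λ a b → node (shape (bst (a ++ lo k v))) (shape
                     (bst (b ++ m ∷ hi k v)))) eq (hi-all u>))))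
                 (below (go {u} b u≤ v><))
      where
      u> : All (k <_) u
      u> = All.tabulate (λ i → ≰⇒> (λ p → case subst (_ ∈_) eq (∈-filter⁺ (_≤? k) i p) of λ ()))
      below : ∀ {l r r′} → r ≼ r′ → node l r ≼ node l r′
      below (inj₁ refl) = inj₁ refl
      below (inj₂ p)    = inj₂ (by-right p)
    ... | x ∷ xs = inj₂ (subst₂ _≺_ (sym graft-expand) (sym (cong shape expand)) (by-size bigger
                     (suc-injective (trans (cong size (sym graft-expand))
                         (trans (size-total u (v ∷ʳ k)) (cong (size ∘ shape) expand))))))
      where
      bigger : size (shape (bst (lo k v))) < size (shape (bst (lo k u ++ lo k v)))
      bigger rewrite eq = subst₂ _<_ (sym (size-bst (lo k v))) (sym (size-bst (x ∷ xs ++ lo k v)))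
        (s≤s (≤-trans (m≤n+m _ (length xs)) (≤-reflexive (sym (length-++ xs)))))

-- The ≺-least shape of bst σ over the permutations σ with decreasing tree of a given shape.
leastBst : BT → BT
leastBst leaf       = leaf
leastBst (node l r) = graft (leastBst r) (leastBst l)

leastBst-injective : ∀ s t → leastBst s ≡ leastBst t → s ≡ t
leastBst-injective leaf       leaf         _ = refl
leastBst-injective leaf       (node l r)   e = contradiction e (graft≢leaf (leastBst r))
leastBst-injective (node l r) leaf         e = contradiction (sym e) (graft≢leaf (leastBst r))
leastBst-injective (node l r) (node l′ r′) e with graft-injective (leastBst r) (leastBst r′) e
... | p , q = cong₂ node (leastBst-injective l l′ q) (leastBst-injective r r′ p)

leastBst-≼ : ∀ w → leastBst (shape (decr w)) ≼ shape (bst w)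
leastBst-≼ w = go (decrView w)
  where
  go : ∀ {w} → DecrView w → leastBst (shape (decr w)) ≼ shape (bst w)
  go empty = inj₁ refl
  go (root u m v u≤ v< a b) = subst (λ t → leastBst (shape t) ≼ shape (bst (u ++ m ∷ v))) (sym (decr-mid u u≤ v<))
    (≼-trans (graft-mono (go b) (go a)) (bst-graft-≼ u v u≤ v<))

-- All letters of the left subtree are placed above those of the right one. No letter before the
-- maximum is then smaller than one after it, so the strict case of `bst-graft-≼` never occurs.
leastPerm : BT → Word
leastPerm leaf       = []
leastPerm (node l r) = map (size r ℕ.+_) (leastPerm l) ++ suc (size r ℕ.+ size l) ∷ leastPerm r

fills-++ : ∀ {s m e u v} → s ≤ m → m ≤ e → Fills m e u → Fills s m v → Fills s e (u ++ v)
fills-++ s≤m m≤e F G .unique = Unique.++⁺ (unique F) (unique G)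
    (λ { (i , j) → <⇒≱ (proj₁ (sound F i)) (proj₂ (sound G j)) })
fills-++ {u = u} s≤m m≤e F G .sound i with ∈-++⁻ u i
... | inj₁ j = ≤-<-trans s≤m (proj₁ (sound F j)) , proj₂ (sound F j)
... | inj₂ j = proj₁ (sound G j) , ≤-trans (proj₂ (sound G j)) m≤e
fills-++ {m = m} {u = u} s≤m m≤e F G .full {x} p q with x ≤? m
... | yes x≤m = ∈-++⁺ʳ u (full G p x≤m)
... | no x≰m  = ∈-++⁺ˡ (full F (≰⇒> x≰m) q)

leastPerm-fills : ∀ t → Fills 0 (size t) (leastPerm t)
leastPerm-fills leaf       = fills-[]
leastPerm-fills (node l r) = subst (λ n → Fills 0 n (leastPerm (node l r))) (cong suc (+-comm (size r) (size l)))
  (fills-mid⁺ (map (size r ℕ.+_) (leastPerm l)) (fills-++ z≤n (m≤m+n (size r) (size l)) (shifted l r)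
      (leastPerm-fills r)))
  where
  shifted : ∀ l r → Fills (size r) (size r ℕ.+ size l) (map (size r ℕ.+_) (leastPerm l))
  shifted l r = subst (λ k → Fills k (size r ℕ.+ size l) (map (size r ℕ.+_) (leastPerm l))) (+-identityʳ (size r))
      (fills-shift (size r) (leastPerm-fills l))

insertDecr-shift : ∀ k x t → insertDecr (k ℕ.+ x) (mapLT (k ℕ.+_) t) ≡ mapLT (k ℕ.+_) (insertDecr x t)
insertDecr-shift k x lleaf = refl
insertDecr-shift k x (lnode l y r) with y <? x
... | yes p rewrite insertDecr-> {l = l} {r = r} p = insertDecr-> (+-monoʳ-< k p)
... | no ¬p rewrite insertDecr-≤ {l = l} {r = r} (≮⇒≥ ¬p) = trans (insertDecr-≤ (+-monoʳ-≤ k (≮⇒≥ ¬p)))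
    (cong (λ t → lnode t _ _) (insertDecr-shift k x l))

decr-shift : ∀ k w → decr (map (k ℕ.+_) w) ≡ mapLT (k ℕ.+_) (decr w)
decr-shift k []      = refl
decr-shift k (x ∷ w) = trans (cong (insertDecr (k ℕ.+ x)) (decr-shift k w)) (insertDecr-shift k x (decr w))

shape-decr-shift : ∀ k w → shape (decr (map (k ℕ.+_) w)) ≡ shape (decr w)
shape-decr-shift k w = trans (cong shape (decr-shift k w)) (shape-mapLT _ (decr w))

module _ (l r : BT) where
  private
    m : ℕ
    m = suc (size r ℕ.+ size l)
    u : Word
    u = map (size r ℕ.+_) (leastPerm l)

  leastPerm-left : All (λ x → size r < x × x < m) u
  leastPerm-left = All.map (λ {x} p → subst (_< x) (+-identityʳ (size r)) (proj₁ p) , s≤s (proj₂ p))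
      (fills-All (fills-shift (size r) (leastPerm-fills l)))

  leastPerm-right : All (_≤ size r) (leastPerm r)
  leastPerm-right = All.map proj₂ (fills-All (leastPerm-fills r))

  leastPerm-right-< : All (_< m) (leastPerm r)
  leastPerm-right-< = All.map (λ p → s≤s (≤-trans p (m≤m+n _ _))) leastPerm-right

shape-decr-leastPerm : ∀ t → shape (decr (leastPerm t)) ≡ t
shape-decr-leastPerm leaf = refl
shape-decr-leastPerm (node l r) = trans
  (cong shape (decr-mid (map (size r ℕ.+_) (leastPerm l)) (All.map (<⇒≤ ∘ proj₂) (leastPerm-left l r))
      (leastPerm-right-< l r)))
  (cong₂ node (trans (shape-decr-shift (size r) (leastPerm l)) (shape-decr-leastPerm l)) (shape-decr-leastPerm r))

-- The equality case of `bst-graft-≼`: every letter of `u` exceeds every letter of `v`, so `lo y u`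
-- is empty for each root `y` met on the way.
bst-graft : ∀ u {k m} v → All (λ x → k < x × x < m) u → All (_≤ k) v → k < m →
    shape (bst (u ++ m ∷ v)) ≡ graft (shape (bst v)) (shape (bst u))
bst-graft u {k} {m} v u> v≤ k<m = go (bstView v) v≤
  where
  go : ∀ {v} → BstView v → All (_≤ k) v → shape (bst (u ++ m ∷ v)) ≡ graft (shape (bst v)) (shape (bst u))
  go empty _ = trans (cong shape (bst-snoc u m)) (cong₂ (λ a b → node (shape (bst a)) (shape (bst b))) (lo-all u≤)
      (hi-none u≤))
    where
    u≤ : All (_≤ m) u
    u≤ = All.map (<⇒≤ ∘ proj₂) u>
  go (root v y a b) v≤ with ++⁻ v v≤
  ... | v≤′ , (y≤k ∷ []) = begin
    shape (bst (u ++ m ∷ (v ∷ʳ y))) ≡⟨ cong (shape ∘ bst) (sym (++-assoc u (m ∷ v) (y ∷ []))) ⟩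
    shape (bst ((u ++ m ∷ v) ∷ʳ y)) ≡⟨ cong shape (bst-snoc (u ++ m ∷ v) y) ⟩
    node (shape (bst (lo y (u ++ m ∷ v)))) (shape (bst (hi y (u ++ m ∷ v))))
      ≡⟨ cong₂ (λ a b → node (shape (bst a)) (shape (bst b)))
           (trans (filter-++ (_≤? y) u (m ∷ v)) (cong₂ _++_ (lo-none y<u) (lo-∷-skip v (≤-<-trans y≤k k<m))))
           (trans (filter-++ (y <?_) u (m ∷ v)) (cong₂ _++_ (hi-all y<u) (hi-∷ v (≤-<-trans y≤k k<m)))) ⟩
    node (shape (bst (lo y v))) (shape (bst (u ++ m ∷ hi y v)))
      ≡⟨ cong (node _) (go b (All.tabulate (λ i → All.lookup v≤′ (proj₁ (∈-filter⁻ (y <?_) {xs = v} i))))) ⟩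
    node (shape (bst (lo y v))) (graft (shape (bst (hi y v))) (shape (bst u)))
      ≡⟨ cong (λ t → graft (shape t) (shape (bst u))) (sym (bst-snoc v y)) ⟩
    graft (shape (bst (v ∷ʳ y))) (shape (bst u)) ∎
    where
    open ≡-Reasoning
    y<u : All (y <_) u
    y<u = All.map (≤-<-trans y≤k ∘ proj₁) u>

shape-bst-leastPerm : ∀ t → shape (bst (leastPerm t)) ≡ leastBst t
shape-bst-leastPerm leaf = refl
shape-bst-leastPerm (node l r) = trans
  (bst-graft _ (leastPerm r) (leastPerm-left l r) (leastPerm-right l r) (s≤s (m≤m+n (size r) (size l))))
  (cong₂ graft (shape-bst-leastPerm r) (trans (shape-bst-shift (size r) (leastPerm l)) (shape-bst-leastPerm l)))

-- Names the local recursion of treesOfSize: abstracting suc m separates its first argument from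
-- the fuel, and abstracting the fold of concatMap lets unification reach the recursive calls.
mutual
  treesWithLeft : ℕ → ℕ → ℕ → List BT
  treesWithLeft = _

  treesOfSize-suc : ∀ m → treesOfSize (suc m) ≡ concatMap (treesWithLeft (suc m) m) (upTo (suc m))
  treesOfSize-suc m with suc m
  ... | _ = refl

mutual
  treesFuel : ℕ → ℕ → ℕ → List BT
  treesFuel = _

  treesWithLeft-split : ∀ n m k → treesWithLeft n m k ≡
    concatMap (λ l → map (node l) (treesFuel n m (m ∸ k))) (treesFuel n m k)
  treesWithLeft-split n m k with foldr {A = List BT} {B = List BT} _++_ []
  ... | _ = refl

-- Completeness of the list of permutations

fills-↭ : ∀ {s e v w} → v ↭ w → Fills s e v → Fills s e w
fills-↭ p F .unique = ↭ₛ.Unique-resp-↭ (setoid ℕ) (↭⇒↭ₛ p) (unique F)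
fills-↭ p F .sound i = sound F (∈-resp-↭ (↭-sym p) i)
fills-↭ p F .full a b = ∈-resp-↭ p (full F a b)

∈-insertEverywhere⁺ : ∀ {m} u v → u ++ m ∷ v ∈ insertEverywhere m (u ++ v)
∈-insertEverywhere⁺ []      []      = here refl
∈-insertEverywhere⁺ []      (x ∷ v) = here refl
∈-insertEverywhere⁺ (x ∷ u) v       = there (∈-map⁺ (x ∷_) (∈-insertEverywhere⁺ u v))

fills-perms : ∀ n {w} → Fills 0 n w → w ∈ perms n
fills-perms zero    F rewrite fills-empty F = here refl
fills-perms (suc n) F with ∈-∃++ (full F {suc n} z<s ≤-refl)
... | u , v , refl = ∈-concatMap⁺ (insertEverywhere (suc n)) {xs = perms n}
    (lose (fills-perms n (fills-mid⁻ u F)) (∈-insertEverywhere⁺ u v))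

module OverField {c ℓ} (K : Field c ℓ) where

  open FreeModule K
  open Field K
    using (Carrier; _≈_; _+_; _*_; -_; 0#; 1#; +-cong; +-congˡ; +-congʳ; *-cong; *-congˡ; *-congʳ; *-identityˡ;
      *-identityʳ; zeroˡ; zeroʳ; distribˡ; distribʳ; *-assoc; *-comm; reflexive; -‿inverseʳ)
    renaming (+-identityˡ to 0+x; +-identityʳ to x+0; +-assoc to +-assocᴷ; +-comm to +-commᴷ;
      refl to ≈-refl; sym to ≈-sym; trans to ≈-trans; setoid to ≈-setoid)
  open Relation.Binary.Reasoning.Setoid ≈-setoid
  open Algebra.Properties.CommutativeSemigroup (Field.+-commutativeSemigroup K) using () renaming (interchange to +-interchange; x∙yz≈y∙xz to x+yz≈y+xz)
  open Algebra.Properties.CommutativeSemigroup (Field.*-commutativeSemigroup K) using (x∙yz≈y∙xz)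

  -- Finite sums and indicators

  ∑ : ∀ {a} {A : Set a} → List A → (A → Carrier) → Carrier
  ∑ []       f = 0#
  ∑ (x ∷ xs) f = f x + ∑ xs f

  syntax ∑ xs (λ x → e) = ∑[ x ← xs ] e
  infixr 8 ∑

  module _ {a} {A : Set a} where

    ∑-cong : ∀ (xs : List A) {f g} → (∀ {x} → x ∈ xs → f x ≈ g x) → ∑ xs f ≈ ∑ xs g
    ∑-cong []       h = ≈-refl
    ∑-cong (x ∷ xs) h = +-cong (h (here refl)) (∑-cong xs (h ∘ there))

    ∑-zero : ∀ (xs : List A) {f} → (∀ {x} → x ∈ xs → f x ≈ 0#) → ∑ xs f ≈ 0#
    ∑-zero []       h = ≈-refl
    ∑-zero (x ∷ xs) h = ≈-trans (+-cong (h (here refl)) (∑-zero xs (h ∘ there))) (0+x 0#)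

    ∑-+ : ∀ (xs : List A) f g → ∑[ x ← xs ] (f x + g x) ≈ ∑ xs f + ∑ xs g
    ∑-+ []       f g = ≈-sym (0+x 0#)
    ∑-+ (x ∷ xs) f g = ≈-trans (+-congˡ (∑-+ xs f g)) (+-interchange _ _ _ _)

    ∑-*ˡ : ∀ (xs : List A) k f → k * ∑ xs f ≈ ∑[ x ← xs ] (k * f x)
    ∑-*ˡ []       k f = zeroʳ k
    ∑-*ˡ (x ∷ xs) k f = ≈-trans (distribˡ k _ _) (+-congˡ (∑-*ˡ xs k f))

    ∑-*ʳ : ∀ (xs : List A) k f → ∑ xs f * k ≈ ∑[ x ← xs ] (f x * k)
    ∑-*ʳ []       k f = zeroˡ k
    ∑-*ʳ (x ∷ xs) k f = ≈-trans (distribʳ k _ _) (+-congˡ (∑-*ʳ xs k f))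

    ∑-++ : ∀ (xs ys : List A) f → ∑ (xs ++ ys) f ≈ ∑ xs f + ∑ ys f
    ∑-++ []       ys f = ≈-sym (0+x _)
    ∑-++ (x ∷ xs) ys f = ≈-trans (+-congˡ (∑-++ xs ys f)) (≈-sym (+-assocᴷ _ _ _))

    ∑-map : ∀ {b} {B : Set b} (h : B → A) xs f → ∑ (map h xs) f ≈ ∑ xs (f ∘ h)
    ∑-map h []       f = ≈-refl
    ∑-map h (x ∷ xs) f = +-congˡ (∑-map h xs f)

    ∑-concatMap : ∀ {b} {B : Set b} (h : B → List A) xs f → ∑ (concatMap h xs) f ≈ ∑[ x ← xs ] ∑ (h x) f
    ∑-concatMap h []       f = ≈-refl
    ∑-concatMap h (x ∷ xs) f = ≈-trans (∑-++ (h x) (concatMap h xs) f) (+-congˡ (∑-concatMap h xs f))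

  ∑-swap : ∀ {a b} {A : Set a} {B : Set b} (xs : List A) (ys : List B) (f : A → B → Carrier) →
           ∑[ x ← xs ] ∑[ y ← ys ] f x y ≈ ∑[ y ← ys ] ∑[ x ← xs ] f x y
  ∑-swap []       ys f = ≈-sym (∑-zero ys (λ _ → ≈-refl))
  ∑-swap (x ∷ xs) ys f = ≈-trans (+-congˡ (∑-swap xs ys f)) (≈-sym (∑-+ ys _ _))

  abstract
    -- Opaque outside this block: goals keep the form `𝟙 d`, so unification can recover a decision
    -- left as `_`.
    𝟙 : ∀ {p} {P : Set p} → Dec P → Carrier
    𝟙 (yes _) = 1#
    𝟙 (no _)  = 0#

    𝟙-yes : ∀ {p} {P : Set p} (d : Dec P) → P → 𝟙 d ≈ 1#
    𝟙-yes (yes _) _ = ≈-refl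
    𝟙-yes (no ¬p) p = contradiction p ¬p

    𝟙-no : ∀ {p} {P : Set p} (d : Dec P) → ¬ P → 𝟙 d ≈ 0#
    𝟙-no (yes p) ¬p = contradiction p ¬p
    𝟙-no (no _)  _  = ≈-refl

  𝟙-guard : ∀ {p} {P : Set p} (d : Dec P) {x y} → (P → x ≈ y) → 𝟙 d * x ≈ 𝟙 d * y
  𝟙-guard (yes p) h = *-congˡ (h p)
  𝟙-guard d@(no ¬p) h = ≈-trans (*-congʳ (𝟙-no d ¬p)) (≈-trans (zeroˡ _) (≈-sym (≈-trans (*-congʳ (𝟙-no d ¬p))
      (zeroˡ _))))

  module _ {p q} {P : Set p} {Q : Set q} where

    𝟙-cong : (d : Dec P) (e : Dec Q) → (P → Q) → (Q → P) → 𝟙 d ≈ 𝟙 e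
    𝟙-cong d@(yes p) e f g = ≈-trans (𝟙-yes d p) (≈-sym (𝟙-yes e (f p)))
    𝟙-cong d@(no ¬p) e f g = ≈-trans (𝟙-no d ¬p) (≈-sym (𝟙-no e (¬p ∘ g)))

  -- The conjunction has a decision `f` of its own because it mostly occurs as one equality of
  -- words, trees or pairs.
  𝟙-× : ∀ {p q r} {P : Set p} {Q : Set q} {R : Set r} (d : Dec P) (e : Dec Q) (f : Dec R) →
        (P → Q → R) → (R → P) → (R → Q) → 𝟙 d * 𝟙 e ≈ 𝟙 f
  𝟙-× d@(yes p) e f h g g′ = ≈-trans (*-congʳ (𝟙-yes d p)) (≈-trans (*-identityˡ _) (𝟙-cong e f (h p) g′))
  𝟙-× d@(no ¬p) e f h g g′ = ≈-trans (*-congʳ (𝟙-no d ¬p)) (≈-trans (zeroˡ _) (≈-sym (𝟙-no f (¬p ∘ g))))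

  ∑-pick : ∀ {a p} {A : Set a} (xs : List A) {P : A → Set p} (d : ∀ x → Dec (P x)) {w} →
           ∑[ x ← xs ] 𝟙 (d x) ≈ 1# → (∀ {x} → P x → x ≡ w) → ∀ g → ∑[ x ← xs ] (𝟙 (d x) * g x) ≈ g w
  ∑-pick xs d {w} one h g = begin
    ∑[ x ← xs ] (𝟙 (d x) * g x) ≈⟨ ∑-cong xs (λ {x} _ → 𝟙-guard (d x) (λ p → reflexive (cong g (h p)))) ⟩
    ∑[ x ← xs ] (𝟙 (d x) * g w) ≈⟨ ∑-*ʳ xs (g w) _ ⟨
    ∑[ x ← xs ] 𝟙 (d x) * g w   ≈⟨ *-congʳ one ⟩
    1# * g w                    ≈⟨ *-identityˡ _ ⟩
    g w ∎

  -- Enumerations without repetition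

  -- Deleting the largest letter of `w` leaves a single possible origin `δ`, and `δ` yields `w` by
  -- one insertion only, since the inserted letter occurs neither in `δ` nor in `u`.
  perms-count : ∀ n {w} → Fills 0 n w → ∑[ γ ← perms n ] 𝟙 (γ ≟ᵂ w) ≈ 1#
  perms-count zero    F rewrite fills-empty F = ≈-trans (x+0 _) (𝟙-yes ([] ≟ᵂ []) refl)
  perms-count (suc n) F with ∈-∃++ (full F {suc n} z<s ≤-refl)
  ... | u , v , refl = begin
    ∑[ γ ← perms (suc n) ] 𝟙 (γ ≟ᵂ (u ++ suc n ∷ v))
      ≈⟨ ∑-concatMap (insertEverywhere (suc n)) (perms n) _ ⟩
    ∑[ δ ← perms n ] ∑[ γ ← insertEverywhere (suc n) δ ] 𝟙 (γ ≟ᵂ (u ++ suc n ∷ v))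
      ≈⟨ ∑-cong (perms n) (λ {δ} i → insert-count u δ (λ j → <-irrefl refl (proj₂ (sound (perms-fills n i) j)))
           (λ j → proj₂ (unique-mid u (unique F)) (∈-++⁺ˡ j))) ⟩
    ∑[ δ ← perms n ] 𝟙 (δ ≟ᵂ (u ++ v))
      ≈⟨ perms-count n (fills-mid⁻ u F) ⟩
    1# ∎
    where
    insert-count : ∀ {m v} u δ → m ∉ δ → m ∉ u → ∑[ γ ← insertEverywhere m δ ] 𝟙 (γ ≟ᵂ (u ++ m ∷ v)) ≈ 𝟙 (δ ≟ᵂ (u ++ v))
    insert-count {m} {v} [] [] _ _ = ≈-trans (x+0 _) (𝟙-cong _ _ (λ { refl → refl }) (λ { refl → refl }))
    insert-count {m} {v} [] (y ∷ δ) m∉ _ = begin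
      𝟙 ((m ∷ y ∷ δ) ≟ᵂ (m ∷ v)) + ∑ (map (y ∷_) (insertEverywhere m δ)) _
        ≈⟨ +-cong (𝟙-cong _ ((y ∷ δ) ≟ᵂ v) (λ { refl → refl }) (λ { refl → refl })) (≈-trans
            (∑-map (y ∷_) (insertEverywhere m δ) _)
             (∑-zero (insertEverywhere m δ) (λ _ → 𝟙-no _ (λ { refl → m∉ (here refl) })))) ⟩
      𝟙 ((y ∷ δ) ≟ᵂ v) + 0# ≈⟨ x+0 _ ⟩
      𝟙 ((y ∷ δ) ≟ᵂ v) ∎
    insert-count {m} {v} (z ∷ u) [] _ m∉ = ≈-trans (x+0 _)
      (𝟙-cong _ _ (λ e → contradiction (here (∷-injectiveˡ e)) m∉) (λ ()))
    insert-count {m} {v} (z ∷ u) (y ∷ δ) m∉δ m∉u = begin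
      𝟙 ((m ∷ y ∷ δ) ≟ᵂ (z ∷ u ++ m ∷ v)) + ∑ (map (y ∷_) (insertEverywhere m δ)) _
        ≈⟨ +-cong (𝟙-no _ (m∉u ∘ here ∘ ∷-injectiveˡ)) (∑-map (y ∷_) (insertEverywhere m δ) _) ⟩
      0# + ∑[ γ ← insertEverywhere m δ ] 𝟙 ((y ∷ γ) ≟ᵂ (z ∷ u ++ m ∷ v))
        ≈⟨ 0+x _ ⟩
      ∑[ γ ← insertEverywhere m δ ] 𝟙 ((y ∷ γ) ≟ᵂ (z ∷ u ++ m ∷ v))
        ≈⟨ ∑-cong (insertEverywhere m δ) (λ _ → ≈-sym (𝟙-× (y ≟ℕ z) _ _ (λ { refl refl → refl }) (λ { refl → refl })
            (λ { refl → refl }))) ⟩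
      ∑[ γ ← insertEverywhere m δ ] (𝟙 (y ≟ℕ z) * 𝟙 (γ ≟ᵂ (u ++ m ∷ v)))
        ≈⟨ ∑-*ˡ (insertEverywhere m δ) _ _ ⟨
      𝟙 (y ≟ℕ z) * ∑[ γ ← insertEverywhere m δ ] 𝟙 (γ ≟ᵂ (u ++ m ∷ v))
        ≈⟨ *-congˡ (insert-count u δ (m∉δ ∘ there) (m∉u ∘ there)) ⟩
      𝟙 (y ≟ℕ z) * 𝟙 (δ ≟ᵂ (u ++ v))
        ≈⟨ 𝟙-× (y ≟ℕ z) _ _ (λ { refl refl → refl }) (λ { refl → refl }) (λ { refl → refl }) ⟩
      𝟙 ((y ∷ δ) ≟ᵂ (z ∷ u ++ v)) ∎

  perms-pick : ∀ n {w} → Fills 0 n w → ∀ g → ∑[ γ ← perms n ] (𝟙 (γ ≟ᵂ w) * g γ) ≈ g w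
  perms-pick n F = ∑-pick (perms n) _ (perms-count n F) id

  -- Inversion permutes `perms n`. On lists this is an expansion by Kronecker deltas and an
  -- interchange of sums, as `δ ≡ inverse γ` and `γ ≡ inverse δ` are equivalent.
  ∑-inverse : ∀ n g → ∑[ γ ← perms n ] g (inverse γ) ≈ ∑ (perms n) g
  ∑-inverse n g = begin
    ∑[ γ ← perms n ] g (inverse γ)
      ≈⟨ ∑-cong (perms n) (λ i → ≈-sym (perms-pick n (inverse-fills (perms-fills n i)) g)) ⟩
    ∑[ γ ← perms n ] ∑[ δ ← perms n ] (𝟙 (δ ≟ᵂ inverse γ) * g δ)
      ≈⟨ ∑-swap (perms n) (perms n) _ ⟩
    ∑[ δ ← perms n ] ∑[ γ ← perms n ] (𝟙 (δ ≟ᵂ inverse γ) * g δ)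
      ≈⟨ ∑-cong (perms n) (λ {δ} i → begin
           ∑[ γ ← perms n ] (𝟙 (δ ≟ᵂ inverse γ) * g δ)
             ≈⟨ ∑-cong (perms n) (λ {γ} j → *-congʳ (𝟙-cong (δ ≟ᵂ inverse γ) (γ ≟ᵂ inverse δ)
                  (λ { refl → sym (inverse-involutive (perms-fills n j)) }) (λ { refl → sym
                      (inverse-involutive (perms-fills n i)) }))) ⟩
           ∑[ γ ← perms n ] (𝟙 (γ ≟ᵂ inverse δ) * g δ)
             ≈⟨ perms-pick n (inverse-fills (perms-fills n i)) (λ _ → g δ) ⟩
           g δ ∎) ⟩
    ∑ (perms n) g ∎

  upTo-count : ∀ n {j} → j < n → ∑[ k ← upTo n ] 𝟙 (j ≟ℕ k) ≈ 1#
  upTo-count n p = go id n p id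
    where
    go : ∀ f n {j} → j < n → (∀ {i j} → f i ≡ f j → i ≡ j) → ∑[ k ← applyUpTo f n ] 𝟙 (f j ≟ℕ k) ≈ 1#
    go f (suc n) {zero}  p inj = ≈-trans (+-cong (𝟙-yes (f 0 ≟ℕ f 0) refl) (∑-zero (applyUpTo (f ∘ suc) n)
      (λ {x} i → 𝟙-no (f 0 ≟ℕ x) (λ e → case ∈-applyUpTo⁻ (f ∘ suc) i of λ { (_ , _ , e′) → case inj (trans e e′) of λ
          () })))) (x+0 1#)
    go f (suc n) {suc j} (s≤s p) inj = ≈-trans (+-cong (𝟙-no (f (suc j) ≟ℕ f 0) (λ e → case inj e of λ ()))
      (go (f ∘ suc) n p (suc-injective ∘ inj))) (0+x 1#)

  upTo-split : ∀ n a b → ∑[ k ← upTo (suc n) ] (𝟙 (a ≟ℕ k) * 𝟙 (b ≟ℕ (n ∸ k))) ≈ 𝟙 ((a ℕ.+ b) ≟ℕ n)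
  upTo-split n a b with (a ℕ.+ b) ≟ℕ n
  ... | d@(yes refl) = ≈-trans (∑-pick (upTo (suc n)) (a ≟ℕ_) (upTo-count (suc n) (s≤s (m≤m+n a b))) sym
      (λ k → 𝟙 (b ≟ℕ (n ∸ k))))
                     (≈-trans (𝟙-yes (b ≟ℕ (a ℕ.+ b ∸ a)) (sym (m+n∸m≡n a b))) (≈-sym (𝟙-yes d refl)))
  -- Truncated subtraction: `k + (n ∸ k) ≡ n` requires `k ≤ n`, which the range `upTo (suc n)`
  -- provides.
  ... | d@(no ne) = ≈-trans ( ∑-zero (upTo (suc n)) (λ {k} i → ≈-trans
                  (𝟙-× (a ≟ℕ k) (b ≟ℕ (n ∸ k)) d (λ { refl refl → m+[n∸m]≡n (ℕ.s≤s⁻¹ (below i)) })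
                      (λ e → contradiction e ne) (λ e → contradiction e ne)) (𝟙-no d ne))) (≈-sym (𝟙-no d ne))
    where
    below : ∀ {k} → k ∈ upTo (suc n) → k < suc n
    below i with ∈-applyUpTo⁻ id i
    ... | _ , p , refl = p

  -- Any fuel not below the size gives the full enumeration, and `node A B` is met only at
  -- `k = size A`, `l = A`, `r = B`.
  trees-count : ∀ n V → ∑[ T ← treesOfSize n ] 𝟙 (V ≟ᵀ T) ≈ 𝟙 (size V ≟ℕ n)
  trees-count n V = go n n V ≤-refl
    where
    leaves : ∀ V → 𝟙 (V ≟ᵀ leaf) + 0# ≈ 𝟙 (size V ≟ℕ 0)
    leaves leaf       = ≈-trans (x+0 _) (𝟙-cong (leaf ≟ᵀ leaf) (0 ≟ℕ 0) (λ _ → refl) (λ _ → refl))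
    leaves (node A B) = ≈-trans (x+0 _) (𝟙-cong (node A B ≟ᵀ leaf) (size (node A B) ≟ℕ 0) (λ ()) (λ ()))

    go : ∀ f m V → m ≤ f → ∑[ T ← treesFuel n f m ] 𝟙 (V ≟ᵀ T) ≈ 𝟙 (size V ≟ℕ m)
    go zero    zero V _ = leaves V
    go (suc _) zero V _ = leaves V
    go (suc f) (suc m) V (s≤s m≤f) = ≈-trans (∑-concatMap (λ k → concatMap (λ l → map (node l) (treesFuel n f (m ∸ k)))
        (treesFuel n f k)) (upTo (suc m)) (λ T → 𝟙 (V ≟ᵀ T))) (≈-trans
      (∑-cong (upTo (suc m)) (λ {k} _ → ≈-trans (∑-concatMap (λ l → map (node l) (treesFuel n f (m ∸ k)))
          (treesFuel n f k) _)
        (∑-cong (treesFuel n f k) (λ {l} _ → ∑-map (node l) (treesFuel n f (m ∸ k)) _)))) (nodes V))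
      where
      nodes : ∀ V → ∑[ k ← upTo (suc m) ] ∑[ l ← treesFuel n f k ] ∑[ r ← treesFuel n f (m ∸ k) ] 𝟙 (V ≟ᵀ node l r) ≈ 𝟙 (size V ≟ℕ suc m)
      nodes leaf = ≈-trans (∑-zero (upTo (suc m)) λ {k} _ → ∑-zero (treesFuel n f k) λ {l} _ → ∑-zero
          (treesFuel n f (m ∸ k)) λ {r} _ → 𝟙-no (leaf ≟ᵀ node l r) (λ ())) (≈-sym (𝟙-no (0 ≟ℕ suc m) (λ ())))
      nodes (node A B) = begin
        ∑[ k ← upTo (suc m) ] ∑[ l ← treesFuel n f k ] ∑[ r ← treesFuel n f (m ∸ k) ] 𝟙 (node A B ≟ᵀ node l r)
          ≈⟨ ∑-cong (upTo (suc m)) (λ {k} i → begin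
               ∑[ l ← treesFuel n f k ] ∑[ r ← treesFuel n f (m ∸ k) ] 𝟙 (node A B ≟ᵀ node l r)
                 ≈⟨ ∑-cong (treesFuel n f k) (λ {l} _ → ≈-trans
                      (∑-cong (treesFuel n f (m ∸ k)) (λ {r} _ → ≈-sym (𝟙-× (A ≟ᵀ l) (B ≟ᵀ r) (node A B ≟ᵀ node l r)
                        (λ { refl refl → refl }) (λ { refl → refl }) (λ { refl → refl }))))
                      (≈-sym (∑-*ˡ (treesFuel n f (m ∸ k)) _ _))) ⟩
               ∑[ l ← treesFuel n f k ] (𝟙 (A ≟ᵀ l) * ∑[ r ← treesFuel n f (m ∸ k) ] 𝟙 (B ≟ᵀ r))
                 ≈⟨ ∑-*ʳ (treesFuel n f k) _ _ ⟨
               ∑[ l ← treesFuel n f k ] 𝟙 (A ≟ᵀ l) * ∑[ r ← treesFuel n f (m ∸ k) ] 𝟙 (B ≟ᵀ r)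
                 ≈⟨ *-cong (go f k A (≤-trans (below i) m≤f)) (go f (m ∸ k) B (≤-trans (m∸n≤m m k) m≤f)) ⟩
               𝟙 (size A ≟ℕ k) * 𝟙 (size B ≟ℕ (m ∸ k)) ∎) ⟩
        ∑[ k ← upTo (suc m) ] (𝟙 (size A ≟ℕ k) * 𝟙 (size B ≟ℕ (m ∸ k)))
          ≈⟨ upTo-split m (size A) (size B) ⟩
        𝟙 ((size A ℕ.+ size B) ≟ℕ m)
          ≈⟨ 𝟙-cong _ (size (node A B) ≟ℕ suc m) (cong suc) suc-injective ⟩
        𝟙 (size (node A B) ≟ℕ suc m) ∎
        where
        below : ∀ {k} → k ∈ upTo (suc m) → k ≤ m
        below i with ∈-applyUpTo⁻ id i
        ... | _ , p , refl = ℕ.s≤s⁻¹ p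

  trees-pick : ∀ n V (g : BT → Carrier) → ∑[ T ← treesOfSize n ] (𝟙 (V ≟ᵀ T) * g T) ≈ 𝟙 (size V ≟ℕ n) * g V
  trees-pick n V g = begin
    ∑[ T ← treesOfSize n ] (𝟙 (V ≟ᵀ T) * g T) ≈⟨ ∑-cong (treesOfSize n) (λ {T} _ → 𝟙-guard (V ≟ᵀ T)
        (λ { refl → ≈-refl })) ⟩
    ∑[ T ← treesOfSize n ] (𝟙 (V ≟ᵀ T) * g V) ≈⟨ ∑-*ʳ (treesOfSize n) (g V) _ ⟨
    ∑[ T ← treesOfSize n ] 𝟙 (V ≟ᵀ T) * g V   ≈⟨ *-congʳ (trees-count n V) ⟩
    𝟙 (size V ≟ℕ n) * g V ∎

  -- Shuffles

  shuffle-[] : ∀ u → shuffle u [] ≡ u ∷ []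
  shuffle-[] []      = refl
  shuffle-[] (x ∷ u) = refl

  shuffle-↭ : ∀ u v {w} → w ∈ shuffle u v → w ↭ u ++ v
  shuffle-↭ []      v       (here refl) = ↭-refl
  shuffle-↭ (x ∷ u) []      (here refl) = ↭-reflexive (sym (++-identityʳ (x ∷ u)))
  shuffle-↭ (x ∷ u) (y ∷ v) i with ∈-++⁻ (map (x ∷_) (shuffle u (y ∷ v))) i
  ... | inj₁ j with ∈-map⁻ (x ∷_) j
  ...   | w , k , refl = prep x (shuffle-↭ u (y ∷ v) k)
  shuffle-↭ (x ∷ u) (y ∷ v) i | inj₂ j with ∈-map⁻ (y ∷_) j
  ...   | w , k , refl = ↭-trans (prep y (shuffle-↭ (x ∷ u) v k)) (↭-sym (shift y (x ∷ u) v))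

  shuffle-fills : ∀ {k l u v} → Fills 0 k u → Fills 0 l v → ∀ {w} → w ∈ shuffle u (map (k ℕ.+_) v) → Fills 0 (k ℕ.+ l) w
  shuffle-fills {k} {l} {u} {v} F G i = fills-↭ (↭-trans (++-comm (map (k ℕ.+_) v) u) (↭-sym (shuffle-↭ u _ i)))
    (fills-++ z≤n (m≤m+n k l) (subst (λ s → Fills s (k ℕ.+ l) (map (k ℕ.+_) v)) (+-identityʳ k) (fills-shift k G)) F)

  lo-[]⇒hi : ∀ {k} w → lo k w ≡ [] → hi k w ≡ w
  lo-[]⇒hi {k} w e = hi-all (All.tabulate (λ i → ≰⇒> (λ p → case subst (_ ∈_) e (∈-filter⁺ (_≤? k) i p) of λ ())))

  hi-[]⇒lo : ∀ {k} w → hi k w ≡ [] → lo k w ≡ w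
  hi-[]⇒lo {k} w e = lo-all (All.tabulate (λ i → ≮⇒≥ (λ p → case subst (_ ∈_) e (∈-filter⁺ (k <?_) i p) of λ ())))

  ∷-count : ∀ x z (ws : List Word) w → ∑[ δ ← ws ] 𝟙 ((x ∷ δ) ≟ᵂ (z ∷ w)) ≈ 𝟙 (z ≟ℕ x) * ∑[ δ ← ws ] 𝟙 (δ ≟ᵂ w)
  ∷-count x z ws w = ≈-trans
    (∑-cong ws (λ {δ} _ → ≈-sym (𝟙-× (z ≟ℕ x) (δ ≟ᵂ w) ((x ∷ δ) ≟ᵂ (z ∷ w)) (λ { refl refl → refl }) (λ { refl → refl })
        (λ { refl → refl }))))
    (≈-sym (∑-*ˡ ws (𝟙 (z ≟ℕ x)) (λ δ → 𝟙 (δ ≟ᵂ w))))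

  -- The value of a letter tells which of the two words it comes from, so `w` arises in at most one
  -- way, with `u` and `v` as its small and large parts.
  shuffle-count : ∀ {k u v} → All (_≤ k) u → All (k <_) v → ∀ w →
                  ∑[ δ ← shuffle u v ] 𝟙 (δ ≟ᵂ w) ≈ 𝟙 (lo k w ≟ᵂ u) * 𝟙 (hi k w ≟ᵂ v)
  shuffle-count {k} {[]} {v} _ v> w = ≈-trans (x+0 _) (≈-sym (𝟙-× (lo k w ≟ᵂ []) (hi k w ≟ᵂ v) (v ≟ᵂ w)
    (λ e e′ → trans (sym e′) (lo-[]⇒hi w e)) (λ { refl → lo-none v> }) (λ { refl → hi-all v> })))
  shuffle-count {k} {x ∷ u} {[]} u≤ _ w = ≈-trans (x+0 _) (≈-sym (𝟙-× (lo k w ≟ᵂ (x ∷ u)) (hi k w ≟ᵂ []) ((x ∷ u) ≟ᵂ w)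
    (λ e e′ → trans (sym e) (hi-[]⇒lo w e′)) (λ { refl → lo-all u≤ }) (λ { refl → hi-none u≤ })))
  shuffle-count {k} {x ∷ u} {y ∷ v} (x≤ ∷ u≤) (y> ∷ v>) w = begin
    ∑[ δ ← shuffle (x ∷ u) (y ∷ v) ] 𝟙 (δ ≟ᵂ w)
      ≈⟨ ∑-++ (map (x ∷_) (shuffle u (y ∷ v))) (map (y ∷_) (shuffle (x ∷ u) v)) (λ δ → 𝟙 (δ ≟ᵂ w)) ⟩
    ∑[ δ ← map (x ∷_) (shuffle u (y ∷ v)) ] 𝟙 (δ ≟ᵂ w) + ∑[ δ ← map (y ∷_) (shuffle (x ∷ u) v) ] 𝟙 (δ ≟ᵂ w)
      ≈⟨ +-cong (∑-map (x ∷_) (shuffle u (y ∷ v)) (λ δ → 𝟙 (δ ≟ᵂ w))) (∑-map (y ∷_) (shuffle (x ∷ u) v)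
          (λ δ → 𝟙 (δ ≟ᵂ w))) ⟩
    ∑[ δ ← shuffle u (y ∷ v) ] 𝟙 ((x ∷ δ) ≟ᵂ w) + ∑[ δ ← shuffle (x ∷ u) v ] 𝟙 ((y ∷ δ) ≟ᵂ w)
      ≈⟨ first w ⟩
    𝟙 (lo k w ≟ᵂ (x ∷ u)) * 𝟙 (hi k w ≟ᵂ (y ∷ v)) ∎
    where
    first : ∀ w → ∑[ δ ← shuffle u (y ∷ v) ] 𝟙 ((x ∷ δ) ≟ᵂ w) + ∑[ δ ← shuffle (x ∷ u) v ] 𝟙 ((y ∷ δ) ≟ᵂ w)
                  ≈ 𝟙 (lo k w ≟ᵂ (x ∷ u)) * 𝟙 (hi k w ≟ᵂ (y ∷ v))
    first [] = ≈-trans (+-cong (∑-zero (shuffle u (y ∷ v)) (λ {δ} _ → 𝟙-no ((x ∷ δ) ≟ᵂ []) (λ ())))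
                               (∑-zero (shuffle (x ∷ u) v) (λ {δ} _ → 𝟙-no ((y ∷ δ) ≟ᵂ []) (λ ()))))
                 (≈-trans (x+0 0#) (≈-sym (≈-trans (*-congʳ (𝟙-no ([] ≟ᵂ (x ∷ u)) (λ ()))) (zeroˡ _))))
    first (z ∷ w) with z ≤? k
    ... | yes z≤k rewrite lo-∷ w z≤k | hi-∷-skip w z≤k = begin
      ∑[ δ ← shuffle u (y ∷ v) ] 𝟙 ((x ∷ δ) ≟ᵂ (z ∷ w)) + ∑[ δ ← shuffle (x ∷ u) v ] 𝟙 ((y ∷ δ) ≟ᵂ (z ∷ w))
        ≈⟨ +-cong (∷-count x z (shuffle u (y ∷ v)) w)
             (∑-zero (shuffle (x ∷ u) v) (λ {δ} _ → 𝟙-no ((y ∷ δ) ≟ᵂ (z ∷ w)) (λ { refl → <⇒≱ y> z≤k }))) ⟩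
      𝟙 (z ≟ℕ x) * ∑[ δ ← shuffle u (y ∷ v) ] 𝟙 (δ ≟ᵂ w) + 0#
        ≈⟨ x+0 _ ⟩
      𝟙 (z ≟ℕ x) * ∑[ δ ← shuffle u (y ∷ v) ] 𝟙 (δ ≟ᵂ w)
        ≈⟨ *-congˡ (shuffle-count u≤ (y> ∷ v>) w) ⟩
      𝟙 (z ≟ℕ x) * (𝟙 (lo k w ≟ᵂ u) * 𝟙 (hi k w ≟ᵂ (y ∷ v)))
        ≈⟨ *-assoc _ _ _ ⟨
      𝟙 (z ≟ℕ x) * 𝟙 (lo k w ≟ᵂ u) * 𝟙 (hi k w ≟ᵂ (y ∷ v))
        ≈⟨ *-congʳ (𝟙-× (z ≟ℕ x) (lo k w ≟ᵂ u) ((z ∷ lo k w) ≟ᵂ (x ∷ u)) (cong₂ _∷_) ∷-injectiveˡ ∷-injectiveʳ) ⟩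
      𝟙 ((z ∷ lo k w) ≟ᵂ (x ∷ u)) * 𝟙 (hi k w ≟ᵂ (y ∷ v)) ∎
    ... | no z≰k rewrite lo-∷-skip w (≰⇒> z≰k) | hi-∷ w (≰⇒> z≰k) = begin
      ∑[ δ ← shuffle u (y ∷ v) ] 𝟙 ((x ∷ δ) ≟ᵂ (z ∷ w)) + ∑[ δ ← shuffle (x ∷ u) v ] 𝟙 ((y ∷ δ) ≟ᵂ (z ∷ w))
        ≈⟨ +-cong (∑-zero (shuffle u (y ∷ v)) (λ {δ} _ → 𝟙-no ((x ∷ δ) ≟ᵂ (z ∷ w)) (λ { refl → z≰k x≤ })))
             (∷-count y z (shuffle (x ∷ u) v) w) ⟩
      0# + 𝟙 (z ≟ℕ y) * ∑[ δ ← shuffle (x ∷ u) v ] 𝟙 (δ ≟ᵂ w)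
        ≈⟨ 0+x _ ⟩
      𝟙 (z ≟ℕ y) * ∑[ δ ← shuffle (x ∷ u) v ] 𝟙 (δ ≟ᵂ w)
        ≈⟨ *-congˡ (shuffle-count (x≤ ∷ u≤) v> w) ⟩
      𝟙 (z ≟ℕ y) * (𝟙 (lo k w ≟ᵂ (x ∷ u)) * 𝟙 (hi k w ≟ᵂ v))
        ≈⟨ x∙yz≈y∙xz _ _ _ ⟩
      𝟙 (lo k w ≟ᵂ (x ∷ u)) * (𝟙 (z ≟ℕ y) * 𝟙 (hi k w ≟ᵂ v))
        ≈⟨ *-congˡ (𝟙-× (z ≟ℕ y) (hi k w ≟ᵂ v) ((z ∷ hi k w) ≟ᵂ (y ∷ v)) (cong₂ _∷_) ∷-injectiveˡ ∷-injectiveʳ) ⟩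
      𝟙 (lo k w ≟ᵂ (x ∷ u)) * 𝟙 ((z ∷ hi k w) ≟ᵂ (y ∷ v)) ∎

  -- The weight of `w` in the shifted shuffle of `u` and `v`, read off from `w` alone.
  split : ℕ → Word → Word × Word → Carrier
  split k w (u , v) = 𝟙 (lo k w ≟ᵂ u) * 𝟙 (unshift k (hi k w) ≟ᵂ v)

  shifted-shuffle-count : ∀ {k u v} → All (_≤ k) u → All (0 <_) v → ∀ w →
                          ∑[ δ ← shuffle u (map (k ℕ.+_) v) ] 𝟙 (δ ≟ᵂ w) ≈ split k w (u , v)
  shifted-shuffle-count {k} {u} {v} u≤ v> w = ≈-trans (shuffle-count u≤ (shifted v>) w)
      (*-congˡ (𝟙-cong (hi k w ≟ᵂ map (k ℕ.+_) v) (unshift k (hi k w) ≟ᵂ v)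
    (λ e → trans (cong (unshift k) e) (unshift-shift k v))
    (λ e → trans (sym (shift-unshift k (All.tabulate (λ i → <⇒≤ (proj₂ (∈-filter⁻ (k <?_) {xs = w} i))))))
        (cong (map (k ℕ.+_)) e))))
    where
    shifted : ∀ {v} → All (0 <_) v → All (k <_) (map (k ℕ.+_) v)
    shifted []      = []
    shifted (p ∷ q) = m<m+n k p ∷ shifted q

  -- After this exchange `u` and `v` occur only in the weight, so they can be summed over in turn.
  ∑-shuffle : ∀ {k l u v} → Fills 0 k u → Fills 0 l v → ∀ g →
              ∑ (shuffle u (map (k ℕ.+_) v)) g ≈ ∑[ δ ← perms (k ℕ.+ l) ] (split k δ (u , v) * g δ)
  ∑-shuffle {k} {l} {u} {v} F G g = begin
    ∑ S g ≈⟨ ∑-cong S (λ i → ≈-sym (perms-pick n (shuffle-fills F G i) g)) ⟩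
    ∑[ δ ← S ] ∑[ γ ← perms n ] (𝟙 (γ ≟ᵂ δ) * g γ) ≈⟨ ∑-swap S (perms n) (λ δ γ → 𝟙 (γ ≟ᵂ δ) * g γ) ⟩
    ∑[ γ ← perms n ] ∑[ δ ← S ] (𝟙 (γ ≟ᵂ δ) * g γ) ≈⟨ ∑-cong (perms n) (λ {γ} _ → begin
        ∑[ δ ← S ] (𝟙 (γ ≟ᵂ δ) * g γ) ≈⟨ ∑-*ʳ S (g γ) (λ δ → 𝟙 (γ ≟ᵂ δ)) ⟨
        ∑[ δ ← S ] 𝟙 (γ ≟ᵂ δ) * g γ   ≈⟨ *-congʳ (∑-cong S (λ {δ} _ → 𝟙-cong (γ ≟ᵂ δ) (δ ≟ᵂ γ) sym sym)) ⟩
        ∑[ δ ← S ] 𝟙 (δ ≟ᵂ γ) * g γ   ≈⟨ *-congʳ (shifted-shuffle-count (All.map proj₂ (fills-All F))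
            (All.map proj₁ (fills-All G)) γ) ⟩
        split k γ (u , v) * g γ ∎) ⟩
    ∑[ γ ← perms n ] (split k γ (u , v) * g γ) ∎
    where
    n : ℕ
    n = k ℕ.+ l
    S : List Word
    S = shuffle u (map (k ℕ.+_) v)

  -- Shuffles of decreasing trees

  -- The sum over all deconcatenations of `w`; taking a function of the two factors gives it the
  -- same form as `splitT` on trees.
  splitW : Word → (Word → Word → Carrier) → Carrier
  splitW []      h = h [] []
  splitW (x ∷ w) h = h [] (x ∷ w) + splitW w (λ u v → h (x ∷ u) v)

  splitW-cong : ∀ w {h h′} → (∀ u v → u ++ v ≡ w → h u v ≈ h′ u v) → splitW w h ≈ splitW w h′
  splitW-cong []      e = e [] [] refl
  splitW-cong (x ∷ w) e = +-cong (e [] (x ∷ w) refl) (splitW-cong w (λ u v p → e (x ∷ u) v (cong (x ∷_) p)))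

  splitW-+ : ∀ w h h′ → splitW w (λ u v → h u v + h′ u v) ≈ splitW w h + splitW w h′
  splitW-+ []      h h′ = ≈-refl
  splitW-+ (x ∷ w) h h′ = ≈-trans (+-congˡ (splitW-+ w _ _)) (+-interchange _ _ _ _)

  splitW-mid : ∀ a m b h → splitW (a ++ m ∷ b) h ≈ splitW a (λ u v → h u (v ++ m ∷ b)) + splitW b (λ u v → h
      (a ++ m ∷ u) v)
  splitW-mid []      m b h = ≈-refl
  splitW-mid (x ∷ a) m b h = ≈-trans (+-congˡ (splitW-mid a m b (λ u v → h (x ∷ u) v))) (≈-sym (+-assocᴷ _ _ _))

  joined : Word → ℕ → Word → (Word → Carrier) → Word → Word → Carrier
  joined b₁ m b₂ g a₁ a₂ = ∑[ δ₁ ← shuffle a₁ b₁ ] ∑[ δ₂ ← shuffle a₂ b₂ ] g (δ₁ ++ m ∷ δ₂)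

  -- In a shuffle of `a` with `b₁ ++ m ∷ b₂` this letter `m` cuts `a` in two; the parts before and
  -- after it are shuffled with `b₁` and `b₂` separately.
  shuffle-mid : ∀ a b₁ m b₂ g → ∑ (shuffle a (b₁ ++ m ∷ b₂)) g ≈ splitW a (joined b₁ m b₂ g)
  shuffle-mid []      b₁ m b₂ g = ≈-sym (x+0 _)
  shuffle-mid (x ∷ a) [] m b₂ g = begin
    ∑ (map (x ∷_) (shuffle a (m ∷ b₂)) ++ map (m ∷_) (shuffle (x ∷ a) b₂)) g
      ≈⟨ ∑-++ (map (x ∷_) (shuffle a (m ∷ b₂))) _ g ⟩
    ∑ (map (x ∷_) (shuffle a (m ∷ b₂))) g + ∑ (map (m ∷_) (shuffle (x ∷ a) b₂)) g
      ≈⟨ +-cong (∑-map (x ∷_) (shuffle a (m ∷ b₂)) g) (∑-map (m ∷_) (shuffle (x ∷ a) b₂) g) ⟩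
    ∑ (shuffle a (m ∷ b₂)) (g ∘ (x ∷_)) + ∑ (shuffle (x ∷ a) b₂) (g ∘ (m ∷_))
      -- `splitW` starts with the empty first factor, where `m` precedes all of `a`; `shuffle` lists
      -- those words last.
      ≈⟨ +-commᴷ _ _ ⟩
    ∑ (shuffle (x ∷ a) b₂) (g ∘ (m ∷_)) + ∑ (shuffle a (m ∷ b₂)) (g ∘ (x ∷_))
      ≈⟨ +-cong (≈-sym (x+0 _)) (≈-trans (shuffle-mid a [] m b₂ (g ∘ (x ∷_)))
           (splitW-cong a (λ u v _ → reflexive (cong (λ S → ∑[ δ₁ ← S ] ∑[ δ₂ ← shuffle v b₂ ] g (x ∷ δ₁ ++ m ∷ δ₂))
               (shuffle-[] u))))) ⟩
    splitW (x ∷ a) (joined [] m b₂ g) ∎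
  shuffle-mid (x ∷ a) (y ∷ b₁) m b₂ g = begin
    ∑ (map (x ∷_) (shuffle a (y ∷ b₁ ++ m ∷ b₂)) ++ map (y ∷_) (shuffle (x ∷ a) (b₁ ++ m ∷ b₂))) g
      ≈⟨ ∑-++ (map (x ∷_) (shuffle a (y ∷ b₁ ++ m ∷ b₂))) _ g ⟩
    ∑ (map (x ∷_) (shuffle a (y ∷ b₁ ++ m ∷ b₂))) g + ∑ (map (y ∷_) (shuffle (x ∷ a) (b₁ ++ m ∷ b₂))) g
      ≈⟨ +-cong (∑-map (x ∷_) (shuffle a (y ∷ b₁ ++ m ∷ b₂)) g) (∑-map (y ∷_) (shuffle (x ∷ a) (b₁ ++ m ∷ b₂)) g) ⟩
    ∑ (shuffle a (y ∷ b₁ ++ m ∷ b₂)) (g ∘ (x ∷_)) + ∑ (shuffle (x ∷ a) (b₁ ++ m ∷ b₂)) (g ∘ (y ∷_))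
      ≈⟨ +-cong (shuffle-mid a (y ∷ b₁) m b₂ (g ∘ (x ∷_))) (shuffle-mid (x ∷ a) b₁ m b₂ (g ∘ (y ∷_))) ⟩
    splitW a (joined (y ∷ b₁) m b₂ (g ∘ (x ∷_))) + (joined b₁ m b₂ (g ∘ (y ∷_)) [] (x ∷ a) + splitW a
        (λ u v → joined b₁ m b₂ (g ∘ (y ∷_)) (x ∷ u) v))
      ≈⟨ x+yz≈y+xz _ _ _ ⟩
    joined b₁ m b₂ (g ∘ (y ∷_)) [] (x ∷ a) + (splitW a (joined (y ∷ b₁) m b₂ (g ∘ (x ∷_))) + splitW a
        (λ u v → joined b₁ m b₂ (g ∘ (y ∷_)) (x ∷ u) v))
      ≈⟨ +-congˡ (splitW-+ a (joined (y ∷ b₁) m b₂ (g ∘ (x ∷_))) (λ u v → joined b₁ m b₂ (g ∘ (y ∷_)) (x ∷ u) v)) ⟨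
    joined b₁ m b₂ (g ∘ (y ∷_)) [] (x ∷ a) + splitW a (λ u v → joined (y ∷ b₁) m b₂ (g ∘ (x ∷_)) u v + joined b₁ m b₂
        (g ∘ (y ∷_)) (x ∷ u) v)
      ≈⟨ +-congˡ (splitW-cong a (λ u v _ → ≈-sym (joined-∷ u v))) ⟩
    splitW (x ∷ a) (joined (y ∷ b₁) m b₂ g) ∎
    where
    joined-∷ : ∀ u v → joined (y ∷ b₁) m b₂ g (x ∷ u) v ≈ joined (y ∷ b₁) m b₂ (g ∘ (x ∷_)) u v + joined b₁ m b₂ (g ∘
        (y ∷_)) (x ∷ u) v
    joined-∷ u v = ≈-trans (∑-++ (map (x ∷_) (shuffle u (y ∷ b₁))) (map (y ∷_) (shuffle (x ∷ u) b₁)) f)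
      (+-cong (∑-map (x ∷_) (shuffle u (y ∷ b₁)) f) (∑-map (y ∷_) (shuffle (x ∷ u) b₁) f))
      where
      f : Word → Carrier
      f δ₁ = ∑[ δ₂ ← shuffle v b₂ ] g (δ₁ ++ m ∷ δ₂)

  -- The shape of the decreasing tree of a shuffle of u and v, where the letters of v exceed those
  -- of u, is assembled from the shapes for u and v: its root is the root for v, and u is cut in two.
  splitT : BT → (BT → BT → Carrier) → Carrier
  splitT leaf       h = h leaf leaf
  splitT (node A B) h = splitT A (λ X Y → h X (node Y B)) + splitT B (λ X Y → h (node A X) Y)

  shuffleT : BT → BT → (BT → Carrier) → Carrier
  shuffleT A leaf         g = g A
  shuffleT A (node B₁ B₂) g = splitT A (λ A₁ A₂ → shuffleT A₁ B₁ (λ X → shuffleT A₂ B₂ (λ Y → g (node X Y))))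

  -- A cut before the maximum leaves the root to the second part, a cut after it leaves the root to
  -- the first: these are the two summands of `splitT`.
  splitW-decr : ∀ {w} → DecrView w → ∀ h → splitW w (λ u v → h (shape (decr u)) (shape (decr v))) ≈ splitT (shape
      (decr w)) h
  splitW-decr empty h = ≈-refl
  splitW-decr (root a m b a≤ b< va vb) h = ≈-trans (splitW-mid a m b _) (≈-trans
    (+-cong
      (≈-trans (splitW-cong a (λ u v e → reflexive (cong (h (shape (decr u)) ∘ shape)
          (decr-mid v (proj₂ (++⁻ u (subst (All (_≤ m)) (sym e) a≤))) b<))))
        (splitW-decr va (λ X Y → h X (node Y (shape (decr b))))))
      (≈-trans (splitW-cong b (λ u v e → reflexive (cong (λ t → h (shape t) (shape (decr v)))
          (decr-mid a a≤ (proj₁ (++⁻ u (subst (All (_< m)) (sym e) b<)))))))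
        (splitW-decr vb (λ X Y → h (node (shape (decr a)) X) Y))))
    (reflexive (cong (λ t → splitT (shape t) h) (sym (decr-mid a a≤ b<)))))

  -- Since `b` lies above `a`, its rightmost maximum `m` is also that of every shuffle.
  -- `shuffle-mid` cuts there, and both sides are again shuffles of a lower with a higher word.
  ∑-shuffle-decr : ∀ {b} → DecrView b → ∀ a → (∀ {x y} → x ∈ a → y ∈ b → x < y) → ∀ g →
                   ∑[ δ ← shuffle a b ] g (shape (decr δ)) ≈ shuffleT (shape (decr a)) (shape (decr b)) g
  ∑-shuffle-decr empty a a<b g rewrite shuffle-[] a = x+0 _
  ∑-shuffle-decr (root b₁ m b₂ b₁≤ b₂< v₁ v₂) a a<b g = begin
    ∑[ δ ← shuffle a (b₁ ++ m ∷ b₂) ] g (shape (decr δ))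
      ≈⟨ shuffle-mid a b₁ m b₂ (g ∘ shape ∘ decr) ⟩
    splitW a (joined b₁ m b₂ (g ∘ shape ∘ decr))
      ≈⟨ splitW-cong a parts ⟩
    splitW a (λ a₁ a₂ → H (shape (decr a₁)) (shape (decr a₂)))
      ≈⟨ splitW-decr (decrView a) H ⟩
    splitT (shape (decr a)) H
      ≈⟨ reflexive (cong (λ t → shuffleT (shape (decr a)) (shape t) g) (sym (decr-mid b₁ b₁≤ b₂<))) ⟩
    shuffleT (shape (decr a)) (shape (decr (b₁ ++ m ∷ b₂))) g ∎
    where
    H : BT → BT → Carrier
    H A₁ A₂ = shuffleT A₁ (shape (decr b₁)) (λ X → shuffleT A₂ (shape (decr b₂)) (λ Y → g (node X Y)))
    a<m : All (_< m) a
    a<m = All.tabulate (λ i → a<b i (∈-++⁺ʳ b₁ (here refl)))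
    all-↭ : ∀ {p} {P : ℕ → Set p} {v w} → w ↭ v → All P v → All P w
    all-↭ s h = All.tabulate (λ i → All.lookup h (∈-resp-↭ s i))
    parts : ∀ a₁ a₂ → a₁ ++ a₂ ≡ a → joined b₁ m b₂ (g ∘ shape ∘ decr) a₁ a₂ ≈ H (shape (decr a₁)) (shape (decr a₂))
    parts a₁ a₂ refl = begin
      ∑[ δ₁ ← shuffle a₁ b₁ ] ∑[ δ₂ ← shuffle a₂ b₂ ] g (shape (decr (δ₁ ++ m ∷ δ₂)))
        ≈⟨ ∑-cong (shuffle a₁ b₁) (λ {δ₁} i → ∑-cong (shuffle a₂ b₂) (λ {δ₂} j → reflexive (cong (g ∘ shape)
             (decr-mid δ₁ (all-↭ (shuffle-↭ a₁ b₁ i) (++⁺ (All.map <⇒≤ (proj₁ (++⁻ a₁ a<m))) b₁≤))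
                          (all-↭ (shuffle-↭ a₂ b₂ j) (++⁺ (proj₂ (++⁻ a₁ a<m)) b₂<)))))) ⟩
      ∑[ δ₁ ← shuffle a₁ b₁ ] ∑[ δ₂ ← shuffle a₂ b₂ ] g (node (shape (decr δ₁)) (shape (decr δ₂)))
        ≈⟨ ∑-cong (shuffle a₁ b₁) (λ {δ₁} _ → ∑-shuffle-decr v₂ a₂ (λ i j → a<b (∈-++⁺ʳ a₁ i) (∈-++⁺ʳ b₁ (there j)))
            (λ Y → g (node (shape (decr δ₁)) Y))) ⟩
      ∑[ δ₁ ← shuffle a₁ b₁ ] shuffleT (shape (decr a₂)) (shape (decr b₂)) (λ Y → g (node (shape (decr δ₁)) Y))
        ≈⟨ ∑-shuffle-decr v₁ a₁ (λ i j → a<b (∈-++⁺ˡ i) (∈-++⁺ˡ j)) (λ X → shuffleT (shape (decr a₂)) (shape (decr b₂))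
            (λ Y → g (node X Y))) ⟩
      H (shape (decr a₁)) (shape (decr a₂)) ∎

  ∑-shifted-shuffle-decr : ∀ {k l u v} → Fills 0 k u → Fills 0 l v → ∀ g →
    ∑[ δ ← shuffle u (map (k ℕ.+_) v) ] g (shape (decr δ)) ≈ shuffleT (shape (decr u)) (shape (decr v)) g
  ∑-shifted-shuffle-decr {k} {l} {u} {v} F G g = ≈-trans (∑-shuffle-decr (decrView (map (k ℕ.+_) v)) u below g)
    (reflexive (cong (λ t → shuffleT (shape (decr u)) t g) (shape-decr-shift k v)))
    where
    below : ∀ {x y} → x ∈ u → y ∈ map (k ℕ.+_) v → x < y
    below i j with ∈-map⁻ (k ℕ.+_) j
    ... | z , j′ , refl = ≤-<-trans (proj₂ (sound F i)) (m<m+n k (proj₁ (sound G j′)))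

  -- Linear forms on free modules

  -- Coefficients are values of such forms (`coeff-ev`), and `lin` is absorbed by them (`ev-lin`).
  -- Identities between coefficients thus become interchanges of sums, with no normal form for
  -- lists.
  ev : {B : Set} → FS B → (B → Carrier) → Carrier
  ev x f = ∑[ p ← x ] (proj₁ p * f (proj₂ p))

  module _ {B : Set} where

    ev-cong : ∀ (x : FS B) {f g} → (∀ b → f b ≈ g b) → ev x f ≈ ev x g
    ev-cong x h = ∑-cong x (λ {p} _ → *-congˡ (h (proj₂ p)))

    ev-*ˡ : ∀ k (x : FS B) f → k * ev x f ≈ ev x (λ b → k * f b)
    ev-*ˡ k x f = ≈-trans (∑-*ˡ x k _) (∑-cong x (λ _ → x∙yz≈y∙xz _ _ _))

    ev-*ʳ : ∀ k (x : FS B) f → ev x f * k ≈ ev x (λ b → f b * k)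
    ev-*ʳ k x f = ≈-trans (∑-*ʳ x k _) (∑-cong x (λ _ → *-assoc _ _ _))

    ∑-ev : ∀ {a} {A : Set a} (xs : List A) (x : FS B) (f : A → B → Carrier) →
           ∑[ a ← xs ] ev x (f a) ≈ ev x (λ b → ∑[ a ← xs ] f a b)
    ∑-ev xs x f = ≈-trans (∑-swap xs x (λ a p → proj₁ p * f a (proj₂ p)))
        (∑-cong x (λ {p} _ → ≈-sym (∑-*ˡ xs (proj₁ p) (λ a → f a (proj₂ p)))))

  module _ {B : Set} where

    coeff-ev : ∀ (eq : (a b : B) → Dec (a ≡ b)) x b → coeff eq x b ≈ ev x (λ a → 𝟙 (eq a b))
    coeff-ev eq []            b = ≈-refl
    coeff-ev eq ((k , a) ∷ x) b with eq a b
    ... | d@(yes p) = +-cong (≈-sym (≈-trans (*-congˡ (𝟙-yes d p)) (*-identityʳ k))) (coeff-ev eq x b)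
    ... | d@(no ¬p) = ≈-trans (coeff-ev eq x b) (≈-sym (≈-trans (+-congʳ (≈-trans (*-congˡ (𝟙-no d ¬p)) (zeroʳ k)))
        (0+x _)))

    ev-scale : ∀ k (x : FS B) f → ev (scale k x) f ≈ k * ev x f
    ev-scale k []            f = ≈-sym (zeroʳ k)
    ev-scale k ((j , a) ∷ x) f = ≈-trans (+-cong (*-assoc k j (f a)) (ev-scale k x f)) (≈-sym (distribˡ k _ _))

    ev-lin : ∀ {C : Set} (g : C → FS B) x f → ev (lin g x) f ≈ ev x (λ a → ev (g a) f)
    ev-lin g []            f = ≈-refl
    ev-lin g ((k , a) ∷ x) f = ≈-trans (∑-++ (scale k (g a)) (lin g x) _) (+-cong (ev-scale k (g a) f) (ev-lin g x f))

    coeff-lin : ∀ {C : Set} (eq : (a b : B) → Dec (a ≡ b)) (g : C → FS B) x b →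
        coeff eq (lin g x) b ≈ ev x (λ a → coeff eq (g a) b)
    coeff-lin eq g x b = ≈-trans (coeff-ev eq (lin g x) b) (≈-trans (ev-lin g x _) (ev-cong x (λ a → ≈-sym (coeff-ev eq
        (g a) b))))

    ev-swap : ∀ {C : Set} (x : FS B) (y : FS C) (f : B → C → Carrier) →
        ev x (λ b → ev y (f b)) ≈ ev y (λ c → ev x (λ b → f b c))
    ev-swap x y f = ≈-trans (∑-cong x (λ {p} _ → ev-*ˡ (proj₁ p) y (f (proj₂ p))))
        (∑-ev x y (λ p c → proj₁ p * f (proj₂ p) c))

    ev-map : ∀ {a} {A : Set a} (k : A → Carrier) (h : A → B) xs f →
        ev (map (λ a → (k a , h a)) xs) f ≈ ∑[ a ← xs ] (k a * f (h a))
    ev-map k h xs f = ∑-map (λ a → (k a , h a)) xs (λ p → proj₁ p * f (proj₂ p))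

    ev-select : ∀ {a p} {A : Set a} {P : A → Set p} (d : ∀ x → Dec (P x)) (h : A → B) xs f →
                ev (concatMap (λ x → if ⌊ d x ⌋ then (1# , h x) ∷ [] else []) xs) f ≈ ∑[ x ← xs ] (𝟙 (d x) * f (h x))
    ev-select d h []       f = ≈-refl
    ev-select d h (x ∷ xs) f with d x
    ... | dx@(yes p) = +-cong (*-congʳ (≈-sym (𝟙-yes dx p))) (ev-select d h xs f)
    ... | dx@(no ¬p) = ≈-trans (ev-select d h xs f) (≈-sym (≈-trans (+-congʳ (≈-trans (*-congʳ (𝟙-no dx ¬p)) (zeroˡ _)))
        (0+x _)))

  coeff-bilin : ∀ {B C D : Set} (eq : (a b : D) → Dec (a ≡ b)) (g : B → C → FS D) x y b →
                coeff eq (bilin g x y) b ≈ ev x (λ a → ev y (λ a′ → coeff eq (g a a′) b))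
  coeff-bilin eq g x y b = ≈-trans (coeff-lin eq _ x b) (ev-cong x (λ a → coeff-lin eq (g a) y b))

  coeff-⊗ : ∀ {B C : Set} (e₁ : (a b : B) → Dec (a ≡ b)) (e₂ : (a b : C) → Dec (a ≡ b)) x y X Y →
            coeff (pairEq e₁ e₂) (x ⊗ y) (X , Y) ≈ coeff e₁ x X * coeff e₂ y Y
  coeff-⊗ e₁ e₂ x y X Y = begin
    coeff (pairEq e₁ e₂) (x ⊗ y) (X , Y)
      ≈⟨ coeff-bilin (pairEq e₁ e₂) (λ b c → basis (b , c)) x y (X , Y) ⟩
    ev x (λ a → ev y (λ b → coeff (pairEq e₁ e₂) (basis (a , b)) (X , Y)))
      ≈⟨ ev-cong x (λ a → ev-cong y (λ b → ≈-trans (coeff-ev (pairEq e₁ e₂) (basis (a , b)) (X , Y))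
           (≈-trans (x+0 _) (≈-trans (*-identityˡ _) (≈-sym (𝟙-× (e₁ a X) (e₂ b Y) (pairEq e₁ e₂ (a , b) (X , Y))
             (λ { refl refl → refl }) (λ { refl → refl }) (λ { refl → refl }))))))) ⟩
    ev x (λ a → ev y (λ b → 𝟙 (e₁ a X) * 𝟙 (e₂ b Y)))
      ≈⟨ ev-cong x (λ a → ev-*ˡ (𝟙 (e₁ a X)) y (λ b → 𝟙 (e₂ b Y))) ⟨
    ev x (λ a → 𝟙 (e₁ a X) * ev y (λ b → 𝟙 (e₂ b Y)))
      ≈⟨ ev-*ʳ (ev y (λ b → 𝟙 (e₂ b Y))) x (λ a → 𝟙 (e₁ a X)) ⟨
    ev x (λ a → 𝟙 (e₁ a X)) * ev y (λ b → 𝟙 (e₂ b Y))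
      ≈⟨ *-cong (coeff-ev e₁ x X) (coeff-ev e₂ y Y) ⟨
    coeff e₁ x X * coeff e₂ y Y ∎

  -- `ΔP` and `ΔQ` both have this form by definition, so one coefficient formula serves the two.
  graded : ℕ → (BT → BT → Carrier) → FS (BT × BT)
  graded n c = concatMap (λ k → concatMap (λ A → map (λ B → (c A B , (A , B))) (treesOfSize (n ∸ k))) (treesOfSize k))
      (upTo (suc n))

  ev-graded : ∀ n c f → ev (graded n c) f ≈
              ∑[ k ← upTo (suc n) ] ∑[ A ← treesOfSize k ] ∑[ B ← treesOfSize (n ∸ k) ] (c A B * f (A , B))
  ev-graded n c f = ≈-trans
    (∑-concatMap (λ k → concatMap (λ A → map (λ B → (c A B , (A , B))) (treesOfSize (n ∸ k))) (treesOfSize k))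
        (upTo (suc n)) _)
    (∑-cong (upTo (suc n)) (λ {k} _ → ≈-trans (∑-concatMap (λ A → map (λ B → (c A B , (A , B))) (treesOfSize (n ∸ k)))
        (treesOfSize k) _)
      (∑-cong (treesOfSize k) (λ {A} _ → ev-map (c A) (A ,_) (treesOfSize (n ∸ k)) f))))

  graded-pick : ∀ n X Y (g : BT → BT → Carrier) →
    ∑[ k ← upTo (suc n) ] ∑[ A ← treesOfSize k ] ∑[ B ← treesOfSize (n ∸ k) ] (𝟙 (X ≟ᵀ A) * (𝟙 (Y ≟ᵀ B) * g A B))
    ≈ 𝟙 ((size X ℕ.+ size Y) ≟ℕ n) * g X Y
  graded-pick n X Y g = begin
    ∑[ k ← upTo (suc n) ] ∑[ A ← treesOfSize k ] ∑[ B ← treesOfSize (n ∸ k) ] (𝟙 (X ≟ᵀ A) * (𝟙 (Y ≟ᵀ B) * g A B))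
      ≈⟨ ∑-cong (upTo (suc n)) (λ {k} _ → begin
           ∑[ A ← treesOfSize k ] ∑[ B ← treesOfSize (n ∸ k) ] (𝟙 (X ≟ᵀ A) * (𝟙 (Y ≟ᵀ B) * g A B))
             ≈⟨ ∑-cong (treesOfSize k) (λ {A} _ → ≈-trans (≈-sym (∑-*ˡ (treesOfSize (n ∸ k)) (𝟙 (X ≟ᵀ A)) (λ B → 𝟙
                 (Y ≟ᵀ B) * g A B)))
                  (*-congˡ (trees-pick (n ∸ k) Y (g A)))) ⟩
           ∑[ A ← treesOfSize k ] (𝟙 (X ≟ᵀ A) * (𝟙 (size Y ≟ℕ (n ∸ k)) * g A Y))
             ≈⟨ trees-pick k X (λ A → 𝟙 (size Y ≟ℕ (n ∸ k)) * g A Y) ⟩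
           𝟙 (size X ≟ℕ k) * (𝟙 (size Y ≟ℕ (n ∸ k)) * g X Y)
             ≈⟨ *-assoc _ _ _ ⟨
           𝟙 (size X ≟ℕ k) * 𝟙 (size Y ≟ℕ (n ∸ k)) * g X Y ∎) ⟩
    ∑[ k ← upTo (suc n) ] (𝟙 (size X ≟ℕ k) * 𝟙 (size Y ≟ℕ (n ∸ k)) * g X Y)
      ≈⟨ ∑-*ʳ (upTo (suc n)) (g X Y) (λ k → 𝟙 (size X ≟ℕ k) * 𝟙 (size Y ≟ℕ (n ∸ k))) ⟨
    ∑[ k ← upTo (suc n) ] (𝟙 (size X ≟ℕ k) * 𝟙 (size Y ≟ℕ (n ∸ k))) * g X Y
      ≈⟨ *-congʳ (upTo-split n (size X) (size Y)) ⟩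
    𝟙 ((size X ℕ.+ size Y) ≟ℕ n) * g X Y ∎

  _≟²_ : (p q : BT × BT) → Dec (p ≡ q)
  _≟²_ = pairEq _≟ᵀ_ _≟ᵀ_

  coeff-graded : ∀ n c X Y → coeff _≟²_ (graded n c) (X , Y) ≈ 𝟙 ((size X ℕ.+ size Y) ≟ℕ n) * c X Y
  coeff-graded n c X Y = begin
    coeff _≟²_ (graded n c) (X , Y) ≈⟨ coeff-ev _≟²_ (graded n c) (X , Y) ⟩
    ev (graded n c) (λ p → 𝟙 (p ≟² (X , Y))) ≈⟨ ev-graded n c (λ p → 𝟙 (p ≟² (X , Y))) ⟩
    ∑[ k ← upTo (suc n) ] ∑[ A ← treesOfSize k ] ∑[ B ← treesOfSize (n ∸ k) ] (c A B * 𝟙 ((A , B) ≟² (X , Y)))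
      ≈⟨ ∑-cong (upTo (suc n)) (λ {k} _ → ∑-cong (treesOfSize k)
          (λ {A} _ → ∑-cong (treesOfSize (n ∸ k)) (λ {B} _ → begin
           c A B * 𝟙 ((A , B) ≟² (X , Y)) ≈⟨ *-comm _ _ ⟩
           𝟙 ((A , B) ≟² (X , Y)) * c A B ≈⟨ *-congʳ (𝟙-× (X ≟ᵀ A) (Y ≟ᵀ B) ((A , B) ≟² (X , Y))
               (λ { refl refl → refl }) (λ { refl → refl }) (λ { refl → refl })) ⟨
           𝟙 (X ≟ᵀ A) * 𝟙 (Y ≟ᵀ B) * c A B ≈⟨ *-assoc _ _ _ ⟩
           𝟙 (X ≟ᵀ A) * (𝟙 (Y ≟ᵀ B) * c A B) ∎))) ⟩
    ∑[ k ← upTo (suc n) ] ∑[ A ← treesOfSize k ] ∑[ B ← treesOfSize (n ∸ k) ] (𝟙 (X ≟ᵀ A) * (𝟙 (Y ≟ᵀ B) * c A B))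
      ≈⟨ graded-pick n X Y c ⟩
    𝟙 ((size X ℕ.+ size Y) ≟ℕ n) * c X Y ∎

  coeff-trees : ∀ n (k : BT → Carrier) V → coeff _≟ᵀ_ (map (λ T → (k T , T)) (treesOfSize n)) V ≈ 𝟙 (size V ≟ℕ n) * k V
  coeff-trees n k V = begin
    coeff _≟ᵀ_ (map (λ T → (k T , T)) (treesOfSize n)) V ≈⟨ coeff-ev _≟ᵀ_ (map (λ T → (k T , T)) (treesOfSize n)) V ⟩
    ev (map (λ T → (k T , T)) (treesOfSize n)) (λ T → 𝟙 (T ≟ᵀ V)) ≈⟨ ev-map k id (treesOfSize n) (λ T → 𝟙 (T ≟ᵀ V)) ⟩
    ∑[ T ← treesOfSize n ] (k T * 𝟙 (T ≟ᵀ V))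
      ≈⟨ ∑-cong (treesOfSize n) (λ {T} _ → ≈-trans (*-comm _ _) (*-congʳ (𝟙-cong (T ≟ᵀ V) (V ≟ᵀ T) sym sym))) ⟩
    ∑[ T ← treesOfSize n ] (𝟙 (V ≟ᵀ T) * k T) ≈⟨ trees-pick n V k ⟩
    𝟙 (size V ≟ℕ n) * k V ∎

  -- The matrix of φ

  b d : Word → BT
  b = shape ∘ bst
  d = shape ∘ decr

  size-d : ∀ {n σ} → Fills 0 n σ → size (d σ) ≡ n
  size-d {n} {σ} F = trans (cong size (sym (bst-inverse F)))
      (trans (size-bst (inverse σ)) (fills-length n (inverse-fills F)))

  size-b : ∀ {n σ} → Fills 0 n σ → size (b σ) ≡ n
  size-b {n} {σ} F = trans (size-bst σ) (fills-length n F)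

  ev-P : ∀ T f → ev (P T) f ≈ ∑[ σ ← perms (size T) ] (𝟙 (b σ ≟ᵀ T) * f σ)
  ev-P T = ev-select (λ σ → b σ ≟ᵀ T) id (perms (size T))

  ev-Q′ : ∀ T f → ev (Q′ T) f ≈ ∑[ σ ← perms (size T) ] (𝟙 (b σ ≟ᵀ T) * f (d σ))
  ev-Q′ T f = ≈-trans (ev-select (λ σ → b σ ≟ᵀ T) (b ∘ inverse) (perms (size T)) f)
    (∑-cong (perms (size T)) (λ i → *-congˡ (reflexive (cong f (bst-inverse (perms-fills (size T) i))))))

  ev-Q′-cong : ∀ T {f g} → (∀ R → size R ≡ size T → f R ≈ g R) → ev (Q′ T) f ≈ ev (Q′ T) g
  ev-Q′-cong T {f} {g} h = ≈-trans (ev-Q′ T f) (≈-trans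
    (∑-cong (perms (size T)) (λ {σ} i → *-congˡ (h (d σ) (size-d (perms-fills (size T) i))))) (≈-sym (ev-Q′ T g)))

  M : BT → BT → Carrier
  M R S = coeff _≟ᵀ_ (Q′ R) S

  M-ev : ∀ R S → M R S ≈ ev (Q′ R) (λ T → 𝟙 (T ≟ᵀ S))
  M-ev R S = coeff-ev _≟ᵀ_ (Q′ R) S

  M-∑ : ∀ R S → M R S ≈ ∑[ σ ← perms (size R) ] (𝟙 (b σ ≟ᵀ R) * 𝟙 (d σ ≟ᵀ S))
  M-∑ R S = ≈-trans (M-ev R S) (ev-Q′ R (λ T → 𝟙 (T ≟ᵀ S)))

  M-zero : ∀ R S → size R ≢ size S → M R S ≈ 0#
  M-zero R S ne = ≈-trans (M-∑ R S) (∑-zero (perms (size R)) (λ {σ} i → ≈-trans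
    (*-congˡ (𝟙-no (d σ ≟ᵀ S) (λ { refl → ne (sym (size-d (perms-fills (size R) i))) }))) (zeroʳ _)))

  M-sym : ∀ R S → M R S ≈ M S R
  M-sym R S with size R ≟ℕ size S
  -- The two entries are sums over `perms (size R)` and `perms (size S)`; unless these lists agree,
  -- both entries vanish.
  ... | no ne = ≈-trans (M-zero R S ne) (≈-sym (M-zero S R (ne ∘ sym)))
  ... | yes e = begin
    M R S ≈⟨ M-∑ R S ⟩
    ∑[ σ ← perms (size R) ] (𝟙 (b σ ≟ᵀ R) * 𝟙 (d σ ≟ᵀ S))
      ≈⟨ ∑-inverse (size R) (λ σ → 𝟙 (b σ ≟ᵀ R) * 𝟙 (d σ ≟ᵀ S)) ⟨
    ∑[ σ ← perms (size R) ] (𝟙 (b (inverse σ) ≟ᵀ R) * 𝟙 (d (inverse σ) ≟ᵀ S))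
      ≈⟨ ∑-cong (perms (size R)) (λ i → ≈-trans (reflexive (cong₂ (λ X Y → 𝟙 (X ≟ᵀ R) * 𝟙 (Y ≟ᵀ S))
           (bst-inverse (perms-fills (size R) i)) (decr-inverse (perms-fills (size R) i)))) (*-comm _ _)) ⟩
    ∑[ σ ← perms (size R) ] (𝟙 (b σ ≟ᵀ S) * 𝟙 (d σ ≟ᵀ R))
      ≈⟨ reflexive (cong (λ n → ∑[ σ ← perms n ] (𝟙 (b σ ≟ᵀ S) * 𝟙 (d σ ≟ᵀ R))) e) ⟩
    ∑[ σ ← perms (size S) ] (𝟙 (b σ ≟ᵀ S) * 𝟙 (d σ ≟ᵀ R))
      ≈⟨ M-∑ S R ⟨
    M S R ∎

  coeff-φ : ∀ x V → coeff _≟ᵀ_ (φ x) V ≈ ev x (λ T → M T V)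
  coeff-φ x V = coeff-lin _≟ᵀ_ Q′ x V

  -- Structure constants

  cP : BT → BT → BT → Carrier
  cP X Y = coeffP (bilin mulF (P X) (P Y))

  cΔ : BT → BT → BT → Carrier
  cΔ V A B = coeffPP (lin ΔF (P V)) (A , B)

  module _ (X Y : BT) where
    private
      k n : ℕ
      k = size X
      n = k ℕ.+ size Y

    splitsTo : Word → Carrier
    splitsTo w = 𝟙 (b (lo k w) ≟ᵀ X) * 𝟙 (b (unshift k (hi k w)) ≟ᵀ Y)

    -- Only `σ = lo k w` and `τ = unshift k (hi k w)` have `w` in their shifted shuffle, so the
    -- double sum has a single term that can be nonzero.
    splitsTo-∑ : ∀ {w} → Fills 0 n w →
      ∑[ σ ← perms k ] (𝟙 (b σ ≟ᵀ X) * ∑[ τ ← perms (size Y) ] (𝟙 (b τ ≟ᵀ Y) * split k w (σ , τ))) ≈ splitsTo w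
    splitsTo-∑ {w} F = begin
      ∑[ σ ← perms k ] (𝟙 (b σ ≟ᵀ X) * ∑[ τ ← perms (size Y) ] (𝟙 (b τ ≟ᵀ Y) * split k w (σ , τ)))
        ≈⟨ ∑-cong (perms k) (λ {σ} _ → *-congˡ (begin
             ∑[ τ ← perms (size Y) ] (𝟙 (b τ ≟ᵀ Y) * (𝟙 (lo k w ≟ᵂ σ) * 𝟙 (hw ≟ᵂ τ)))
               ≈⟨ ∑-cong (perms (size Y)) (λ {τ} _ → ≈-trans (x∙yz≈y∙xz _ _ _)
                   (*-congˡ (≈-trans (*-comm _ _) (*-congʳ (𝟙-cong (hw ≟ᵂ τ) (τ ≟ᵂ hw) sym sym))))) ⟩
             ∑[ τ ← perms (size Y) ] (𝟙 (lo k w ≟ᵂ σ) * (𝟙 (τ ≟ᵂ hw) * 𝟙 (b τ ≟ᵀ Y)))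
               ≈⟨ ∑-*ˡ (perms (size Y)) (𝟙 (lo k w ≟ᵂ σ)) (λ τ → 𝟙 (τ ≟ᵂ hw) * 𝟙 (b τ ≟ᵀ Y)) ⟨
             𝟙 (lo k w ≟ᵂ σ) * ∑[ τ ← perms (size Y) ] (𝟙 (τ ≟ᵂ hw) * 𝟙 (b τ ≟ᵀ Y))
               ≈⟨ *-congˡ (perms-pick (size Y) (fills-unshift k (hi-fills z≤n F)) (λ τ → 𝟙 (b τ ≟ᵀ Y))) ⟩
             𝟙 (lo k w ≟ᵂ σ) * 𝟙 (b hw ≟ᵀ Y) ∎)) ⟩
      ∑[ σ ← perms k ] (𝟙 (b σ ≟ᵀ X) * (𝟙 (lo k w ≟ᵂ σ) * 𝟙 (b hw ≟ᵀ Y)))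
        ≈⟨ ∑-cong (perms k) (λ {σ} _ → ≈-trans (x∙yz≈y∙xz _ _ _)
            (*-congʳ (𝟙-cong (lo k w ≟ᵂ σ) (σ ≟ᵂ lo k w) sym sym))) ⟩
      ∑[ σ ← perms k ] (𝟙 (σ ≟ᵂ lo k w) * (𝟙 (b σ ≟ᵀ X) * 𝟙 (b hw ≟ᵀ Y)))
        ≈⟨ perms-pick k (lo-fills (m≤m+n k (size Y)) F) (λ σ → 𝟙 (b σ ≟ᵀ X) * 𝟙 (b hw ≟ᵀ Y)) ⟩
      splitsTo w ∎
      where
      hw : Word
      hw = unshift k (hi k w)

    coeff-mulF : ∀ {σ τ} → Fills 0 k σ → Fills 0 (size Y) τ → ∀ w → coeff _≟ᵂ_ (mulF σ τ) w ≈ split k w (σ , τ)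
    coeff-mulF {σ} {τ} F G w = begin
      coeff _≟ᵂ_ (mulF σ τ) w ≈⟨ coeff-ev _≟ᵂ_ (mulF σ τ) w ⟩
      ev (mulF σ τ) (λ δ → 𝟙 (δ ≟ᵂ w)) ≈⟨ ev-map (λ _ → 1#) id (shuffle σ (map (length σ ℕ.+_) τ)) (λ δ → 𝟙 (δ ≟ᵂ w)) ⟩
      ∑[ δ ← shuffle σ (map (length σ ℕ.+_) τ) ] (1# * 𝟙 (δ ≟ᵂ w)) ≈⟨ ∑-cong (shuffle σ
          (map (length σ ℕ.+_) τ)) (λ _ → *-identityˡ _) ⟩
      ∑[ δ ← shuffle σ (map (length σ ℕ.+_) τ) ] 𝟙 (δ ≟ᵂ w)
        ≈⟨ reflexive (cong (λ j → ∑[ δ ← shuffle σ (map (j ℕ.+_) τ) ] 𝟙 (δ ≟ᵂ w)) (fills-length k F)) ⟩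
      ∑[ δ ← shuffle σ (map (k ℕ.+_) τ) ] 𝟙 (δ ≟ᵂ w)
        ≈⟨ shifted-shuffle-count (All.map proj₂ (fills-All F)) (All.map proj₁ (fills-All G)) w ⟩
      split k w (σ , τ) ∎

    -- `cP` reads the coefficient at `canon (b γ)`, a word with the same search tree as `γ`. By
    -- `bst-lo` and `bst-hi` the restrictions of the two words have equal search trees too, so the
    -- coefficient is constant on each class.
    cP-splitsTo : ∀ {γ} → Fills 0 n γ → cP X Y (b γ) ≈ splitsTo γ
    cP-splitsTo {γ} F = begin
      coeff _≟ᵂ_ (bilin mulF (P X) (P Y)) w
        ≈⟨ coeff-bilin _≟ᵂ_ mulF (P X) (P Y) w ⟩
      ev (P X) (λ σ → ev (P Y) (λ τ → coeff _≟ᵂ_ (mulF σ τ) w))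
        ≈⟨ ev-P X _ ⟩
      ∑[ σ ← perms k ] (𝟙 (b σ ≟ᵀ X) * ev (P Y) (λ τ → coeff _≟ᵂ_ (mulF σ τ) w))
        ≈⟨ ∑-cong (perms k) (λ {σ} i → *-congˡ (≈-trans (ev-P Y (λ τ → coeff _≟ᵂ_ (mulF σ τ) w))
             (∑-cong (perms (size Y)) (λ {τ} j → *-congˡ (coeff-mulF (perms-fills k i) (perms-fills (size Y) j) w))))) ⟩
      ∑[ σ ← perms k ] (𝟙 (b σ ≟ᵀ X) * ∑[ τ ← perms (size Y) ] (𝟙 (b τ ≟ᵀ Y) * split k w (σ , τ)))
        ≈⟨ splitsTo-∑ Fw ⟩
      splitsTo w
        ≈⟨ reflexive (cong₂ (λ S T → 𝟙 (S ≟ᵀ X) * 𝟙 (T ≟ᵀ Y)) same-lo same-hi) ⟩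
      splitsTo γ ∎
      where
      w : Word
      w = canon (b γ)
      Fw : Fills 0 n w
      Fw = subst (λ m → Fills 0 m w) (size-b F) (canon-fills (b γ))
      same : bst w ≡ bst γ
      same = bst-shape-injective Fw F (shape-bst-canon (b γ))
      same-lo : b (lo k w) ≡ b (lo k γ)
      same-lo = cong shape (trans (bst-lo k w) (trans (cong (cutLo k) same) (sym (bst-lo k γ))))
      unshift-b : ∀ v → b (unshift k (hi k v)) ≡ b (hi k v)
      unshift-b v = trans (sym (shape-bst-shift k (unshift k (hi k v))))
        (cong b (shift-unshift k (All.tabulate (λ i → <⇒≤ (proj₂ (∈-filter⁻ (k <?_) {xs = v} i))))))
      same-hi : b (unshift k (hi k w)) ≡ b (unshift k (hi k γ))
      same-hi = trans (unshift-b w) (trans (cong shape (trans (bst-hi k w) (trans (cong (cutHi k) same)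
          (sym (bst-hi k γ))))) (sym (unshift-b γ)))

  _≟ᵂ²_ : (p q : Word × Word) → Dec (p ≡ q)
  _≟ᵂ²_ = pairEq _≟ᵂ_ _≟ᵂ_

  -- Only the cut at `k` gives a first factor as long as `α`, so the factor `𝟙 (k ≟ℕ j)` may be
  -- inserted and `∑-pick` applied. The standardised factors are then compared through their
  -- inverses, by `lo-inverse` and `hi-inverse`.
  coeff-ΔF : ∀ {k l α β γ} → Fills 0 k α → Fills 0 l β → Fills 0 (k ℕ.+ l) γ →
             coeff _≟ᵂ²_ (ΔF γ) (α , β) ≈ split k (inverse γ) (inverse α , inverse β)
  coeff-ΔF {k} {l} {α} {β} {γ} Fα Fβ F = begin
    coeff _≟ᵂ²_ (ΔF γ) (α , β)
      ≈⟨ coeff-ev _≟ᵂ²_ (ΔF γ) (α , β) ⟩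
    ev (ΔF γ) (λ p → 𝟙 (p ≟ᵂ² (α , β)))
      ≈⟨ ev-map (λ _ → 1#) cut (upTo (suc (length γ))) (λ p → 𝟙 (p ≟ᵂ² (α , β))) ⟩
    ∑[ j ← upTo (suc (length γ)) ] (1# * 𝟙 (cut j ≟ᵂ² (α , β)))
      ≈⟨ reflexive (cong (λ m → ∑[ j ← upTo (suc m) ] (1# * 𝟙 (cut j ≟ᵂ² (α , β)))) len) ⟩
    ∑[ j ← upTo (suc n) ] (1# * 𝟙 (cut j ≟ᵂ² (α , β)))
      ≈⟨ ∑-cong (upTo (suc n)) (λ {j} i → ≈-trans (*-identityˡ _) (≈-sym (𝟙-× (k ≟ℕ j) (cut j ≟ᵂ² (α , β)) (cut j ≟ᵂ²
          (α , β)) (λ _ e → e) (λ e → position-of (below i) e) id))) ⟩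
    ∑[ j ← upTo (suc n) ] (𝟙 (k ≟ℕ j) * 𝟙 (cut j ≟ᵂ² (α , β)))
      ≈⟨ ∑-pick (upTo (suc n)) (k ≟ℕ_) (upTo-count (suc n) (s≤s (m≤m+n k l))) sym (λ j → 𝟙 (cut j ≟ᵂ² (α , β))) ⟩
    𝟙 (cut k ≟ᵂ² (α , β))
      ≈⟨ 𝟙-× (lo k (inverse γ) ≟ᵂ inverse α) (unshift k (hi k (inverse γ)) ≟ᵂ inverse β) (cut k ≟ᵂ² (α , β))
           (λ p q → cong₂ _,_ (inverse-injective (fills-std-u) Fα (trans (sym lo≡) p))
               (inverse-injective (fills-std-v) Fβ (trans (sym hi≡) q)))
           (λ e → trans lo≡ (cong (inverse ∘ proj₁) e)) (λ e → trans hi≡ (cong (inverse ∘ proj₂) e)) ⟨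
    split k (inverse γ) (inverse α , inverse β) ∎
    where
    n : ℕ
    n = k ℕ.+ l
    cut : ℕ → Word × Word
    cut j = std (take j γ) , std (drop j γ)
    len : length γ ≡ n
    len = fills-length n F
    below : ∀ {j} → j ∈ upTo (suc n) → j ≤ n
    below i with ∈-applyUpTo⁻ id i
    ... | _ , p , refl = ℕ.s≤s⁻¹ p
    length-take-≤ : ∀ {j} → j ≤ n → length (take j γ) ≡ j
    length-take-≤ {j} p = trans (length-take j γ) (m≤n⇒m⊓n≡m (≤-trans p (≤-reflexive (sym len))))
    F′ : ∀ j → Fills 0 n (take j γ ++ drop j γ)
    F′ j = subst (Fills 0 n) (sym (take++drop≡id j γ)) F
    std-u : ∀ j → Fills 0 (length (take j γ)) (std (take j γ))
    std-u j = std-fills (proj₁ (unique-++⁻ (take j γ) (unique (F′ j)))) (proj₁ (++⁻ (take j γ) (fills-All (F′ j))))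
    position-of : ∀ {j} → j ≤ n → cut j ≡ (α , β) → k ≡ j
    position-of {j} p e = trans (sym (fills-length k Fα)) (trans (cong (length ∘ proj₁) (sym e))
      (trans (fills-length _ (std-u j)) (length-take-≤ p)))
    u v : Word
    u = take k γ
    v = drop k γ
    |u| : length u ≡ k
    |u| = length-take-≤ (m≤m+n k l)
    |v| : length v ≡ l
    |v| = +-cancelˡ-≡ k _ _ (trans (cong (ℕ._+ length v) (sym |u|)) (trans (sym (length-++ u))
        (trans (cong length (take++drop≡id k γ)) len)))
    fills-std-u : Fills 0 k (std u)
    fills-std-u = subst (λ m → Fills 0 m (std u)) |u| (std-u k)
    fills-std-v : Fills 0 l (std v)
    fills-std-v = subst (λ m → Fills 0 m (std v)) |v| (std-fills (proj₁ (proj₂ (unique-++⁻ u (unique (F′ k)))))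
        (proj₂ (++⁻ u (fills-All (F′ k)))))
    lo≡ : lo k (inverse γ) ≡ inverse (std u)
    lo≡ = trans (cong₂ (λ j w → lo j (inverse w)) (sym |u|) (sym (take++drop≡id k γ))) (lo-inverse u (F′ k))
    hi≡ : unshift k (hi k (inverse γ)) ≡ inverse (std v)
    hi≡ = trans (cong₂ (λ j w → unshift j (hi j (inverse w))) (sym |u|) (sym (take++drop≡id k γ))) (hi-inverse u (F′ k))

  -- Passing to inverses turns cuts into shuffles of `inverse (canon A)` and `inverse (canon B)`.
  -- Only the decreasing trees of these words count, and they are `A` and `B`.
  cΔ-shuffleT : ∀ V A B → size A ℕ.+ size B ≡ size V → cΔ V A B ≈ shuffleT A B (λ T → 𝟙 (T ≟ᵀ V))
  cΔ-shuffleT V A B e = begin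
    coeff _≟ᵂ²_ (lin ΔF (P V)) (canon A , canon B)
      ≈⟨ coeff-lin _≟ᵂ²_ ΔF (P V) (canon A , canon B) ⟩
    ev (P V) (λ γ → coeff _≟ᵂ²_ (ΔF γ) (canon A , canon B))
      ≈⟨ ev-P V _ ⟩
    ∑[ γ ← perms (size V) ] (𝟙 (b γ ≟ᵀ V) * coeff _≟ᵂ²_ (ΔF γ) (canon A , canon B))
      ≈⟨ reflexive (cong (λ m → ∑[ γ ← perms m ] (𝟙 (b γ ≟ᵀ V) * coeff _≟ᵂ²_ (ΔF γ) (canon A , canon B))) (sym e)) ⟩
    ∑[ γ ← perms n ] (𝟙 (b γ ≟ᵀ V) * coeff _≟ᵂ²_ (ΔF γ) (canon A , canon B))
      ≈⟨ ∑-cong (perms n) (λ {γ} i → ≈-trans (*-cong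
           (reflexive (cong (λ T → 𝟙 (T ≟ᵀ V)) (sym (decr-inverse (perms-fills n i)))))
           (coeff-ΔF (canon-fills A) (canon-fills B) (perms-fills n i))) (*-comm _ _)) ⟩
    ∑[ γ ← perms n ] (split (size A) (inverse γ) (α , β) * 𝟙 (d (inverse γ) ≟ᵀ V))
      ≈⟨ ∑-inverse n (λ δ → split (size A) δ (α , β) * 𝟙 (d δ ≟ᵀ V)) ⟩
    ∑[ δ ← perms n ] (split (size A) δ (α , β) * 𝟙 (d δ ≟ᵀ V))
      ≈⟨ ∑-shuffle Fα Fβ (λ δ → 𝟙 (d δ ≟ᵀ V)) ⟨
    ∑[ δ ← shuffle α (map (size A ℕ.+_) β) ] 𝟙 (d δ ≟ᵀ V)
      ≈⟨ ∑-shifted-shuffle-decr Fα Fβ (λ T → 𝟙 (T ≟ᵀ V)) ⟩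
    shuffleT (d α) (d β) (λ T → 𝟙 (T ≟ᵀ V))
      ≈⟨ reflexive (cong₂ (λ S T → shuffleT S T (λ T → 𝟙 (T ≟ᵀ V)))
           (trans (decr-inverse (canon-fills A)) (shape-bst-canon A)) (trans (decr-inverse (canon-fills B))
               (shape-bst-canon B))) ⟩
    shuffleT A B (λ T → 𝟙 (T ≟ᵀ V)) ∎
    where
    n : ℕ
    n = size A ℕ.+ size B
    α β : Word
    α = inverse (canon A)
    β = inverse (canon B)
    Fα : Fills 0 (size A) α
    Fα = inverse-fills (canon-fills A)
    Fβ : Fills 0 (size B) β
    Fβ = inverse-fills (canon-fills B)

  -- Products and coproducts

  -- The coefficients of `φ (mulP X Y)` at `V` and of `ΔQlin (Q′ V)` at `(X , Y)` both reduce to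
  -- this form; those of `Q′ X ·Q Q′ Y` and `φ⊗φ (ΔP V)` reduce to `coproductForm`. Both
  -- compatibilities thus become one identity.
  productForm : BT → BT → BT → Carrier
  productForm V X Y = ev (Q′ V) (λ R → 𝟙 ((size X ℕ.+ size Y) ≟ℕ size R) * cP X Y R)

  coproductForm : BT → BT → BT → Carrier
  coproductForm V X Y = ev (Q′ X) (λ R → ev (Q′ Y) (λ S → 𝟙 ((size R ℕ.+ size S) ≟ℕ size V) * cΔ V R S))

  -- The same degree condition arises twice, from two nested enumerations of trees.
  𝟙-absorb : ∀ {p q} {A : Set p} {B : Set q} (a : Dec A) (b : Dec B) → (B → A) → ∀ x → 𝟙 a * (𝟙 b * x) ≈ 𝟙 b * x
  𝟙-absorb a b g x = ≈-trans (≈-sym (*-assoc _ _ _)) (*-congʳ (𝟙-× a b b (λ _ q → q) g id))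

  coeff-mulP : ∀ X Y V → coeff _≟ᵀ_ (mulP X Y) V ≈ 𝟙 ((size X ℕ.+ size Y) ≟ℕ size V) * cP X Y V
  coeff-mulP X Y V = ≈-trans (coeff-trees (size X ℕ.+ size Y) (cP X Y) V)
      (*-congʳ (𝟙-cong (size V ≟ℕ (size X ℕ.+ size Y)) _ sym sym))

  -- `M-sym` turns the column of `V` into its row, so the sum becomes an evaluation on `Q′ V`.
  coeff-φ-mulP : ∀ X Y V → coeff _≟ᵀ_ (φ (mulP X Y)) V ≈ productForm V X Y
  coeff-φ-mulP X Y V = begin
    coeff _≟ᵀ_ (φ (mulP X Y)) V ≈⟨ coeff-φ (mulP X Y) V ⟩
    ev (mulP X Y) (λ T → M T V) ≈⟨ ev-cong (mulP X Y) (λ T → ≈-trans (M-sym T V) (M-ev V T)) ⟩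
    ev (mulP X Y) (λ T → ev (Q′ V) (λ R → 𝟙 (R ≟ᵀ T))) ≈⟨ ev-swap (mulP X Y) (Q′ V) (λ T R → 𝟙 (R ≟ᵀ T)) ⟩
    ev (Q′ V) (λ R → ev (mulP X Y) (λ T → 𝟙 (R ≟ᵀ T)))
      ≈⟨ ev-cong (Q′ V) (λ R → ≈-trans (ev-cong (mulP X Y) (λ T → 𝟙-cong (R ≟ᵀ T) (T ≟ᵀ R) sym sym))
           (≈-trans (≈-sym (coeff-ev _≟ᵀ_ (mulP X Y) R)) (coeff-mulP X Y R))) ⟩
    productForm V X Y ∎

  coeff-ΔQ : ∀ V X Y → coeff _≟²_ (ΔQlin (Q′ V)) (X , Y) ≈ productForm V X Y
  coeff-ΔQ V X Y = ≈-trans (coeff-lin _≟²_ ΔQ (Q′ V) (X , Y)) (ev-cong (Q′ V) (λ R → ≈-trans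
    (coeff-graded (size R) (λ A B → coeff _≟ᵀ_ (mulP A B) R) X Y) (≈-trans (*-congˡ (coeff-mulP X Y R))
        (𝟙-absorb _ _ id _))))

  coeff-Q′·Q′ : ∀ X Y V → coeff _≟ᵀ_ (Q′ X ·Q Q′ Y) V ≈ coproductForm V X Y
  coeff-Q′·Q′ X Y V = ≈-trans (coeff-bilin _≟ᵀ_ mulQ (Q′ X) (Q′ Y) V)
      (ev-cong (Q′ X) (λ R → ev-cong (Q′ Y) (λ S → ≈-trans
    (coeff-trees (size R ℕ.+ size S) (λ V → coeff _≟²_ (ΔP V) (R , S)) V)
    (≈-trans (*-congˡ (coeff-graded (size V) (cΔ V) R S)) (𝟙-absorb _ _ sym _)))))

  -- `M-sym` in each tensor factor replaces the entry of `Q′ A` at `X` by that of `Q′ X` at `A`; the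
  -- sums over `A` and `B` then collapse by `graded-pick`.
  coeff-φ⊗φ : ∀ V X Y → coeff _≟²_ (φ⊗φ (ΔP V)) (X , Y) ≈ coproductForm V X Y
  coeff-φ⊗φ V X Y = begin
    coeff _≟²_ (φ⊗φ (ΔP V)) (X , Y)
      ≈⟨ coeff-lin _≟²_ _ (ΔP V) (X , Y) ⟩
    ev (ΔP V) (λ p → coeff _≟²_ (Q′ (proj₁ p) ⊗ Q′ (proj₂ p)) (X , Y))
      ≈⟨ ev-graded n (cΔ V) _ ⟩
    ∑[ k ← upTo (suc n) ] ∑[ A ← treesOfSize k ] ∑[ B ← treesOfSize (n ∸ k) ] (cΔ V A B * coeff _≟²_ (Q′ A ⊗ Q′ B)
        (X , Y))
      ≈⟨ ∑-cong (upTo (suc n)) (λ {k} _ → ∑-cong (treesOfSize k)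
          (λ {A} _ → ∑-cong (treesOfSize (n ∸ k)) (λ {B} _ → expand A B))) ⟩
    ∑[ k ← upTo (suc n) ] ∑[ A ← treesOfSize k ] ∑[ B ← treesOfSize (n ∸ k) ] ev (Q′ X) (λ R → ev (Q′ Y) (term A B R))
      ≈⟨ ∑-cong (upTo (suc n)) (λ {k} _ → ∑-cong (treesOfSize k) (λ {A} _ → ∑-ev² (treesOfSize (n ∸ k)) (term A))) ⟩
    ∑[ k ← upTo (suc n) ] ∑[ A ← treesOfSize k ] ev (Q′ X) (λ R → ev (Q′ Y)
        (λ S → ∑[ B ← treesOfSize (n ∸ k) ] term A B R S))
      ≈⟨ ∑-cong (upTo (suc n)) (λ {k} _ → ∑-ev² (treesOfSize k) (λ A R S → ∑[ B ← treesOfSize (n ∸ k) ] term A B R S)) ⟩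
    ∑[ k ← upTo (suc n) ] ev (Q′ X) (λ R → ev (Q′ Y)
        (λ S → ∑[ A ← treesOfSize k ] ∑[ B ← treesOfSize (n ∸ k) ] term A B R S))
      ≈⟨ ∑-ev² (upTo (suc n)) (λ k R S → ∑[ A ← treesOfSize k ] ∑[ B ← treesOfSize (n ∸ k) ] term A B R S) ⟩
    ev (Q′ X) (λ R → ev (Q′ Y) (λ S → ∑[ k ← upTo (suc n) ] ∑[ A ← treesOfSize k ] ∑[ B ← treesOfSize
        (n ∸ k) ] term A B R S))
      ≈⟨ ev-cong (Q′ X) (λ R → ev-cong (Q′ Y) (λ S → graded-pick n R S (cΔ V))) ⟩
    coproductForm V X Y ∎
    where
    n : ℕ
    n = size V
    term : BT → BT → BT → BT → Carrier
    term A B R S = 𝟙 (R ≟ᵀ A) * (𝟙 (S ≟ᵀ B) * cΔ V A B)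
    ∑-ev² : ∀ {A : Set} (xs : List A) (f : A → BT → BT → Carrier) →
            ∑[ a ← xs ] ev (Q′ X) (λ R → ev (Q′ Y) (f a R)) ≈ ev (Q′ X) (λ R → ev (Q′ Y) (λ S → ∑[ a ← xs ] f a R S))
    ∑-ev² xs f = ≈-trans (∑-ev xs (Q′ X) (λ a R → ev (Q′ Y) (f a R)))
        (ev-cong (Q′ X) (λ R → ∑-ev xs (Q′ Y) (λ a → f a R)))
    expand : ∀ A B → cΔ V A B * coeff _≟²_ (Q′ A ⊗ Q′ B) (X , Y) ≈ ev (Q′ X) (λ R → ev (Q′ Y) (term A B R))
    expand A B = begin
      cΔ V A B * coeff _≟²_ (Q′ A ⊗ Q′ B) (X , Y)
        ≈⟨ *-congˡ (≈-trans (coeff-⊗ _≟ᵀ_ _≟ᵀ_ (Q′ A) (Q′ B) X Y)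
            (*-cong (≈-trans (M-sym A X) (M-ev X A)) (≈-trans (M-sym B Y) (M-ev Y B)))) ⟩
      cΔ V A B * (ev (Q′ X) (λ R → 𝟙 (R ≟ᵀ A)) * ev (Q′ Y) (λ S → 𝟙 (S ≟ᵀ B)))
        ≈⟨ ≈-trans (*-comm _ _) (*-assoc _ _ _) ⟩
      ev (Q′ X) (λ R → 𝟙 (R ≟ᵀ A)) * (ev (Q′ Y) (λ S → 𝟙 (S ≟ᵀ B)) * cΔ V A B)
        ≈⟨ *-congˡ (ev-*ʳ (cΔ V A B) (Q′ Y) (λ S → 𝟙 (S ≟ᵀ B))) ⟩
      ev (Q′ X) (λ R → 𝟙 (R ≟ᵀ A)) * ev (Q′ Y) (λ S → 𝟙 (S ≟ᵀ B) * cΔ V A B)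
        ≈⟨ ev-*ʳ _ (Q′ X) (λ R → 𝟙 (R ≟ᵀ A)) ⟩
      ev (Q′ X) (λ R → 𝟙 (R ≟ᵀ A) * ev (Q′ Y) (λ S → 𝟙 (S ≟ᵀ B) * cΔ V A B))
        ≈⟨ ev-cong (Q′ X) (λ R → ev-*ˡ (𝟙 (R ≟ᵀ A)) (Q′ Y) (λ S → 𝟙 (S ≟ᵀ B) * cΔ V A B)) ⟩
      ev (Q′ X) (λ R → ev (Q′ Y) (term A B R)) ∎

  -- Both forms count the permutations δ with decreasing tree V whose restrictions to the values
  -- ≤ |X| and > |X| have binary search trees X and Y.
  productForm≈coproductForm : ∀ V X Y → productForm V X Y ≈ coproductForm V X Y
  productForm≈coproductForm V X Y with (size X ℕ.+ size Y) ≟ℕ size V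
  ... | no ne = ≈-trans
    (ev-Q′-zero V (λ R e → ≈-trans (*-congʳ (𝟙-no ((size X ℕ.+ size Y) ≟ℕ size R) (λ q → ne (trans q e)))) (zeroˡ _)))
    (≈-sym (ev-Q′-zero X (λ R e → ev-Q′-zero Y (λ S e′ → ≈-trans
      (*-congʳ (𝟙-no ((size R ℕ.+ size S) ≟ℕ size V) (λ q → ne (trans (cong₂ ℕ._+_ (sym e) (sym e′)) q)))) (zeroˡ _)))))
    where
    ev-Q′-zero : ∀ T {f} → (∀ R → size R ≡ size T → f R ≈ 0#) → ev (Q′ T) f ≈ 0#
    ev-Q′-zero T h = ≈-trans (ev-Q′-cong T h) (∑-zero (Q′ T) (λ _ → zeroʳ _))
  ... | yes e = begin
    productForm V X Y
      ≈⟨ ev-Q′-cong V (λ R q → ≈-trans (*-congʳ (𝟙-yes ((size X ℕ.+ size Y) ≟ℕ size R) (trans e (sym q))))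
          (*-identityˡ _)) ⟩
    ev (Q′ V) (cP X Y)
      ≈⟨ ev-Q′ V (cP X Y) ⟩
    ∑[ σ ← perms (size V) ] (𝟙 (b σ ≟ᵀ V) * cP X Y (d σ))
      ≈⟨ reflexive (cong (λ m → ∑[ σ ← perms m ] (𝟙 (b σ ≟ᵀ V) * cP X Y (d σ))) (sym e)) ⟩
    ∑[ σ ← perms n ] (𝟙 (b σ ≟ᵀ V) * cP X Y (d σ))
      ≈⟨ ∑-inverse n (λ σ → 𝟙 (b σ ≟ᵀ V) * cP X Y (d σ)) ⟨
    ∑[ δ ← perms n ] (𝟙 (b (inverse δ) ≟ᵀ V) * cP X Y (d (inverse δ)))
      ≈⟨ ∑-cong (perms n) (λ {δ} i → *-cong (reflexive (cong (λ T → 𝟙 (T ≟ᵀ V)) (bst-inverse (perms-fills n i))))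
           (≈-trans (reflexive (cong (cP X Y) (decr-inverse (perms-fills n i)))) (cP-splitsTo X Y (perms-fills n i)))) ⟩
    ∑[ δ ← perms n ] (𝟙 (d δ ≟ᵀ V) * splitsTo X Y δ)
      ≈⟨ ∑-cong (perms n) (λ {δ} i → ≈-trans (*-congˡ (≈-sym (splitsTo-∑ X Y (perms-fills n i)))) (distribute δ)) ⟩
    ∑[ δ ← perms n ] ∑[ σ ← perms k ] ∑[ τ ← perms l ] (𝟙 (b σ ≟ᵀ X) *
        (𝟙 (b τ ≟ᵀ Y) * (split k δ (σ , τ) * 𝟙 (d δ ≟ᵀ V))))
      ≈⟨ ∑-swap (perms n) (perms k) _ ⟩
    ∑[ σ ← perms k ] ∑[ δ ← perms n ] ∑[ τ ← perms l ] (𝟙 (b σ ≟ᵀ X) *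
        (𝟙 (b τ ≟ᵀ Y) * (split k δ (σ , τ) * 𝟙 (d δ ≟ᵀ V))))
      ≈⟨ ∑-cong (perms k) (λ {σ} i → ≈-trans (∑-swap (perms n) (perms l) (λ δ τ → 𝟙 (b σ ≟ᵀ X) *
          (𝟙 (b τ ≟ᵀ Y) * (split k δ (σ , τ) * 𝟙 (d δ ≟ᵀ V)))))
           (≈-trans (∑-cong (perms l) (λ {τ} j → collect i j))
               (≈-sym (∑-*ˡ (perms l) (𝟙 (b σ ≟ᵀ X)) (λ τ → 𝟙 (b τ ≟ᵀ Y) * cΔ V (d σ) (d τ)))))) ⟩
    ∑[ σ ← perms k ] (𝟙 (b σ ≟ᵀ X) * ∑[ τ ← perms l ] (𝟙 (b τ ≟ᵀ Y) * cΔ V (d σ) (d τ)))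
      ≈⟨ ≈-trans (ev-Q′ X (λ R → ev (Q′ Y) (cΔ V R))) (∑-cong (perms k) (λ {σ} _ → *-congˡ (ev-Q′ Y (cΔ V (d σ))))) ⟨
    ev (Q′ X) (λ R → ev (Q′ Y) (cΔ V R))
      ≈⟨ ev-Q′-cong X (λ R p → ev-Q′-cong Y (λ S q → ≈-trans
           (*-congʳ (𝟙-yes ((size R ℕ.+ size S) ≟ℕ size V) (trans (cong₂ ℕ._+_ p q) e))) (*-identityˡ _))) ⟨
    coproductForm V X Y ∎
    where
    k l n : ℕ
    k = size X
    l = size Y
    n = k ℕ.+ l
    distribute : ∀ δ → 𝟙 (d δ ≟ᵀ V) * ∑[ σ ← perms k ] (𝟙 (b σ ≟ᵀ X) * ∑[ τ ← perms l ]
        (𝟙 (b τ ≟ᵀ Y) * split k δ (σ , τ)))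
                 ≈ ∑[ σ ← perms k ] ∑[ τ ← perms l ] (𝟙 (b σ ≟ᵀ X) *
                     (𝟙 (b τ ≟ᵀ Y) * (split k δ (σ , τ) * 𝟙 (d δ ≟ᵀ V))))
    distribute δ = ≈-trans (*-comm _ _) (≈-trans (∑-*ʳ (perms k) (𝟙 (d δ ≟ᵀ V)) _) (∑-cong (perms k)
        (λ {σ} _ → ≈-trans (*-assoc _ _ _)
      (≈-trans (*-congˡ (∑-*ʳ (perms l) (𝟙 (d δ ≟ᵀ V)) (λ τ → 𝟙 (b τ ≟ᵀ Y) * split k δ (σ , τ))))
        (≈-trans (∑-*ˡ (perms l) (𝟙 (b σ ≟ᵀ X)) (λ τ → 𝟙 (b τ ≟ᵀ Y) * split k δ (σ , τ) * 𝟙 (d δ ≟ᵀ V)))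
          (∑-cong (perms l) (λ _ → *-congˡ (*-assoc _ _ _))))))))
    collect : ∀ {σ τ} → σ ∈ perms k → τ ∈ perms l →
              ∑[ δ ← perms n ] (𝟙 (b σ ≟ᵀ X) * (𝟙 (b τ ≟ᵀ Y) * (split k δ (σ , τ) * 𝟙 (d δ ≟ᵀ V))))
              ≈ 𝟙 (b σ ≟ᵀ X) * (𝟙 (b τ ≟ᵀ Y) * cΔ V (d σ) (d τ))
    collect {σ} {τ} i j = begin
      ∑[ δ ← perms n ] (𝟙 (b σ ≟ᵀ X) * (𝟙 (b τ ≟ᵀ Y) * (split k δ (σ , τ) * 𝟙 (d δ ≟ᵀ V))))
        ≈⟨ ∑-*ˡ (perms n) (𝟙 (b σ ≟ᵀ X)) (λ δ → 𝟙 (b τ ≟ᵀ Y) * (split k δ (σ , τ) * 𝟙 (d δ ≟ᵀ V))) ⟨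
      𝟙 (b σ ≟ᵀ X) * ∑[ δ ← perms n ] (𝟙 (b τ ≟ᵀ Y) * (split k δ (σ , τ) * 𝟙 (d δ ≟ᵀ V)))
        ≈⟨ *-congˡ (∑-*ˡ (perms n) (𝟙 (b τ ≟ᵀ Y)) (λ δ → split k δ (σ , τ) * 𝟙 (d δ ≟ᵀ V))) ⟨
      𝟙 (b σ ≟ᵀ X) * (𝟙 (b τ ≟ᵀ Y) * ∑[ δ ← perms n ] (split k δ (σ , τ) * 𝟙 (d δ ≟ᵀ V)))
        ≈⟨ *-congˡ (*-congˡ (≈-trans (≈-sym (∑-shuffle Fσ Fτ (λ δ → 𝟙 (d δ ≟ᵀ V))))
             (≈-trans (∑-shifted-shuffle-decr Fσ Fτ (λ T → 𝟙 (T ≟ᵀ V)))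
               (≈-sym (cΔ-shuffleT V (d σ) (d τ) (trans (cong₂ ℕ._+_ (size-d Fσ) (size-d Fτ)) e)))))) ⟩
      𝟙 (b σ ≟ᵀ X) * (𝟙 (b τ ≟ᵀ Y) * cΔ V (d σ) (d τ)) ∎
      where
      Fσ : Fills 0 k σ
      Fσ = perms-fills k i
      Fτ : Fills 0 l τ
      Fτ = perms-fills l j

  -- Bijectivity

  Preimage : PBT* → Set _
  Preimage y = Σ PBT (λ x → φ x ≈ᴾ y)

  coeff-∷ : ∀ k R (y : PBT*) V → coeff _≟ᵀ_ ((k , R) ∷ y) V ≈ k * 𝟙 (R ≟ᵀ V) + coeff _≟ᵀ_ y V
  coeff-∷ k R y V = ≈-trans (coeff-ev _≟ᵀ_ ((k , R) ∷ y) V) (+-congˡ (≈-sym (coeff-ev _≟ᵀ_ y V)))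

  coeff-basis : ∀ R V → coeff _≟ᵀ_ (basis R) V ≈ 𝟙 (R ≟ᵀ V)
  coeff-basis R V = ≈-trans (coeff-∷ 1# R [] V) (≈-trans (x+0 _) (*-identityˡ _))

  preimage-lin : ∀ y → (∀ T → Preimage (basis T)) → Preimage y
  preimage-lin y pre = lin (proj₁ ∘ pre) y , λ T → begin
    coeff _≟ᵀ_ (φ (lin (proj₁ ∘ pre) y)) T ≈⟨ coeff-φ (lin (proj₁ ∘ pre) y) T ⟩
    ev (lin (proj₁ ∘ pre) y) (λ S → M S T) ≈⟨ ev-lin (proj₁ ∘ pre) y (λ S → M S T) ⟩
    ev y (λ R → ev (proj₁ (pre R)) (λ S → M S T))
      ≈⟨ ev-cong y (λ R → ≈-trans (≈-sym (coeff-φ (proj₁ (pre R)) T)) (≈-trans (proj₂ (pre R) T) (coeff-basis R T))) ⟩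
    ev y (λ R → 𝟙 (R ≟ᵀ T)) ≈⟨ coeff-ev _≟ᵀ_ y T ⟨
    coeff _≟ᵀ_ y T ∎

  -- Splits off the part of `y` along `T`. Every other entry has a preimage by assumption, and these
  -- are collected in `x`; `T` is exempt because its preimage is what is being built.
  reduce : ∀ T (y : PBT*) → All (λ p → proj₂ p ≢ T → Preimage (basis (proj₂ p))) y →
           Σ PBT (λ x → ∀ V → coeff _≟ᵀ_ y V ≈ coeff _≟ᵀ_ y T * 𝟙 (T ≟ᵀ V) + coeff _≟ᵀ_ (φ x) V)
  reduce T []            []      = [] , λ V → ≈-sym (≈-trans (x+0 _) (zeroˡ _))
  reduce T ((k , R) ∷ y) (p ∷ q) with reduce T y q | R ≟ᵀ T
  ... | x , h | yes refl = x , λ V → begin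
    coeff _≟ᵀ_ ((k , R) ∷ y) V
      ≈⟨ coeff-∷ k R y V ⟩
    k * 𝟙 (R ≟ᵀ V) + coeff _≟ᵀ_ y V
      ≈⟨ +-congˡ (h V) ⟩
    k * 𝟙 (R ≟ᵀ V) + (coeff _≟ᵀ_ y R * 𝟙 (R ≟ᵀ V) + coeff _≟ᵀ_ (φ x) V)
      ≈⟨ ≈-trans (≈-sym (+-assocᴷ _ _ _)) (+-congʳ (≈-sym (distribʳ _ _ _))) ⟩
    (k + coeff _≟ᵀ_ y R) * 𝟙 (R ≟ᵀ V) + coeff _≟ᵀ_ (φ x) V ∎
  ... | x , h | no R≢T = scale k z ++ x , λ V → begin
    coeff _≟ᵀ_ ((k , R) ∷ y) V
      ≈⟨ coeff-∷ k R y V ⟩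
    k * 𝟙 (R ≟ᵀ V) + coeff _≟ᵀ_ y V
      ≈⟨ +-cong (*-congˡ (≈-sym (≈-trans (≈-sym (coeff-φ z V)) (≈-trans (proj₂ (p R≢T) V) (coeff-basis R V))))) (h V) ⟩
    k * ev z (λ S → M S V) + (coeff _≟ᵀ_ y T * 𝟙 (T ≟ᵀ V) + coeff _≟ᵀ_ (φ x) V)
      ≈⟨ x+yz≈y+xz _ _ _ ⟩
    coeff _≟ᵀ_ y T * 𝟙 (T ≟ᵀ V) + (k * ev z (λ S → M S V) + coeff _≟ᵀ_ (φ x) V)
      ≈⟨ +-congˡ (≈-trans (coeff-φ (scale k z ++ x) V) (≈-trans (∑-++ (scale k z) x _)
           (+-cong (ev-scale k z (λ S → M S V)) (≈-sym (coeff-φ x V))))) ⟨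
    coeff _≟ᵀ_ y T * 𝟙 (T ≟ᵀ V) + coeff _≟ᵀ_ (φ (scale k z ++ x)) V ∎
    where
    z : PBT
    z = proj₁ (p R≢T)

  -- Keeps both reasons for the presence of an entry, membership and the test: the comparison of the
  -- entries of `Q′ G` with `G` needs the two.
  all-select : ∀ {a p q} {A : Set a} {B : Set} {P : A → Set p} {Z : B → Set q} (d : ∀ x → Dec (P x)) (h : A → B) xs →
               (∀ {x} → x ∈ xs → P x → Z (h x)) →
               All (Z ∘ proj₂) (concatMap (λ x → if ⌊ d x ⌋ then (1# , h x) ∷ [] else []) xs)
  all-select d h []       f = []
  all-select d h (x ∷ xs) f with d x
  ... | yes p = f (here refl) p ∷ all-select d h xs (f ∘ there)
  ... | no _  = all-select d h xs (f ∘ there)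

  ∑𝟙-natural : ∀ {a p} {A : Set a} {P : A → Set p} (d : ∀ x → Dec (P x)) xs → ∃ λ j → ∑[ x ← xs ] 𝟙 (d x) ≈ fromℕ K j
  ∑𝟙-natural d []       = 0 , ≈-refl
  ∑𝟙-natural d (x ∷ xs) with ∑𝟙-natural d xs | d x
  ... | j , e | dx@(yes p) = suc j , +-cong (𝟙-yes dx p) e
  ... | j , e | dx@(no ¬p) = j , ≈-trans (+-cong (𝟙-no dx ¬p) e) (0+x _)

  -- The form `fromℕ K (suc j)` is the one that `CharacteristicZero` declares nonzero.
  ∑𝟙-positive : ∀ {a p} {A : Set a} {P : A → Set p} (d : ∀ x → Dec (P x)) {xs x} → x ∈ xs → P x →
                ∃ λ j → ∑[ x ← xs ] 𝟙 (d x) ≈ fromℕ K (suc j)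
  ∑𝟙-positive d {x ∷ xs} (here refl) p with ∑𝟙-natural d xs
  ... | j , e = j , +-cong (𝟙-yes (d x) p) e
  ∑𝟙-positive d {y ∷ xs} (there i) p with ∑𝟙-positive d i p | d y
  ... | j , e | dy@(yes q) = suc j , +-cong (𝟙-yes dy q) e
  ... | j , e | dy@(no ¬q) = j , ≈-trans (+-cong (𝟙-no dy ¬q) e) (0+x _)

  -- `leastPerm T` is one of the permutations counted by this entry.
  M-diagonal : ∀ T → ∃ λ j → M (leastBst T) T ≈ fromℕ K (suc j)
  M-diagonal T with ∑𝟙-positive (λ σ → (b σ ≟ᵀ leastBst T) ×-dec (d σ ≟ᵀ T)) {perms (size (leastBst T))}
    (fills-perms _ (subst (λ m → Fills 0 m (leastPerm T)) (sym size≡) (leastPerm-fills T)))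
    (shape-bst-leastPerm T , shape-decr-leastPerm T)
    where
    size≡ : size (leastBst T) ≡ size T
    size≡ = trans (cong size (sym (shape-bst-leastPerm T))) (size-b (leastPerm-fills T))
  ... | j , e = j , ≈-trans (M-∑ (leastBst T) T) (≈-trans (∑-cong (perms (size (leastBst T)))
    (λ {σ} _ → 𝟙-× (b σ ≟ᵀ leastBst T) (d σ ≟ᵀ T) ((b σ ≟ᵀ leastBst T) ×-dec (d σ ≟ᵀ T)) _,_ proj₁ proj₂)) e)

  module _ (char0 : CharacteristicZero K) where

    basis-preimage : ∀ T → Preimage (basis T)
    basis-preimage T = go T (≺-wellFounded (leastBst T))
      where
      go : ∀ T → Acc _≺_ (leastBst T) → Preimage (basis T)
      -- `reduce` writes `Q′ G` as `M G T` times the basis element of `T` plus `φ x`; solving for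
      -- that element gives the preimage below.
      go T (acc rs) = scale m⁻¹ (basis G ++ scale (- 1#) x) , λ V → begin
        coeff _≟ᵀ_ (φ (scale m⁻¹ (basis G ++ scale (- 1#) x))) V
          ≈⟨ coeff-φ (scale m⁻¹ (basis G ++ scale (- 1#) x)) V ⟩
        ev (scale m⁻¹ (basis G ++ scale (- 1#) x)) (λ S → M S V)
          ≈⟨ ev-scale m⁻¹ (basis G ++ scale (- 1#) x) (λ S → M S V) ⟩
        m⁻¹ * (1# * M G V + ev (scale (- 1#) x) (λ S → M S V))
          ≈⟨ *-congˡ (+-cong (≈-trans (*-identityˡ _) (proj₂ reduced V))
               (≈-trans (ev-scale (- 1#) x (λ S → M S V)) (*-congˡ (≈-sym (coeff-φ x V))))) ⟩
        m⁻¹ * (M G T * 𝟙 (T ≟ᵀ V) + coeff _≟ᵀ_ (φ x) V + - 1# * coeff _≟ᵀ_ (φ x) V)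
          ≈⟨ *-congˡ (≈-trans (+-assocᴷ _ _ _) (≈-trans (+-congˡ (cancel _)) (x+0 _))) ⟩
        m⁻¹ * (M G T * 𝟙 (T ≟ᵀ V))
          ≈⟨ *-assoc _ _ _ ⟨
        m⁻¹ * M G T * 𝟙 (T ≟ᵀ V)
          ≈⟨ *-congʳ (≈-trans (*-comm _ _) (proj₂ invertible)) ⟩
        1# * 𝟙 (T ≟ᵀ V)
          ≈⟨ *-identityˡ _ ⟩
        𝟙 (T ≟ᵀ V)
          ≈⟨ coeff-basis T V ⟨
        coeff _≟ᵀ_ (basis T) V ∎
        where
        G : BT
        G = leastBst T
        invertible : Σ Carrier (λ y → M G T * y ≈ 1#)
        invertible = Field.inverse K (M G T) (λ e → char0 (proj₁ (M-diagonal T)) (≈-trans (≈-sym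
            (proj₂ (M-diagonal T))) e))
        m⁻¹ : Carrier
        m⁻¹ = proj₁ invertible
        -- For an entry `R` of `Q′ G`, `leastBst-≼` gives `leastBst R ≼ G`. Equality would mean
        -- `R ≡ T` by injectivity of `leastBst`; otherwise `R` is earlier in the recursion.
        smaller : ∀ {σ} → σ ∈ perms (size G) → b σ ≡ G → b (inverse σ) ≢ T → Preimage (basis (b (inverse σ)))
        smaller {σ} i e ne with subst₂ (λ R S → leastBst R ≼ S) (sym
            (bst-inverse (perms-fills (size G) i))) e (leastBst-≼ σ)
        ... | inj₁ p = contradiction (leastBst-injective _ T p) ne
        ... | inj₂ p = go (b (inverse σ)) (rs p)
        reduced = reduce T (Q′ G) (all-select {Z = λ R → R ≢ T → Preimage (basis R)} (λ σ → b σ ≟ᵀ G) (b ∘ inverse)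
            (perms (size G)) smaller)
        x : PBT
        x = proj₁ reduced
        cancel : ∀ a → a + - 1# * a ≈ 0#
        cancel a = begin
          a + - 1# * a      ≈⟨ +-congʳ (*-identityˡ a) ⟨
          1# * a + - 1# * a ≈⟨ distribʳ a 1# (- 1#) ⟨
          (1# + - 1#) * a   ≈⟨ *-congʳ (-‿inverseʳ 1#) ⟩
          0# * a            ≈⟨ zeroˡ a ⟩
          0# ∎

    φ-surjective : ∀ y → Preimage y
    φ-surjective y = preimage-lin y basis-preimage

    -- By symmetry of `M`, `φ` is self-adjoint for the pairing by coefficients. If `z` is a preimage
    -- of `basis T`, the coefficient of `x` at `T` is the pairing of `φ x` with `z`, hence
    -- determined by `φ x`.
    φ-injective : ∀ x y → φ x ≈ᴾ φ y → x ≈ᴾ y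
    φ-injective x y h T = ≈-trans (through x) (≈-trans (ev-cong z h) (≈-sym (through y)))
      where
      z : PBT
      z = proj₁ (basis-preimage T)
      through : ∀ x → coeff _≟ᵀ_ x T ≈ ev z (coeff _≟ᵀ_ (φ x))
      through x = begin
        coeff _≟ᵀ_ x T ≈⟨ coeff-ev _≟ᵀ_ x T ⟩
        ev x (λ S → 𝟙 (S ≟ᵀ T))
          ≈⟨ ev-cong x (λ S → ≈-trans (𝟙-cong (S ≟ᵀ T) (T ≟ᵀ S) sym sym) (≈-trans (≈-sym (coeff-basis T S))
               (≈-trans (≈-sym (proj₂ (basis-preimage T) S)) (≈-trans (coeff-φ z S) (ev-cong z (λ R → M-sym R S)))))) ⟩
        ev x (λ S → ev z (λ R → M S R)) ≈⟨ ev-swap x z M ⟩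
        ev z (λ R → ev x (λ S → M S R)) ≈⟨ ev-cong z (λ R → coeff-φ x R) ⟨
        ev z (coeff _≟ᵀ_ (φ x)) ∎

mainTheorem15 : ∀ {c ℓ} (K : Field c ℓ) → CharacteristicZero K →
    let open FreeModule K in
    ((x y : PBT) → φ x ≈ᴾ φ y → x ≈ᴾ y)
    × ((y : PBT*) → Σ PBT (λ x → φ x ≈ᴾ y))
    × ((T′ T″ : BT) → φ (mulP T′ T″) ≈ᴾ (Q′ T′ ·Q Q′ T″))
    × ((T : BT) → φ⊗φ (ΔP T) ≈² ΔQlin (Q′ T))
mainTheorem15 K char0 =
  φ-injective char0 ,
  φ-surjective char0 ,
  (λ X Y V → ≈-trans (coeff-φ-mulP X Y V) (≈-trans (productForm≈coproductForm V X Y) (≈-sym (coeff-Q′·Q′ X Y V)))) ,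
  (λ T → λ { (X , Y) → ≈-trans (coeff-φ⊗φ T X Y) (≈-trans (≈-sym (productForm≈coproductForm T X Y))
      (≈-sym (coeff-ΔQ T X Y))) })
  where
  open OverField K
  open Field K using () renaming (sym to ≈-sym; trans to ≈-trans)
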